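{- For every integer $k\ge1$, the friendship graph $F_k=K_1\vee kK_2$ is determined by its distance spectrum; that is, for any connected graph $H$, $\mathrm{Spec}_D(H)=\mathrm{Spec}_D(F_k)$ implies $H\cong F_k$.
   Context: All graphs are finite and simple. For a connected graph $G$ with vertices $v_1,\ldots,v_n$, the distance matrix is $D(G)=(d(v_i,v_j))_{n\times n}$, where $d(v_i,v_j)$ is the length of a shortest path; the distance spectrum $\mathrm{Spec}_D(G)$ is the multiset of eigenvalues of $D(G)$ (with multiplicities). $F_k$ consists of $k$ edge-disjoint triangles all meeting in one common vertex, i.e. it is the join $K_1\vee kK_2$ of a single vertex with the disjoint union of $k$ copies of $K_2$. -}

module Defs where

open import Algebra.Bundles.Raw using (RawRing)
import Algebra.Definitions.RawSemiring as RawSemiringDefs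
open import Data.Bool.Base using (Bool; true; false; not; _∧_; T)
open import Data.Empty using (⊥-elim)
open import Data.Fin.Base using (Fin; zero; suc; toℕ; fromℕ; inject₁; punchIn; splitAt; quotient; remainder)
open import Data.Fin.Properties using () renaming (_≟_ to _≟ᶠ_)
import Data.Integer.Base as ℤ
open import Data.Nat.Base as ℕ using (ℕ; zero; suc)
import Data.Nat.Properties as ℕ
open import Data.Product.Base using (Σ; ∃; _×_; _,_)
open import Data.Rational.Base as ℚ using (ℚ; 0ℚ; 1ℚ; ½; ∣_∣)
import Data.Rational.Properties as ℚ
open import Data.Rational.Solver using (module +-*-Solver)
open import Data.Sum.Base using (_⊎_; inj₁; inj₂)
open import Data.Vec.Base using (Vec; lookup; toList)
open import Function.Bundles using (_↔_; module Inverse)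
open import Function.Definitions using (Injective)
open import Level using (0ℓ)
open import Relation.Binary.Bundles using (Setoid)
open import Relation.Binary.PropositionalEquality.Core
  using (_≡_; refl; sym; trans; cong; cong₂; subst)
open import Relation.Nullary using (does; yes; no)
import Data.List.Relation.Binary.Permutation.Setoid as Permutation

IsCauchy : (ℕ → ℚ) → Set
IsCauchy s = ∀ ε → 0ℚ ℚ.< ε →
  Σ ℕ λ N → ∀ m n → N ℕ.≤ m → N ℕ.≤ n → ∣ s m ℚ.- s n ∣ ℚ.< ε

-- Cauchy sequences of rationals; _≃_ below is their equality as reals.
record ℝ : Set where
  constructor mkℝ
  field
    seq    : ℕ → ℚ
    cauchy : IsCauchy seq

open ℝ public

infix 4 _≃_

record _≃_ (x y : ℝ) : Set where
  constructor mk≃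
  field
    close : ∀ ε → 0ℚ ℚ.< ε →
      Σ ℕ λ N → ∀ n → N ℕ.≤ n → ∣ seq x n ℚ.- seq y n ∣ ℚ.< ε

open _≃_ public

module _ where
  open +-*-Solver

  negate-sub : ∀ a b → b ℚ.- a ≡ (ℚ.- a) ℚ.- (ℚ.- b)
  negate-sub = solve 2 (λ a b → b :- a := (:- a) :- (:- b)) refl

  sub-swap : ∀ a b → a ℚ.- b ≡ ℚ.- (b ℚ.- a)
  sub-swap = solve 2 (λ a b → a :- b := :- (b :- a)) refl

  sub-add : ∀ a b → (a ℚ.- b) ℚ.+ b ≡ a
  sub-add = solve 2 (λ a b → (a :- b) :+ b := a) refl

  telescope : ∀ a b c → (a ℚ.- b) ℚ.+ (b ℚ.- c) ≡ a ℚ.- c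
  telescope = solve 3 (λ a b c → (a :- b) :+ (b :- c) := a :- c) refl

  sum-sub : ∀ a b c d → (a ℚ.- c) ℚ.+ (b ℚ.- d) ≡ (a ℚ.+ b) ℚ.- (c ℚ.+ d)
  sum-sub = solve 4 (λ a b c d → (a :- c) :+ (b :- d) := (a :+ b) :- (c :+ d)) refl

  prod-sub : ∀ a b c d → a ℚ.* (b ℚ.- d) ℚ.+ d ℚ.* (a ℚ.- c) ≡ a ℚ.* b ℚ.- c ℚ.* d
  prod-sub = solve 4 (λ a b c d → a :* (b :- d) :+ d :* (a :- c) := a :* b :- c :* d) refl

half>0 : ∀ {ε} → 0ℚ ℚ.< ε → 0ℚ ℚ.< ½ ℚ.* ε
half>0 {ε} ε>0 = ℚ.positive⁻¹ (½ ℚ.* ε) {{ℚ.pos*pos⇒pos ½ ε {{ℚ.positive ε>0}}}}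

half+half : ∀ ε → ½ ℚ.* ε ℚ.+ ½ ℚ.* ε ≡ ε
half+half ε = trans (sym (ℚ.*-distribʳ-+ ε ½ ½)) (ℚ.*-identityˡ ε)

+-close : ∀ ε a b c → a ℚ.+ b ≡ c →
  ∣ a ∣ ℚ.< ½ ℚ.* ε → ∣ b ∣ ℚ.< ½ ℚ.* ε → ∣ c ∣ ℚ.< ε
+-close ε a b _ refl a< b< = ℚ.≤-<-trans (ℚ.∣p+q∣≤∣p∣+∣q∣ a b)
  (subst (∣ a ∣ ℚ.+ ∣ b ∣ ℚ.<_) (half+half ε) (ℚ.+-mono-< a< b<))

sum-close : ∀ ε a b c d → ∣ a ℚ.- c ∣ ℚ.< ½ ℚ.* ε → ∣ b ℚ.- d ∣ ℚ.< ½ ℚ.* ε →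
  ∣ (a ℚ.+ b) ℚ.- (c ℚ.+ d) ∣ ℚ.< ε
sum-close ε a b c d = +-close ε (a ℚ.- c) (b ℚ.- d) ((a ℚ.+ b) ℚ.- (c ℚ.+ d)) (sum-sub a b c d)

prod-close : ∀ ε a b c d →
  ∣ a ℚ.* (b ℚ.- d) ∣ ℚ.< ½ ℚ.* ε → ∣ d ℚ.* (a ℚ.- c) ∣ ℚ.< ½ ℚ.* ε →
  ∣ a ℚ.* b ℚ.- c ℚ.* d ∣ ℚ.< ε
prod-close ε a b c d =
  +-close ε (a ℚ.* (b ℚ.- d)) (d ℚ.* (a ℚ.- c)) (a ℚ.* b ℚ.- c ℚ.* d) (prod-sub a b c d)

trans-close : ∀ ε a b c → ∣ a ℚ.- b ∣ ℚ.< ½ ℚ.* ε → ∣ b ℚ.- c ∣ ℚ.< ½ ℚ.* ε →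
  ∣ a ℚ.- c ∣ ℚ.< ε
trans-close ε a b c = +-close ε (a ℚ.- b) (b ℚ.- c) (a ℚ.- c) (telescope a b c)

∣a-a∣ : ∀ a → ∣ a ℚ.- a ∣ ≡ 0ℚ
∣a-a∣ a = cong ∣_∣ (ℚ.+-inverseʳ a)

∣a-b∣-swap : ∀ a b → ∣ a ℚ.- b ∣ ≡ ∣ b ℚ.- a ∣
∣a-b∣-swap a b = trans (cong ∣_∣ (sub-swap a b)) (ℚ.∣-p∣≡∣p∣ (b ℚ.- a))

≤-⊔ˡ : ∀ a b {n} → a ℕ.⊔ b ℕ.≤ n → a ℕ.≤ n
≤-⊔ˡ a b = ℕ.≤-trans (ℕ.m≤m⊔n a b)

≤-⊔ʳ : ∀ a b {n} → a ℕ.⊔ b ℕ.≤ n → b ℕ.≤ n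
≤-⊔ʳ a b = ℕ.≤-trans (ℕ.m≤n⊔m a b)

bounded : ∀ {s} → IsCauchy s →
  Σ ℚ λ B → (0ℚ ℚ.< B) × Σ ℕ λ N → ∀ n → N ℕ.≤ n → ∣ s n ∣ ℚ.< B
bounded {s} c with c 1ℚ (ℚ.positive⁻¹ 1ℚ)
... | N , h = 1ℚ ℚ.+ ∣ s N ∣ , B>0 , N , bound
  where
  B>0 : 0ℚ ℚ.< 1ℚ ℚ.+ ∣ s N ∣
  B>0 = ℚ.+-mono-<-≤ (ℚ.positive⁻¹ 1ℚ) (ℚ.0≤∣p∣ (s N))
  bound : ∀ n → N ℕ.≤ n → ∣ s n ∣ ℚ.< 1ℚ ℚ.+ ∣ s N ∣
  bound n N≤n = ℚ.≤-<-trans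
    (subst (λ a → ∣ a ∣ ℚ.≤ ∣ s n ℚ.- s N ∣ ℚ.+ ∣ s N ∣)
      (sub-add (s n) (s N))
      (ℚ.∣p+q∣≤∣p∣+∣q∣ (s n ℚ.- s N) (s N)))
    (ℚ.+-monoˡ-< ∣ s N ∣ (h n N N≤n ℕ.≤-refl))

shrink : ∀ M ε → 0ℚ ℚ.< M → 0ℚ ℚ.< ε → Σ ℚ λ δ → (0ℚ ℚ.< δ) ×
  (∀ a b → ∣ a ∣ ℚ.< M → ∣ b ∣ ℚ.< δ → ∣ a ℚ.* b ∣ ℚ.< ε)
shrink M ε M>0 ε>0 = 1/M ℚ.* ε , δ>0 , bound
  where
  open ℚ.≤-Reasoning
  instance
    M-pos : ℚ.Positive M
    M-pos = ℚ.positive M>0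
    M-nonZero : ℚ.NonZero M
    M-nonZero = ℚ.pos⇒nonZero M
  1/M : ℚ
  1/M = ℚ.1/ M
  δ>0 : 0ℚ ℚ.< 1/M ℚ.* ε
  δ>0 = ℚ.positive⁻¹ (1/M ℚ.* ε) {{ℚ.pos*pos⇒pos 1/M {{ℚ.1/pos⇒pos M}} ε {{ℚ.positive ε>0}}}}
  bound : ∀ a b → ∣ a ∣ ℚ.< M → ∣ b ∣ ℚ.< 1/M ℚ.* ε → ∣ a ℚ.* b ∣ ℚ.< ε
  bound a b a< b< = begin-strict
    ∣ a ℚ.* b ∣          ≡⟨ ℚ.∣p*q∣≡∣p∣*∣q∣ a b ⟩
    ∣ a ∣ ℚ.* ∣ b ∣      ≤⟨ ℚ.*-monoʳ-≤-nonNeg ∣ b ∣ {{ℚ.∣-∣-nonNeg b}} (ℚ.<⇒≤ a<) ⟩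
    M ℚ.* ∣ b ∣          <⟨ ℚ.*-monoʳ-<-pos M b< ⟩
    M ℚ.* (1/M ℚ.* ε)    ≡⟨ sym (ℚ.*-assoc M 1/M ε) ⟩
    M ℚ.* 1/M ℚ.* ε      ≡⟨ cong (ℚ._* ε) (ℚ.*-inverseʳ M) ⟩
    1ℚ ℚ.* ε             ≡⟨ ℚ.*-identityˡ ε ⟩
    ε                    ∎

abstract
  const-cauchy : ∀ q → IsCauchy (λ _ → q)
  const-cauchy q ε ε>0 = 0 , λ _ _ _ _ → subst (ℚ._< ε) (sym (∣a-a∣ q)) ε>0

  +-cauchy : ∀ {s t} → IsCauchy s → IsCauchy t → IsCauchy (λ n → s n ℚ.+ t n)
  +-cauchy {s} {t} cs ct ε ε>0 =
    let N₁ , h₁ = cs (½ ℚ.* ε) (half>0 ε>0)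
        N₂ , h₂ = ct (½ ℚ.* ε) (half>0 ε>0)
    in N₁ ℕ.⊔ N₂ , λ m n m≥ n≥ →
       sum-close ε (s m) (t m) (s n) (t n)
         (h₁ m n (≤-⊔ˡ N₁ N₂ m≥) (≤-⊔ˡ N₁ N₂ n≥))
         (h₂ m n (≤-⊔ʳ N₁ N₂ m≥) (≤-⊔ʳ N₁ N₂ n≥))

  neg-cauchy : ∀ {s} → IsCauchy s → IsCauchy (λ n → ℚ.- s n)
  neg-cauchy {s} cs ε ε>0 =
    let N , h = cs ε ε>0
    in N , λ m n m≥ n≥ →
       subst (λ a → ∣ a ∣ ℚ.< ε) (negate-sub (s m) (s n)) (h n m n≥ m≥)

  *-cauchy : ∀ {s t} → IsCauchy s → IsCauchy t → IsCauchy (λ n → s n ℚ.* t n)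
  *-cauchy {s} {t} cs ct ε ε>0 =
    let B , B>0 , N₁ , b₁ = bounded cs
        C , C>0 , N₂ , b₂ = bounded ct
        δ₁ , δ₁>0 , p₁    = shrink B (½ ℚ.* ε) B>0 (half>0 ε>0)
        δ₂ , δ₂>0 , p₂    = shrink C (½ ℚ.* ε) C>0 (half>0 ε>0)
        N₃ , h₁           = ct δ₁ δ₁>0
        N₄ , h₂           = cs δ₂ δ₂>0
        N₁₂               = N₁ ℕ.⊔ N₂
        N₃₄               = N₃ ℕ.⊔ N₄
    in N₁₂ ℕ.⊔ N₃₄ , λ m n m≥ n≥ →
      let m≥₁₂ = ≤-⊔ˡ N₁₂ N₃₄ m≥
          n≥₁₂ = ≤-⊔ˡ N₁₂ N₃₄ n≥
          m≥₃₄ = ≤-⊔ʳ N₁₂ N₃₄ m≥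
          n≥₃₄ = ≤-⊔ʳ N₁₂ N₃₄ n≥
      in prod-close ε (s m) (t m) (s n) (t n)
           (p₁ (s m) (t m ℚ.- t n) (b₁ m (≤-⊔ˡ N₁ N₂ m≥₁₂))
             (h₁ m n (≤-⊔ˡ N₃ N₄ m≥₃₄) (≤-⊔ˡ N₃ N₄ n≥₃₄)))
           (p₂ (t n) (s m ℚ.- s n) (b₂ n (≤-⊔ʳ N₁ N₂ n≥₁₂))
             (h₂ m n (≤-⊔ʳ N₃ N₄ m≥₃₄) (≤-⊔ʳ N₃ N₄ n≥₃₄)))

infixl 6 _+ᴿ_
infixl 7 _*ᴿ_
infix  8 -ᴿ_

fromℚ : ℚ → ℝ
fromℚ q = mkℝ (λ _ → q) (const-cauchy q)

_+ᴿ_ : ℝ → ℝ → ℝ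
x +ᴿ y = mkℝ (λ n → seq x n ℚ.+ seq y n) (+-cauchy {seq x} {seq y} (cauchy x) (cauchy y))

-ᴿ_ : ℝ → ℝ
-ᴿ x = mkℝ (λ n → ℚ.- seq x n) (neg-cauchy {seq x} (cauchy x))

_*ᴿ_ : ℝ → ℝ → ℝ
x *ᴿ y = mkℝ (λ n → seq x n ℚ.* seq y n) (*-cauchy {seq x} {seq y} (cauchy x) (cauchy y))

≃-refl : ∀ {x} → x ≃ x
≃-refl {x} = mk≃ λ ε ε>0 → 0 , λ n _ → subst (ℚ._< ε) (sym (∣a-a∣ (seq x n))) ε>0

≃-sym : ∀ {x y} → x ≃ y → y ≃ x
≃-sym {x} {y} (mk≃ p) = mk≃ λ ε ε>0 →
  let N , h = p ε ε>0
  in N , λ n n≥ → subst (ℚ._< ε) (∣a-b∣-swap (seq x n) (seq y n)) (h n n≥)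

≃-trans : ∀ {x y z} → x ≃ y → y ≃ z → x ≃ z
≃-trans {x} {y} {z} (mk≃ p) (mk≃ q) = mk≃ λ ε ε>0 →
  let N₁ , h₁ = p (½ ℚ.* ε) (half>0 ε>0)
      N₂ , h₂ = q (½ ℚ.* ε) (half>0 ε>0)
  in N₁ ℕ.⊔ N₂ , λ n n≥ →
     trans-close ε (seq x n) (seq y n) (seq z n)
       (h₁ n (≤-⊔ˡ N₁ N₂ n≥)) (h₂ n (≤-⊔ʳ N₁ N₂ n≥))

ℝ-setoid : Setoid 0ℓ 0ℓ
ℝ-setoid = record
  { Carrier       = ℝ
  ; _≈_           = _≃_
  ; isEquivalence = record { refl = ≃-refl ; sym = ≃-sym ; trans = ≃-trans }
  }

ℝ-rawRing : RawRing 0ℓ 0ℓ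
ℝ-rawRing = record
  { Carrier = ℝ
  ; _≈_     = _≃_
  ; _+_     = _+ᴿ_
  ; _*_     = _*ᴿ_
  ; -_      = -ᴿ_
  ; 0#      = fromℚ 0ℚ
  ; 1#      = fromℚ 1ℚ
  }

Matrix : ∀ {a} → Set a → ℕ → Set a
Matrix A n = Fin n → Fin n → A

module Determinant {c ℓ} (R : RawRing c ℓ) where
  open RawRing R
  open RawSemiringDefs rawSemiring using (sum; product; _^_) public

  identity : ∀ {n} → Matrix Carrier n
  identity zero    zero    = 1#
  identity zero    (suc j) = 0#
  identity (suc i) zero    = 0#
  identity (suc i) (suc j) = identity i j

  det : ∀ {n} → Matrix Carrier n → Carrier
  det {zero}  A = 1#
  det {suc n} A = sum λ j →
    (- 1#) ^ toℕ j * (A zero j * det (λ i k → A (suc i) (punchIn j k)))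

  -- The value at x of the characteristic polynomial of A.
  charPoly : ∀ {n} → Matrix Carrier n → Carrier → Carrier
  charPoly A x = det λ i j → x * identity i j + (- A i j)

-- The entries of λs are the eigenvalues of A, listed with multiplicity:
-- det (xI - A) = ∏ᵢ (x - λᵢ).  Since ℝ is infinite, agreement at every
-- real x is equality of polynomials.
IsSpectrum : ∀ {n} → Matrix ℝ n → Vec ℝ n → Set
IsSpectrum A λs = ∀ x → charPoly A x ≃ product (λ i → x +ᴿ (-ᴿ lookup λs i))
  where open Determinant ℝ-rawRing

open Permutation ℝ-setoid public using () renaming (_↭_ to _↭ᴿ_)

-- A finite simple graph with vertex set Fin n.
record Graph (n : ℕ) : Set where
  field
    adj        : Fin n → Fin n → Bool
    adj-sym    : ∀ u v → adj u v ≡ adj v u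
    adj-irrefl : ∀ v → adj v v ≡ false

open Graph public

record Path {n} (G : Graph n) (u v : Fin n) (ℓ : ℕ) : Set where
  field
    vertex   : Fin (suc ℓ) → Fin n
    start    : vertex zero ≡ u
    end      : vertex (fromℕ ℓ) ≡ v
    edge     : ∀ (i : Fin ℓ) → T (adj G (vertex (inject₁ i)) (vertex (suc i)))
    distinct : Injective _≡_ _≡_ vertex

-- No non-emptiness is required; the graph with no vertices counts as connected.
Connected : ∀ {n} → Graph n → Set
Connected G = ∀ u v → ∃ λ ℓ → Path G u v ℓ

IsDistance : ∀ {n} → Graph n → Fin n → Fin n → ℕ → Set
IsDistance G u v d = Path G u v d × (∀ ℓ → Path G u v ℓ → d ℕ.≤ ℓ)

IsDistanceMatrix : ∀ {n} → Graph n → Matrix ℕ n → Set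
IsDistanceMatrix G D = ∀ u v → IsDistance G u v (D u v)

fromℕᴿ : ℕ → ℝ
fromℕᴿ d = fromℚ (ℤ.+ d ℚ./ 1)

IsDistanceSpectrum : ∀ {n} → Graph n → Vec ℝ n → Set
IsDistanceSpectrum {n} G λs =
  Σ (Matrix ℕ n) λ D → IsDistanceMatrix G D × IsSpectrum (λ u v → fromℕᴿ (D u v)) λs

-- Multisets of reals are represented by their enumerations, so equality of
-- spectra is permutation up to equality in ℝ; it forces m ≡ n.
SameDistanceSpectrum : ∀ {m n} → Graph m → Graph n → Set
SameDistanceSpectrum {m} {n} G H = Σ (Vec ℝ m) λ λs → Σ (Vec ℝ n) λ μs →
  IsDistanceSpectrum G λs × IsDistanceSpectrum H μs × (toList λs ↭ᴿ toList μs)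

infix 4 _≅_

_≅_ : ∀ {m n} → Graph m → Graph n → Set
_≅_ {m} {n} G H = Σ (Fin m ↔ Fin n) λ f →
  ∀ u v → adj H (Inverse.to f u) (Inverse.to f v) ≡ adj G u v

does-sym : ∀ {n} (u v : Fin n) → does (u ≟ᶠ v) ≡ does (v ≟ᶠ u)
does-sym u v with u ≟ᶠ v | v ≟ᶠ u
... | yes _ | yes _ = refl
... | no  _ | no  _ = refl
... | yes p | no ¬q = ⊥-elim (¬q (sym p))
... | no ¬p | yes q = ⊥-elim (¬p (sym q))

does-refl : ∀ {n} (v : Fin n) → does (v ≟ᶠ v) ≡ true
does-refl v with v ≟ᶠ v
... | yes _ = refl
... | no ¬p = ⊥-elim (¬p refl)

complete : ∀ n → Graph n
complete n = record
  { adj        = λ u v → not (does (u ≟ᶠ v))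
  ; adj-sym    = λ u v → cong not (does-sym u v)
  ; adj-irrefl = λ v → cong not (does-refl v)
  }

-- Disjoint union of k copies of G; the vertex v lies in the copy numbered
-- quotient n v, where it corresponds to the vertex remainder n v of G.
copies : ∀ {n} k → Graph n → Graph (k ℕ.* n)
copies {n} k G = record
  { adj        = λ u v → does (quotient {k} n u ≟ᶠ quotient {k} n v)
                         ∧ adj G (remainder {k} n u) (remainder {k} n v)
  ; adj-sym    = λ u v → cong₂ _∧_ (does-sym (quotient {k} n u) (quotient {k} n v))
                                   (adj-sym G (remainder {k} n u) (remainder {k} n v))
  ; adj-irrefl = λ v → cong₂ _∧_ (does-refl (quotient {k} n v))
                                 (adj-irrefl G (remainder {k} n v))
  }

joinAdj : ∀ {m n} → Graph m → Graph n → Fin m ⊎ Fin n → Fin m ⊎ Fin n → Bool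
joinAdj G H (inj₁ u) (inj₁ v) = adj G u v
joinAdj G H (inj₁ u) (inj₂ v) = true
joinAdj G H (inj₂ u) (inj₁ v) = true
joinAdj G H (inj₂ u) (inj₂ v) = adj H u v

infixr 6 _∨ᴳ_

_∨ᴳ_ : ∀ {m n} → Graph m → Graph n → Graph (m ℕ.+ n)
_∨ᴳ_ {m} {n} G H = record
  { adj        = λ u v → joinAdj G H (splitAt m u) (splitAt m v)
  ; adj-sym    = λ u v → joinSym (splitAt m u) (splitAt m v)
  ; adj-irrefl = λ v → joinIrrefl (splitAt m v)
  }
  where
  joinSym : ∀ u v → joinAdj G H u v ≡ joinAdj G H v u
  joinSym (inj₁ u) (inj₁ v) = adj-sym G u v
  joinSym (inj₁ u) (inj₂ v) = refl
  joinSym (inj₂ u) (inj₁ v) = refl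
  joinSym (inj₂ u) (inj₂ v) = adj-sym H u v
  joinIrrefl : ∀ v → joinAdj G H v v ≡ false
  joinIrrefl (inj₁ v) = adj-irrefl G v
  joinIrrefl (inj₂ v) = adj-irrefl H v

friendship : ∀ k → Graph (1 ℕ.+ k ℕ.* 2)
friendship k = complete 1 ∨ᴳ copies k (complete 2)

{-# OPTIONS --safe #-}

-- Equality of the characteristic polynomials at x = 1/t gives det (I - tD) the same
-- integer values for H and F_k at all positive integers t. The first-order change of
-- det (I - tD) in t is -tr (D adj (I - tD)), and tr (Dᵖ adj) = det · tr Dᵖ + t tr (Dᵖ⁺¹ adj)
-- with det ≡ 1 mod t, so all traces tr Dᵖ agree. The polynomial
-- g = (x + 1)(x + 3)(x² - (4k - 3)x - 2k) annihilates D(F_k), and tr g(D)² = 0 forces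
-- g(D) = 0 for D = D(H) by symmetry. Splitting vectors along the factors of g shows that
-- D + 3 and (D + 1)(D + 3) are positive semidefinite for k ≥ 2.
-- The first excludes distance 3; tr D² then gives 3k edges. With diameter two,
-- D = 2(J - I) - A, and the second says ‖Az‖ ≥ ‖z‖ whenever Σz = 0. Test vectors
-- supported near vertices of degree at most two, whose existence follows from the mean
-- degree being below three, produce a dominating vertex; one more test vector shows
-- that all other vertices have degree two, i.e. that H is a windmill of triangles.

module Submission where

open import Algebra.Bundles using (CommutativeRing)
open import Algebra.Bundles.Raw using (RawRing)
open import Data.Bool.Base using (true; false; if_then_else_; T; not; _∧_)
open import Data.Empty using (⊥; ⊥-elim)
open import Data.Fin.Base
  using (Fin; zero; suc; punchIn; toℕ; quotient; remainder; inject₁; combine; _<_)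
open import Data.Fin.Permutation using (↔⇒≡)
open import Data.Fin.Properties
  using (any?; all?; suc-injective; combine-remQuot; remQuot-combine; <-cmp; <-irrefl; <-trans; _<?_)
  renaming (_≟_ to _≟ᶠ_)
open import Data.Integer.Base as ℤ using (ℤ; +_; 0ℤ; 1ℤ; _+_; _*_; _-_; -_)
import Data.Integer.Properties as ℤ
open import Data.Integer.Tactic.RingSolver using (solve-∀)
open import Data.List.Base as List using (List; []; _∷_; length; filter; allFin; tabulate)
open import Data.List.Membership.Propositional.Properties
  using (∈-filter⁺; ∈-filter⁻; ∈-lookup; ∈-allFin)
import Data.List.Relation.Binary.Permutation.Homogeneous as Homogeneous
import Data.List.Relation.Binary.Permutation.Setoid.Properties as PermutationProperties
open import Data.List.Relation.Binary.Pointwise.Base using (Pointwise; []; _∷_)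
import Data.List.Relation.Unary.All as All
open import Data.List.Relation.Unary.AllPairs using (_∷_)
open import Data.List.Relation.Unary.Any using (index)
open import Data.List.Relation.Unary.Any.Properties using (lookup-index)
open import Data.List.Relation.Unary.Unique.Propositional using (Unique)
open import Data.List.Relation.Unary.Unique.Propositional.Properties using (filter⁺; allFin⁺)
open import Data.Nat.Base as ℕ using (ℕ; zero; suc; _≤_)
import Data.Nat.Properties as ℕ
open import Data.Product.Base using (∃; _×_; _,_; proj₁; proj₂)
open import Data.Rational.Base as ℚ using (ℚ; 0ℚ; 1ℚ; ½)
import Data.Rational.Properties as ℚ
open import Data.Rational.Solver using (module +-*-Solver)
import Data.Rational.Unnormalised.Base as ℚᵘ
import Data.Rational.Unnormalised.Properties as ℚᵘ
open import Data.Sum.Base using (_⊎_; inj₁; inj₂)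
open import Data.Unit.Base using (tt)
open import Data.Vec.Base using (Vec; []; _∷_; lookup; toList)
open import Data.Vec.Properties using (length-toList)
open import Defs
open import Function.Base using (_∘_)
open import Function.Bundles using (_↔_; mk↔ₛ′)
open import Level using (0ℓ)
open import Relation.Binary.Definitions using (tri<; tri≈; tri>)
open import Relation.Binary.PropositionalEquality
  using (_≡_; _≢_; refl; sym; trans; cong; cong₂; subst; subst₂; module ≡-Reasoning)
open import Relation.Nullary
  using (yes; no; ¬_; does; Dec; ¬?; _→-dec_; _×-dec_; decidable-stable)
open import Relation.Nullary.Decidable using (map′)

open import Algebra.Properties.Semiring.Sum
  (CommutativeRing.semiring ℤ.+-*-commutativeRing)
  using (∑-distrib-+; ∑-comm; *-distribˡ-sum; *-distribʳ-sum)
  renaming (sum to ∑; sum-cong-≗ to ∑-cong)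

open Determinant ℤ.+-*-rawRing using (det; identity)
open ≡-Reasoning

-- The reals here are Cauchy sequences with undecidable equality, so no eigenvector over ℝ is ever
-- formed: all spectral information is carried by integer identities. The constants come from the
-- spectrum of `F_k`. The eigenvalue -1 belongs to differences of two partners in a triangle, -3 to
-- vectors that vanish at the centre, are constant on each triangle and have sum zero, and the two
-- roots of the quadratic factor of g to vectors constant off the centre. That quadratic takes the
-- value 2k - 2 at -1 and -2k at 0, so for k ≥ 2 its smaller root lies strictly between -1 and 0.
-- Hence no eigenvalue lies below -3 or strictly between -3 and -1, which is what the two positivity
-- statements express. At k = 1 the quadratic is (x + 1)(x - 2): the factors share the root -1, the
-- splitting of vectors breaks down, and the trace of the square has to settle this case alone.

-- Finite sums and the identity matrix

∑-+* : ∀ {n} s (f g : Fin n → ℤ) → ∑ (λ i → f i + s * g i) ≡ ∑ f + s * ∑ g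
∑-+* s f g = trans (∑-distrib-+ f (λ i → s * g i)) (cong (_+_ (∑ f)) (sym (*-distribˡ-sum s g)))

∑-zero : ∀ {n} {f : Fin n → ℤ} → (∀ i → f i ≡ 0ℤ) → ∑ f ≡ 0ℤ
∑-zero {zero}  f≡0 = refl
∑-zero {suc n} f≡0 = cong₂ _+_ (f≡0 zero) (∑-zero (f≡0 ∘ suc))

identity-sym : ∀ {n} (i j : Fin n) → identity i j ≡ identity j i
identity-sym zero    zero    = refl
identity-sym zero    (suc j) = refl
identity-sym (suc i) zero    = refl
identity-sym (suc i) (suc j) = identity-sym i j

identity-refl : ∀ {n} (i : Fin n) → identity i i ≡ 1ℤ
identity-refl zero    = refl
identity-refl (suc i) = identity-refl i

identity-≢ : ∀ {n} {i j : Fin n} → i ≢ j → identity i j ≡ 0ℤ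
identity-≢ {i = zero}  {zero}  i≢j = ⊥-elim (i≢j refl)
identity-≢ {i = zero}  {suc j} i≢j = refl
identity-≢ {i = suc i} {zero}  i≢j = refl
identity-≢ {i = suc i} {suc j} i≢j = identity-≢ (i≢j ∘ cong suc)

∑-identityˡ : ∀ {n} (i : Fin n) (f : Fin n → ℤ) → ∑ (λ j → identity i j * f j) ≡ f i
∑-identityˡ zero f = trans
  (cong₂ _+_ (ℤ.*-identityˡ (f zero)) (∑-zero (λ j → ℤ.*-zeroˡ (f (suc j)))))
  (ℤ.+-identityʳ (f zero))
∑-identityˡ (suc i) f = trans
  (cong₂ _+_ (ℤ.*-zeroˡ (f zero)) (∑-identityˡ i (f ∘ suc)))
  (ℤ.+-identityˡ (f (suc i)))

∑-identityʳ : ∀ {n} (i : Fin n) (f : Fin n → ℤ) → ∑ (λ j → f j * identity j i) ≡ f i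
∑-identityʳ i f = trans
  (∑-cong λ j → trans (ℤ.*-comm (f j) (identity j i)) (cong (_* f j) (identity-sym j i)))
  (∑-identityˡ i f)

-- Determinants

private variable
  Col : Set

-- Contraction of the alternating form F with the covector v; iterating it over the rows
-- of a matrix is the Laplace expansion.
δ : (Col → ℤ) → (List Col → ℤ) → List Col → ℤ
δ v F []       = 0ℤ
δ v F (c ∷ cs) = v c * F cs - δ v (F ∘ (c ∷_)) cs

δ-congˡ : ∀ {v w : Col → ℤ} (F : List Col → ℤ) → (∀ c → v c ≡ w c) → ∀ cs → δ v F cs ≡ δ w F cs
δ-congˡ F v≡w []       = refl
δ-congˡ F v≡w (c ∷ cs) =
  cong₂ (λ a b → a * F cs - b) (v≡w c) (δ-congˡ (F ∘ (c ∷_)) v≡w cs)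

δ-congʳ : ∀ (v : Col → ℤ) {F G : List Col → ℤ} → (∀ cs → F cs ≡ G cs) → ∀ cs → δ v F cs ≡ δ v G cs
δ-congʳ v F≡G []       = refl
δ-congʳ v F≡G (c ∷ cs) =
  cong₂ (λ a b → v c * a - b) (F≡G cs) (δ-congʳ v (F≡G ∘ (c ∷_)) cs)

δ-linearˡ : ∀ s (v w : Col → ℤ) F cs →
  δ (λ c → v c + s * w c) F cs ≡ δ v F cs + s * δ w F cs
δ-linearˡ s v w F []       = sym (trans (ℤ.+-identityˡ (s * 0ℤ)) (ℤ.*-zeroʳ s))
δ-linearˡ s v w F (c ∷ cs) = trans
  (cong (λ z → (v c + s * w c) * F cs - z) (δ-linearˡ s v w (F ∘ (c ∷_)) cs))
  (regroup s (v c) (w c) (F cs) _ _)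
  where
  regroup : ∀ s a b f x y → (a + s * b) * f - (x + s * y) ≡ (a * f - x) + s * (b * f - y)
  regroup = solve-∀

δ-linearʳ : ∀ s (v : Col → ℤ) F G cs →
  δ v (λ ds → F ds + s * G ds) cs ≡ δ v F cs + s * δ v G cs
δ-linearʳ s v F G []       = sym (trans (ℤ.+-identityˡ (s * 0ℤ)) (ℤ.*-zeroʳ s))
δ-linearʳ s v F G (c ∷ cs) = trans
  (cong (λ z → v c * (F cs + s * G cs) - z) (δ-linearʳ s v (F ∘ (c ∷_)) (G ∘ (c ∷_)) cs))
  (regroup s (v c) (F cs) (G cs) _ _)
  where
  regroup : ∀ s a f g x y → a * (f + s * g) - (x + s * y) ≡ (a * f - x) + s * (a * g - y)
  regroup = solve-∀

δ-zeroˡ : ∀ (F : List Col → ℤ) cs → δ (λ _ → 0ℤ) F cs ≡ 0ℤ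
δ-zeroˡ F []       = refl
δ-zeroˡ F (c ∷ cs) =
  cong₂ _-_ (ℤ.*-zeroˡ (F cs)) (δ-zeroˡ (F ∘ (c ∷_)) cs)

δ-zeroʳ : ∀ (v : Col → ℤ) {F} → (∀ cs → F cs ≡ 0ℤ) → ∀ cs → δ v F cs ≡ 0ℤ
δ-zeroʳ v F≡0 []       = refl
δ-zeroʳ v F≡0 (c ∷ cs) =
  cong₂ _-_ (trans (cong (v c *_) (F≡0 cs)) (ℤ.*-zeroʳ (v c))) (δ-zeroʳ v (F≡0 ∘ (c ∷_)) cs)

δ-∑ : ∀ {n} (v : Col → ℤ) (F : Fin n → List Col → ℤ) cs →
  δ v (λ ds → ∑ λ i → F i ds) cs ≡ ∑ λ i → δ v (F i) cs
δ-∑ {n = zero}  v F cs = δ-zeroʳ v (λ _ → refl) cs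
δ-∑ {n = suc n} v F cs = begin
  δ v (λ ds → F zero ds + ∑ λ i → F (suc i) ds) cs
    ≡⟨ δ-congʳ v (λ ds → cong (_+_ (F zero ds)) (sym (ℤ.*-identityˡ _))) cs ⟩
  δ v (λ ds → F zero ds + 1ℤ * ∑ λ i → F (suc i) ds) cs
    ≡⟨ δ-linearʳ 1ℤ v (F zero) _ cs ⟩
  δ v (F zero) cs + 1ℤ * δ v (λ ds → ∑ λ i → F (suc i) ds) cs
    ≡⟨ cong (_+_ (δ v (F zero) cs)) (trans (ℤ.*-identityˡ _) (δ-∑ v (F ∘ suc) cs)) ⟩
  δ v (F zero) cs + ∑ (λ i → δ v (F (suc i)) cs) ∎

-- Each side removes two columns in turn. The sign of a removal counts the columns still standing
-- before it, so the two orders of removal carry opposite signs.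
δ-anticomm : ∀ (v w : Col → ℤ) F cs → δ v (δ w F) cs ≡ - δ w (δ v F) cs
δ-anticomm v w F []       = refl
δ-anticomm v w F (c ∷ cs) = begin
  v c * δ w F cs - δ v (λ ds → w c * F ds - δ w (F ∘ (c ∷_)) ds) cs
    ≡⟨ cong (_-_ (v c * δ w F cs)) (expand v w) ⟩
  v c * δ w F cs - (w c * δ v F cs - δ v (δ w (F ∘ (c ∷_))) cs)
    ≡⟨ cong (λ z → v c * δ w F cs - (w c * δ v F cs - z)) (δ-anticomm v w (F ∘ (c ∷_)) cs) ⟩
  v c * δ w F cs - (w c * δ v F cs - - δ w (δ v (F ∘ (c ∷_))) cs)
    ≡⟨ flip (v c * δ w F cs) (w c * δ v F cs) _ ⟩
  - (w c * δ v F cs - (v c * δ w F cs - δ w (δ v (F ∘ (c ∷_))) cs))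
    ≡⟨ cong (λ z → - (w c * δ v F cs - z)) (sym (expand w v)) ⟩
  - (w c * δ v F cs - δ w (λ ds → v c * F ds - δ v (F ∘ (c ∷_)) ds) cs) ∎
  where
  flip : ∀ a b x → a - (b - - x) ≡ - (b - (a - x))
  flip = solve-∀
  neg-one : ∀ s x → 0ℤ + - 1ℤ * x + s ≡ s - x
  neg-one = solve-∀
  expand : ∀ v w → δ v (λ ds → w c * F ds - δ w (F ∘ (c ∷_)) ds) cs
                 ≡ w c * δ v F cs - δ v (δ w (F ∘ (c ∷_))) cs
  expand v w = begin
    δ v (λ ds → w c * F ds - δ w (F ∘ (c ∷_)) ds) cs
      ≡⟨ δ-congʳ v (λ ds → sym (neg-one (w c * F ds) _)) cs ⟩
    δ v (λ ds → (0ℤ + - 1ℤ * δ w (F ∘ (c ∷_)) ds) + w c * F ds) cs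
      ≡⟨ δ-linearʳ (w c) v _ F cs ⟩
    δ v (λ ds → 0ℤ + - 1ℤ * δ w (F ∘ (c ∷_)) ds) cs + w c * δ v F cs
      ≡⟨ cong (_+ w c * δ v F cs) (δ-linearʳ (- 1ℤ) v (λ _ → 0ℤ) _ cs) ⟩
    δ v (λ _ → 0ℤ) cs + - 1ℤ * δ v (δ w (F ∘ (c ∷_))) cs + w c * δ v F cs
      ≡⟨ cong (λ z → z + - 1ℤ * δ v (δ w (F ∘ (c ∷_))) cs + w c * δ v F cs)
           (δ-zeroʳ v (λ _ → refl) cs) ⟩
    0ℤ + - 1ℤ * δ v (δ w (F ∘ (c ∷_))) cs + w c * δ v F cs
      ≡⟨ neg-one (w c * δ v F cs) _ ⟩
    w c * δ v F cs - δ v (δ w (F ∘ (c ∷_))) cs ∎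

x≡-x⇒x≡0 : ∀ x → x ≡ - x → x ≡ 0ℤ
x≡-x⇒x≡0 (+ zero) _ = refl

wedge : ∀ {m} → (Fin m → Col → ℤ) → List Col → ℤ
wedge {m = zero}  r cs = 1ℤ
wedge {m = suc m} r cs = δ (r zero) (wedge (r ∘ suc)) cs

wedge-cong : ∀ {m} {r r′ : Fin m → Col → ℤ} → (∀ i c → r i c ≡ r′ i c) → ∀ cs → wedge r cs ≡ wedge r′ cs
wedge-cong {m = zero}  r≡r′ cs = refl
wedge-cong {m = suc m} r≡r′ cs =
  trans (δ-congˡ _ (r≡r′ zero) cs) (δ-congʳ _ (wedge-cong (r≡r′ ∘ suc)) cs)

infixl 8 _[_↦_]

_[_↦_] : ∀ {a} {A : Set a} {m} → (Fin m → A) → Fin m → A → Fin m → A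
(r [ zero  ↦ v ]) zero    = v
(r [ zero  ↦ v ]) (suc j) = r (suc j)
(r [ suc i ↦ v ]) zero    = r zero
(r [ suc i ↦ v ]) (suc j) = ((r ∘ suc) [ i ↦ v ]) j

[↦]-cong : ∀ {a b} {A : Set a} {B : Set b} (f g : A → B) {m} (r : Fin m → A) i {v w} →
  (∀ j → f (r j) ≡ g (r j)) → f v ≡ g w → ∀ j → f ((r [ i ↦ v ]) j) ≡ g ((r [ i ↦ w ]) j)
[↦]-cong f g r zero    e e′ zero    = e′
[↦]-cong f g r zero    e e′ (suc j) = e (suc j)
[↦]-cong f g r (suc i) e e′ zero    = e zero
[↦]-cong f g r (suc i) e e′ (suc j) = [↦]-cong f g (r ∘ suc) i (e ∘ suc) e′ j

[↦]-same : ∀ {a} {A : Set a} {m} (r : Fin m → A) i v → (r [ i ↦ v ]) i ≡ v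
[↦]-same r zero    v = refl
[↦]-same r (suc i) v = [↦]-same (r ∘ suc) i v

[↦]-other : ∀ {a} {A : Set a} {m} (r : Fin m → A) {i j} v → i ≢ j → (r [ i ↦ v ]) j ≡ r j
[↦]-other r {zero}  {zero}  v i≢j = ⊥-elim (i≢j refl)
[↦]-other r {zero}  {suc j} v i≢j = refl
[↦]-other r {suc i} {zero}  v i≢j = refl
[↦]-other r {suc i} {suc j} v i≢j = [↦]-other (r ∘ suc) v (i≢j ∘ cong suc)

[↦]-id : ∀ {a} {A : Set a} {m} (r : Fin m → A) i j → (r [ i ↦ r i ]) j ≡ r j
[↦]-id r zero    zero    = refl
[↦]-id r zero    (suc j) = refl
[↦]-id r (suc i) zero    = refl
[↦]-id r (suc i) (suc j) = [↦]-id (r ∘ suc) i j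

wedge-linear : ∀ {m} s (r : Fin m → Col → ℤ) i v w cs →
  wedge (r [ i ↦ (λ c → v c + s * w c) ]) cs ≡ wedge (r [ i ↦ v ]) cs + s * wedge (r [ i ↦ w ]) cs
wedge-linear s r zero    v w cs = δ-linearˡ s v w _ cs
wedge-linear s r (suc i) v w cs = trans
  (δ-congʳ (r zero) (wedge-linear s (r ∘ suc) i v w) cs)
  (δ-linearʳ s (r zero) (wedge ((r ∘ suc) [ i ↦ v ])) (wedge ((r ∘ suc) [ i ↦ w ])) cs)

wedge-zero : ∀ {m} (r : Fin m → Col → ℤ) i cs → wedge (r [ i ↦ (λ _ → 0ℤ) ]) cs ≡ 0ℤ
wedge-zero r zero    cs = δ-zeroˡ _ cs
wedge-zero r (suc i) cs = δ-zeroʳ (r zero) (wedge-zero (r ∘ suc) i) cs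

wedge-∑ : ∀ {m n} (r : Fin m → Col → ℤ) i (a : Fin n → ℤ) (w : Fin n → Col → ℤ) cs →
  wedge (r [ i ↦ (λ c → ∑ λ j → a j * w j c) ]) cs ≡ ∑ λ j → a j * wedge (r [ i ↦ w j ]) cs
wedge-∑ {n = zero}  r i a w cs = wedge-zero r i cs
wedge-∑ {n = suc n} r i a w cs = begin
  wedge (r [ i ↦ (λ c → a zero * w zero c + ∑ λ j → a (suc j) * w (suc j) c) ]) cs
    ≡⟨ wedge-cong (λ l c → [↦]-cong (λ v → v c) (λ v → v c) r i (λ _ → refl)
         (ℤ.+-comm (a zero * w zero c) _) l) cs ⟩
  wedge (r [ i ↦ (λ c → ∑ (λ j → a (suc j) * w (suc j) c) + a zero * w zero c) ]) cs
    ≡⟨ wedge-linear (a zero) r i _ (w zero) cs ⟩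
  wedge (r [ i ↦ (λ c → ∑ λ j → a (suc j) * w (suc j) c) ]) cs + a zero * wedge (r [ i ↦ w zero ]) cs
    ≡⟨ cong (_+ a zero * wedge (r [ i ↦ w zero ]) cs) (wedge-∑ r i (a ∘ suc) (w ∘ suc) cs) ⟩
  ∑ (λ j → a (suc j) * wedge (r [ i ↦ w (suc j) ]) cs) + a zero * wedge (r [ i ↦ w zero ]) cs
    ≡⟨ ℤ.+-comm _ (a zero * wedge (r [ i ↦ w zero ]) cs) ⟩
  a zero * wedge (r [ i ↦ w zero ]) cs + ∑ (λ j → a (suc j) * wedge (r [ i ↦ w (suc j) ]) cs) ∎

-- Anticommutation carries `δ v` past the rows before row `l`; there, contracting twice with the
-- same covector equals its own negative.
δ-wedge≡0 : ∀ {m} (r : Fin m → Col → ℤ) {v} l → (∀ c → r l c ≡ v c) → ∀ cs → δ v (wedge r) cs ≡ 0ℤ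
δ-wedge≡0 {m = suc m} r {v} zero r≡v cs = x≡-x⇒x≡0 _ (begin
  δ v (δ (r zero) F) cs  ≡⟨ δ-anticomm v (r zero) F cs ⟩
  - δ (r zero) (δ v F) cs ≡⟨ cong -_ (δ-congˡ (δ v F) r≡v cs) ⟩
  - δ v (δ v F) cs ≡⟨ cong -_ (δ-congʳ v (λ ds → sym (δ-congˡ F r≡v ds)) cs) ⟩
  - δ v (δ (r zero) F) cs ∎)
  where F = wedge (r ∘ suc)
δ-wedge≡0 {m = suc m} r {v} (suc l) r≡v cs = trans
  (δ-anticomm v (r zero) _ cs)
  (cong -_ (δ-zeroʳ (r zero) (δ-wedge≡0 (r ∘ suc) l r≡v) cs))

wedge-alternating : ∀ {m} (r : Fin m → Col → ℤ) {i l} → i ≢ l → (∀ c → r i c ≡ r l c) →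
  ∀ cs → wedge r cs ≡ 0ℤ
wedge-alternating r {zero}  {zero}  i≢l e cs = ⊥-elim (i≢l refl)
wedge-alternating r {zero}  {suc l} i≢l e cs = δ-wedge≡0 (r ∘ suc) l (λ c → sym (e c)) cs
wedge-alternating r {suc i} {zero}  i≢l e cs = δ-wedge≡0 (r ∘ suc) i e cs
wedge-alternating r {suc i} {suc l} i≢l e cs =
  δ-zeroʳ (r zero) (wedge-alternating (r ∘ suc) (i≢l ∘ cong suc) e) cs

-- `punchIn` and `δ` delete the same column; the factor -1 that the sign gains at each later column
-- becomes the subtraction in `δ`.
∑-laplace : ∀ {m} (v : Col → ℤ) F (c : Fin (suc m) → Col) →
  ∑ (λ j → (- 1ℤ) ℤ.^ toℕ j * (v (c j) * F (tabulate (c ∘ punchIn j)))) ≡ δ v F (tabulate c)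
∑-laplace {m = zero}  v F c = solved (v (c zero)) (F [])
  where
  solved : ∀ a b → 1ℤ * (a * b) + 0ℤ ≡ a * b - 0ℤ
  solved = solve-∀
∑-laplace {m = suc m} v F c = begin
  1ℤ * t₀ + ∑ (λ j → - 1ℤ * (- 1ℤ) ℤ.^ toℕ j * G j)
    ≡⟨ cong₂ _+_ (ℤ.*-identityˡ t₀)
         (∑-cong {x = λ j → - 1ℤ * (- 1ℤ) ℤ.^ toℕ j * G j} λ j → ℤ.*-assoc (- 1ℤ) ((- 1ℤ) ℤ.^ toℕ j) (G j)) ⟩
  t₀ + ∑ (λ j → - 1ℤ * ((- 1ℤ) ℤ.^ toℕ j * G j))
    ≡⟨ cong (_+_ t₀) (sym (*-distribˡ-sum (- 1ℤ) (λ j → (- 1ℤ) ℤ.^ toℕ j * G j))) ⟩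
  t₀ + - 1ℤ * ∑ (λ j → (- 1ℤ) ℤ.^ toℕ j * G j)
    ≡⟨ cong (λ z → t₀ + - 1ℤ * z) (∑-laplace v (F ∘ (c zero ∷_)) (c ∘ suc)) ⟩
  t₀ + - 1ℤ * δ v (F ∘ (c zero ∷_)) (tabulate (c ∘ suc))
    ≡⟨ solved t₀ (δ v (F ∘ (c zero ∷_)) (tabulate (c ∘ suc))) ⟩
  t₀ - δ v (F ∘ (c zero ∷_)) (tabulate (c ∘ suc)) ∎
  where
  t₀ = v (c zero) * F (tabulate (c ∘ suc))
  G = λ j → v (c (suc j)) * F (c zero ∷ tabulate (c ∘ suc ∘ punchIn j))
  solved : ∀ a b → a + - 1ℤ * b ≡ a - b
  solved = solve-∀

^-agree : ∀ j → Determinant._^_ ℤ.+-*-rawRing (- 1ℤ) j ≡ (- 1ℤ) ℤ.^ j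
^-agree zero    = refl
^-agree (suc j) = cong (- 1ℤ *_) (^-agree j)

det-wedge : ∀ {m} (A : Fin m → Col → ℤ) (c : Fin m → Col) →
  det (λ i j → A i (c j)) ≡ wedge A (tabulate c)
det-wedge {m = zero}  A c = refl
det-wedge {m = suc m} A c = trans
  (∑-cong λ j → cong₂ _*_ (^-agree (toℕ j))
    (cong (A zero (c j) *_) (det-wedge (A ∘ suc) (c ∘ punchIn j))))
  (∑-laplace (A zero) (wedge (A ∘ suc)) c)

columns : ∀ n → List (Fin n)
columns n = tabulate (λ i → i)

det≡wedge : ∀ {n} (A : Matrix ℤ n) → det A ≡ wedge A (columns n)
det≡wedge A = det-wedge A (λ i → i)

-- Row `i` is replaced by a unit vector instead of deleting a row and a column, so that expansion
-- along a row is linearity in that row. This is the entry `(j, i)` of the adjugate.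
cofactor : ∀ {n} → Matrix ℤ n → Matrix ℤ n
cofactor {n} A i j = wedge (A [ i ↦ identity j ]) (columns n)

cofactor-row : ∀ {n} (A : Matrix ℤ n) i v →
  ∑ (λ j → v j * cofactor A i j) ≡ wedge (A [ i ↦ v ]) (columns n)
cofactor-row {n} A i v = trans (sym (wedge-∑ A i v identity (columns n)))
  (wedge-cong (λ l c → [↦]-cong (λ u → u c) (λ u → u c) A i (λ _ → refl)
    (∑-identityʳ c v) l) (columns n))

-- For `i ≢ l` the sum is the determinant after row `l` has been copied over row `i`, which has two
-- equal rows.
cofactor-expansion : ∀ {n} (A : Matrix ℤ n) i l →
  ∑ (λ j → A l j * cofactor A i j) ≡ identity i l * det A
cofactor-expansion {n} A i l with i ≟ᶠ l
... | yes refl = trans (cofactor-row A i (A i)) (trans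
      (wedge-cong (λ j c → cong (λ v → v c) ([↦]-id A i j)) (columns n))
      (trans (sym (det≡wedge A))
        (sym (trans (cong (_* det A) (identity-refl i)) (ℤ.*-identityˡ (det A))))))
... | no i≢l = trans (cofactor-row A i (A l)) (trans
      (wedge-alternating (A [ i ↦ A l ]) i≢l
        (λ c → cong (λ v → v c) (trans ([↦]-same A i (A l)) (sym ([↦]-other A (A l) i≢l)))) (columns n))
      (sym (trans (cong (_* det A) (identity-≢ i≢l)) (ℤ.*-zeroˡ (det A)))))

-- Its point is integrality: beyond first order, the determinant changes by a multiple of `s * s`
-- for each integer `s`.
quadraticRemainder : ∀ {m} → ℤ → (a b : Fin m → Col → ℤ) → List Col → ℤ
quadraticRemainder {m = zero}  s a b cs = 0ℤ
quadraticRemainder {m = suc m} s a b cs =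
  δ (b zero) (λ ds → ∑ λ i → wedge ((a ∘ suc) [ i ↦ b (suc i) ]) ds) cs
  + δ (λ c → a zero c + s * b zero c) (quadraticRemainder s (a ∘ suc) (b ∘ suc)) cs

wedge-taylor : ∀ {m} s (a b : Fin m → Col → ℤ) cs →
  wedge (λ i c → a i c + s * b i c) cs ≡
  wedge a cs + s * ∑ (λ i → wedge (a [ i ↦ b i ]) cs) + s * s * quadraticRemainder s a b cs
wedge-taylor {m = zero}  s a b cs = solved s
  where
  solved : ∀ s → 1ℤ ≡ 1ℤ + s * 0ℤ + s * s * 0ℤ
  solved = solve-∀
wedge-taylor {m = suc m} s a b cs = begin
  δ ab (wedge (λ i c → a (suc i) c + s * b (suc i) c)) cs
    ≡⟨ δ-congʳ ab (wedge-taylor s (a ∘ suc) (b ∘ suc)) cs ⟩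
  δ ab (λ ds → W ds + s * Y ds + s * s * Z ds) cs
    ≡⟨ δ-linearʳ (s * s) ab (λ ds → W ds + s * Y ds) Z cs ⟩
  δ ab (λ ds → W ds + s * Y ds) cs + s * s * δ ab Z cs
    ≡⟨ cong (_+ s * s * δ ab Z cs) (δ-linearʳ s ab W Y cs) ⟩
  δ ab W cs + s * δ ab Y cs + s * s * δ ab Z cs
    ≡⟨ cong₂ (λ x y → x + s * y + s * s * δ ab Z cs)
         (δ-linearˡ s (a zero) (b zero) W cs) (δ-linearˡ s (a zero) (b zero) Y cs) ⟩
  δ a₀ W cs + s * δ b₀ W cs + s * (δ a₀ Y cs + s * δ b₀ Y cs) + s * s * δ ab Z cs
    ≡⟨ regroup s (δ a₀ W cs) (δ b₀ W cs) (δ a₀ Y cs) (δ b₀ Y cs) (δ ab Z cs) ⟩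
  δ a₀ W cs + s * (δ b₀ W cs + δ a₀ Y cs) + s * s * (δ b₀ Y cs + δ ab Z cs)
    ≡⟨ cong (λ y → δ a₀ W cs + s * (δ b₀ W cs + y) + s * s * (δ b₀ Y cs + δ ab Z cs))
         (δ-∑ a₀ (λ i → wedge ((a ∘ suc) [ i ↦ b (suc i) ])) cs) ⟩
  δ a₀ W cs + s * (δ b₀ W cs + ∑ (λ i → δ a₀ (wedge ((a ∘ suc) [ i ↦ b (suc i) ])) cs))
    + s * s * (δ b₀ Y cs + δ ab Z cs) ∎
  where
  a₀ = a zero
  b₀ = b zero
  ab = λ c → a₀ c + s * b₀ c
  W = wedge (a ∘ suc)
  Y = λ ds → ∑ λ i → wedge ((a ∘ suc) [ i ↦ b (suc i) ]) ds
  Z = quadraticRemainder s (a ∘ suc) (b ∘ suc)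
  regroup : ∀ s aw bw ay by z →
    aw + s * bw + s * (ay + s * by) + s * s * z ≡ aw + s * (bw + ay) + s * s * (by + z)
  regroup = solve-∀

det-taylor : ∀ {n} s (A B : Matrix ℤ n) → ∃ λ R →
  det (λ i j → A i j + s * B i j) ≡
  det A + s * ∑ (λ i → ∑ λ j → B i j * cofactor A i j) + s * s * R
det-taylor {n} s A B = quadraticRemainder s A B (columns n) , (begin
  det (λ i j → A i j + s * B i j)
    ≡⟨ det≡wedge (λ i j → A i j + s * B i j) ⟩
  wedge (λ i j → A i j + s * B i j) (columns n)
    ≡⟨ wedge-taylor s A B (columns n) ⟩
  wedge A (columns n) + s * ∑ (λ i → wedge (A [ i ↦ B i ]) (columns n)) + s * s * R
    ≡⟨ cong₂ (λ d x → d + s * x + s * s * R) (sym (det≡wedge A))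
         (∑-cong λ i → sym (cofactor-row A i (B i))) ⟩
  det A + s * ∑ (λ i → ∑ λ j → B i j * cofactor A i j) + s * s * R ∎)
  where R = quadraticRemainder s A B (columns n)

det-identity : ∀ n → det (identity {n}) ≡ 1ℤ
det-identity zero    = refl
det-identity (suc n) = trans
  (cong₂ _+_
    (trans (ℤ.*-identityˡ (1ℤ * det (identity {n}))) (trans (ℤ.*-identityˡ (det (identity {n}))) (det-identity n)))
    (∑-zero {n} λ j → ℤ.*-zeroʳ (Determinant._^_ ℤ.+-*-rawRing (- 1ℤ) (toℕ (suc j)))))
  (ℤ.+-identityʳ 1ℤ)

-- Traces of powers

∑∑ : ∀ {m n} → (Fin m → Fin n → ℤ) → ℤ
∑∑ f = ∑ λ i → ∑ λ j → f i j

∑∑-cong : ∀ {m n} {f g : Fin m → Fin n → ℤ} → (∀ i j → f i j ≡ g i j) → ∑∑ f ≡ ∑∑ g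
∑∑-cong f≡g = ∑-cong λ i → ∑-cong (f≡g i)

∑∑-+* : ∀ {m n} s (f g : Fin m → Fin n → ℤ) → ∑∑ (λ i j → f i j + s * g i j) ≡ ∑∑ f + s * ∑∑ g
∑∑-+* s f g = trans (∑-cong λ i → ∑-+* s (f i) (g i)) (∑-+* s (λ i → ∑ (f i)) (λ i → ∑ (g i)))

infixl 7 _·_

_·_ : ∀ {l m n} → (Fin l → Fin m → ℤ) → (Fin m → Fin n → ℤ) → Fin l → Fin n → ℤ
(A · B) i j = ∑ λ l → A i l * B l j

pow : ∀ {n} → Matrix ℤ n → ℕ → Matrix ℤ n
pow A zero    = identity
pow A (suc p) = pow A p · A

tr : ∀ {n} → Matrix ℤ n → ℤ
tr A = ∑ λ i → A i i

·-assoc : ∀ {k l m n} (A : Fin k → Fin l → ℤ) (B : Fin l → Fin m → ℤ) (C : Fin m → Fin n → ℤ) →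
  ∀ i j → (A · B · C) i j ≡ (A · (B · C)) i j
·-assoc A B C i j = begin
  ∑ (λ m → (∑ λ l → A i l * B l m) * C m j)
    ≡⟨ ∑-cong (λ m → *-distribʳ-sum (C m j) (λ l → A i l * B l m)) ⟩
  ∑ (λ m → ∑ λ l → A i l * B l m * C m j)
    ≡⟨ ∑-comm (λ m l → A i l * B l m * C m j) ⟩
  ∑ (λ l → ∑ λ m → A i l * B l m * C m j)
    ≡⟨ ∑-cong (λ l → trans (∑-cong λ m → ℤ.*-assoc (A i l) (B l m) (C m j))
         (sym (*-distribˡ-sum (A i l) (λ m → B l m * C m j)))) ⟩
  ∑ (λ l → A i l * ∑ λ m → B l m * C m j) ∎

det-cong : ∀ {n} {A B : Matrix ℤ n} → (∀ i j → A i j ≡ B i j) → det A ≡ det B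
det-cong {n} {A} {B} A≡B =
  trans (det≡wedge A) (trans (wedge-cong A≡B (columns n)) (sym (det≡wedge B)))

+-cancelˡ : ∀ a {x y} → a + x ≡ a + y → x ≡ y
+-cancelˡ a {x} {y} e = trans (solved a x) (trans (cong (_- a) e) (sym (solved a y)))
  where
  solved : ∀ a x → x ≡ a + x - a
  solved = solve-∀

-- Divisibility by `1 + |x - y|` suffices, since a nonzero integer has no divisor of larger absolute
-- value. This takes the place of limits over the integers.
≡-by-divisibility : ∀ x y → (∀ m → ∃ λ q → x - y ≡ + suc m * q) → x ≡ y
≡-by-divisibility x y divisible with divisible ℤ.∣ x - y ∣
... | q , e = ℤ.i-j≡0⇒i≡j x y (ℤ.∣i∣≡0⇒i≡0 (vanish _ ℤ.∣ q ∣ ∣e∣))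
  where
  ∣e∣ : ℤ.∣ x - y ∣ ≡ suc ℤ.∣ x - y ∣ ℕ.* ℤ.∣ q ∣
  ∣e∣ = trans (cong ℤ.∣_∣ e) (ℤ.abs-* (+ suc ℤ.∣ x - y ∣) q)
  vanish : ∀ a b → a ≡ suc a ℕ.* b → a ≡ 0
  vanish a zero    a≡ = trans a≡ (ℕ.*-zeroʳ (suc a))
  vanish a (suc b) a≡ = ⊥-elim (ℕ.<-irrefl a≡ (ℕ.≤-trans (ℕ.n<1+n a)
    (ℕ.m≤m*n (suc a) (suc b))))

-- det (pencil A t) is the reciprocal characteristic polynomial at t.
pencil : ∀ {n} → Matrix ℤ n → ℤ → Matrix ℤ n
pencil A t i j = identity i j + t * - A i j

-- The trace of `pow A p` times the adjugate of `pencil A t`; the equal index order in both factors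
-- accounts for the transposition in the adjugate.
traceAdj : ∀ {n} → Matrix ℤ n → ℤ → ℕ → ℤ
traceAdj A t p = ∑∑ λ i l → pow A p i l * cofactor (pencil A t) i l

det-pencil≡1+ : ∀ {n} (A : Matrix ℤ n) t → ∃ λ q → det (pencil A t) ≡ 1ℤ + t * q
det-pencil≡1+ {n} A t with det-taylor t identity (λ i j → - A i j)
... | R , e = X + t * R , (begin
  det (pencil A t)                        ≡⟨ e ⟩
  det (identity {n}) + t * X + t * t * R  ≡⟨ cong (λ d → d + t * X + t * t * R) (det-identity n) ⟩
  1ℤ + t * X + t * t * R                  ≡⟨ regroup t X R ⟩
  1ℤ + t * (X + t * R)                    ∎)
  where
  X = ∑∑ λ i j → - A i j * cofactor identity i j
  regroup : ∀ t x r → 1ℤ + t * x + t * t * r ≡ 1ℤ + t * (x + t * r)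
  regroup = solve-∀

pow-1 : ∀ {n} (A : Matrix ℤ n) i j → pow A 1 i j ≡ A i j
pow-1 A i j = ∑-identityˡ i (λ l → A l j)

det-pencil-shift : ∀ {n} (A : Matrix ℤ n) t s → ∃ λ R →
  det (pencil A (t + s)) ≡ det (pencil A t) - s * traceAdj A t 1 + s * s * R
det-pencil-shift {n} A t s with det-taylor s (pencil A t) (λ i j → - A i j)
... | R , e = R , (begin
  det (pencil A (t + s))
    ≡⟨ det-cong (λ i j → split t s (identity i j) (A i j)) ⟩
  det (λ i j → pencil A t i j + s * - A i j)
    ≡⟨ e ⟩
  det (pencil A t) + s * ∑∑ (λ i j → - A i j * cofactor (pencil A t) i j) + s * s * R
    ≡⟨ cong (λ x → det (pencil A t) + s * x + s * s * R) negated ⟩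
  det (pencil A t) + s * (0ℤ + - 1ℤ * traceAdj A t 1) + s * s * R
    ≡⟨ sign (det (pencil A t)) s (traceAdj A t 1) (s * s * R) ⟩
  det (pencil A t) - s * traceAdj A t 1 + s * s * R ∎)
  where
  split : ∀ t s a b → a + (t + s) * - b ≡ a + t * - b + s * - b
  split = solve-∀
  sign : ∀ d s x y → d + s * (0ℤ + - 1ℤ * x) + y ≡ d - s * x + y
  sign = solve-∀
  pull : ∀ a c → - a * c ≡ 0ℤ + - 1ℤ * (a * c)
  pull = solve-∀
  C = cofactor (pencil A t)
  negated : ∑∑ (λ i j → - A i j * C i j) ≡ 0ℤ + - 1ℤ * traceAdj A t 1
  negated = begin
    ∑∑ (λ i j → - A i j * C i j)
      ≡⟨ ∑∑-cong (λ i j → trans (pull (A i j) (C i j))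
           (cong (λ a → 0ℤ + - 1ℤ * (a * C i j)) (sym (pow-1 A i j)))) ⟩
    ∑∑ (λ i j → 0ℤ + - 1ℤ * (pow A 1 i j * C i j))
      ≡⟨ ∑∑-+* {n} {n} (- 1ℤ) (λ _ _ → 0ℤ) (λ i j → pow A 1 i j * C i j) ⟩
    ∑∑ {n} {n} (λ _ _ → 0ℤ) + - 1ℤ * traceAdj A t 1
      ≡⟨ cong (λ z → z + - 1ℤ * traceAdj A t 1) (∑-zero {n} λ _ → ∑-zero {n} λ _ → refl) ⟩
    0ℤ + - 1ℤ * traceAdj A t 1 ∎

-- The entries of `(I - tA) · adj = det · I`, solved for the adjugate.
cofactor-pencil : ∀ {n} (A : Matrix ℤ n) t i l → let C = cofactor (pencil A t) in
  C i l ≡ det (pencil A t) * identity i l + t * ∑ (λ b → A l b * C i b)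
cofactor-pencil A t i l = solved (C i l) t (∑ λ b → A l b * C i b) (det (pencil A t)) (identity i l) (begin
  C i l + (- t) * ∑ (λ b → A l b * C i b)
    ≡⟨ cong (λ z → z + (- t) * ∑ (λ b → A l b * C i b)) (sym (∑-identityˡ l (C i))) ⟩
  ∑ (λ b → identity l b * C i b) + (- t) * ∑ (λ b → A l b * C i b)
    ≡⟨ sym (∑-+* (- t) (λ b → identity l b * C i b) (λ b → A l b * C i b)) ⟩
  ∑ (λ b → identity l b * C i b + (- t) * (A l b * C i b))
    ≡⟨ ∑-cong (λ b → factor (identity l b) t (A l b) (C i b)) ⟩
  ∑ (λ b → pencil A t l b * C i b)
    ≡⟨ cofactor-expansion (pencil A t) i l ⟩
  identity i l * det (pencil A t) ∎)
  where
  C = cofactor (pencil A t)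
  factor : ∀ d t a c → d * c + (- t) * (a * c) ≡ (d + t * - a) * c
  factor = solve-∀
  move : ∀ x t y → x ≡ (x + (- t) * y) + t * y
  move = solve-∀
  solved : ∀ x t y d e → x + (- t) * y ≡ e * d → x ≡ d * e + t * y
  solved x t y d e h = trans (move x t y) (cong (_+ t * y) (trans h (ℤ.*-comm e d)))

traceAdj-recurrence : ∀ {n} (A : Matrix ℤ n) t p →
  traceAdj A t p ≡ det (pencil A t) * tr (pow A p) + t * traceAdj A t (suc p)
traceAdj-recurrence A t p = begin
  ∑∑ (λ i l → P i l * C i l)
    ≡⟨ ∑∑-cong (λ i l → trans (cong (P i l *_) (cofactor-pencil A t i l))
         (distribute (P i l) d (identity i l) t (∑ λ b → A l b * C i b))) ⟩
  ∑∑ (λ i l → d * (P i l * identity i l) + t * (P i l * ∑ λ b → A l b * C i b))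
    ≡⟨ ∑∑-+* t (λ i l → d * (P i l * identity i l)) (λ i l → P i l * ∑ λ b → A l b * C i b) ⟩
  ∑∑ (λ i l → d * (P i l * identity i l)) + t * ∑∑ (λ i l → P i l * ∑ λ b → A l b * C i b)
    ≡⟨ cong₂ (λ x y → x + t * y) diagonal (∑-cong shift) ⟩
  d * tr P + t * traceAdj A t (suc p) ∎
  where
  P = pow A p
  C = cofactor (pencil A t)
  d = det (pencil A t)
  distribute : ∀ p d e t x → p * (d * e + t * x) ≡ d * (p * e) + t * (p * x)
  distribute = solve-∀
  diagonal : ∑∑ (λ i l → d * (P i l * identity i l)) ≡ d * tr P
  diagonal = trans
    (∑-cong λ i → trans (sym (*-distribˡ-sum d (λ l → P i l * identity i l)))
      (cong (d *_) (trans (∑-cong λ l → cong (P i l *_) (identity-sym i l)) (∑-identityʳ i (P i)))))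
    (sym (*-distribˡ-sum d (λ i → P i i)))
  shift : ∀ i → ∑ (λ l → P i l * ∑ λ b → A l b * C i b) ≡ ∑ (λ b → (P · A) i b * C i b)
  shift i = sym (·-assoc P A (λ b (_ : Fin 1) → C i b) i zero)

module _ {n} (A B : Matrix ℤ n) (same-det : ∀ m → det (pencil A (+ suc m)) ≡ det (pencil B (+ suc m))) where

  -- The determinants agree at `t` and at `t + s`, so the two first-order terms in `s` differ by a
  -- multiple of `s²`. Cancelling one `s` leaves a difference divisible by every positive `s`.
  traceAdj-1 : ∀ m → traceAdj A (+ suc m) 1 ≡ traceAdj B (+ suc m) 1
  traceAdj-1 m = ≡-by-divisibility _ _ λ l → go l (det-pencil-shift A (+ suc m) (+ suc l)) (det-pencil-shift B (+ suc m) (+ suc l))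
    where
    compare : ∀ d s x y R R′ → d - s * x + s * s * R ≡ d - s * y + s * s * R′ →
      s * (x - y) ≡ s * (s * (R - R′))
    compare d s x y R R′ e = trans (left d s x y R R′)
      (trans (cong (λ z → s * (s * (R - R′)) - z + (d - s * y + s * s * R′)) e) (right (d - s * y + s * s * R′) (s * (s * (R - R′)))))
      where
      left : ∀ d s x y R R′ → s * (x - y) ≡
        s * (s * (R - R′)) - (d - s * x + s * s * R) + (d - s * y + s * s * R′)
      left = solve-∀
      right : ∀ a b → b - a + a ≡ b
      right = solve-∀
    go : ∀ l →
      ∃ (λ R → det (pencil A (+ suc m + + suc l)) ≡
        det (pencil A (+ suc m)) - + suc l * traceAdj A (+ suc m) 1 + + suc l * + suc l * R) →
      ∃ (λ R → det (pencil B (+ suc m + + suc l)) ≡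
        det (pencil B (+ suc m)) - + suc l * traceAdj B (+ suc m) 1 + + suc l * + suc l * R) →
      ∃ λ q → traceAdj A (+ suc m) 1 - traceAdj B (+ suc m) 1 ≡ + suc l * q
    go l (R , e) (R′ , e′) = R - R′ , ℤ.*-cancelˡ-≡ (+ suc l) _ _
      (compare (det (pencil A (+ suc m))) (+ suc l) _ _ R R′ (trans (sym e) (trans (same-det (m ℕ.+ suc l))
        (trans e′ (cong (λ d → d - + suc l * traceAdj B (+ suc m) 1 + + suc l * + suc l * R′)
          (sym (same-det m)))))))

  private
    -- Read modulo `t`, the recurrence leaves only the traces, because the determinant is 1 modulo
    -- `t`. They agree modulo every positive `t`, hence are equal; cancelling them and then the
    -- factor `t` carries the induction to `suc p`.
    step : ∀ p → (∀ m → traceAdj A (+ suc m) p ≡ traceAdj B (+ suc m) p) →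
      (tr (pow A p) ≡ tr (pow B p)) × (∀ m → traceAdj A (+ suc m) (suc p) ≡ traceAdj B (+ suc m) (suc p))
    step p ih = same-tr , λ m → ℤ.*-cancelˡ-≡ (+ suc m) _ _ (+-cancelˡ (det (pencil A (+ suc m)) * tr (pow A p)) (trans (balance m)
        (cong (λ a → det (pencil A (+ suc m)) * a + + suc m * traceAdj B (+ suc m) (suc p)) (sym same-tr))))
      where
      balance : ∀ m → let t = + suc m ; d = det (pencil A t) in
        d * tr (pow A p) + t * traceAdj A t (suc p) ≡ d * tr (pow B p) + t * traceAdj B t (suc p)
      balance m = trans (sym (traceAdj-recurrence A (+ suc m) p)) (trans (ih m) (trans
        (traceAdj-recurrence B (+ suc m) p)
        (cong (λ d → d * tr (pow B p) + + suc m * traceAdj B (+ suc m) (suc p)) (sym (same-det m)))))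
      extract : ∀ t q a b x y → (1ℤ + t * q) * a + t * x ≡ (1ℤ + t * q) * b + t * y →
        a - b ≡ t * (y - x - q * (a - b))
      extract t q a b x y e = trans (left t q a b x y) (trans
        (cong (λ z → z - ((1ℤ + t * q) * b + t * y) + t * (y - x - q * (a - b))) e)
        (right ((1ℤ + t * q) * b + t * y) (t * (y - x - q * (a - b)))))
        where
        left : ∀ t q a b x y → a - b ≡ ((1ℤ + t * q) * a + t * x) - ((1ℤ + t * q) * b + t * y)
          + t * (y - x - q * (a - b))
        left = solve-∀
        right : ∀ u v → u - u + v ≡ v
        right = solve-∀
      same-tr : tr (pow A p) ≡ tr (pow B p)
      same-tr = ≡-by-divisibility _ _ λ m → let q , e = det-pencil≡1+ A (+ suc m) in
        _ , extract (+ suc m) q (tr (pow A p)) (tr (pow B p)) _ _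
          (subst (λ d → d * tr (pow A p) + + suc m * traceAdj A (+ suc m) (suc p)
                      ≡ d * tr (pow B p) + + suc m * traceAdj B (+ suc m) (suc p)) e (balance m))

    traceAdj-agree : ∀ p m → traceAdj A (+ suc m) (suc p) ≡ traceAdj B (+ suc m) (suc p)
    traceAdj-agree zero    = traceAdj-1
    traceAdj-agree (suc p) = proj₂ (step (suc p) (traceAdj-agree p))

  trace-pow-agree : ∀ p → tr (pow A p) ≡ tr (pow B p)
  trace-pow-agree zero    = refl
  trace-pow-agree (suc p) = proj₁ (step (suc p) (traceAdj-agree p))

-- From real spectra to integer determinants

module Dℝ = Determinant ℝ-rawRing
module Dℚ = Determinant ℚ.+-*-rawRing

-- One argument for two maps: the inclusion `ι` of the integers in the rationals, and the map
-- sending a real to a fixed term of its Cauchy sequence, on which the operations act termwise.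
module _ {R S : RawRing 0ℓ 0ℓ} where
  private
    module R = RawRing R
    module S = RawRing S
    module DR = Determinant R
    module DS = Determinant S

  module _ (h : R.Carrier → S.Carrier)
    (+-homo : ∀ x y → h (x R.+ y) ≡ h x S.+ h y) (*-homo : ∀ x y → h (x R.* y) ≡ h x S.* h y)
    (neg-homo : ∀ x → h (R.- x) ≡ S.- h x) (0-homo : h R.0# ≡ S.0#) (1-homo : h R.1# ≡ S.1#) where

    sum-homo : ∀ {n} (f : Fin n → R.Carrier) {g : Fin n → S.Carrier} → (∀ i → h (f i) ≡ g i) → h (DR.sum f) ≡ DS.sum g
    sum-homo {zero}  f e = 0-homo
    sum-homo {suc n} f e = trans (+-homo _ _) (cong₂ S._+_ (e zero) (sum-homo (f ∘ suc) (e ∘ suc)))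

    ^-homo : ∀ x j → h (x DR.^ j) ≡ h x DS.^ j
    ^-homo x zero    = 1-homo
    ^-homo x (suc j) = trans (*-homo _ _) (cong (h x S.*_) (^-homo x j))

    det-homo : ∀ {n} (A : Matrix R.Carrier n) {B : Matrix S.Carrier n} → (∀ i j → h (A i j) ≡ B i j) →
      h (DR.det A) ≡ DS.det B
    det-homo {zero}  A e = 1-homo
    det-homo {suc n} A {B} e = sum-homo _ λ j → trans (*-homo _ _) (cong₂ S._*_
      (trans (^-homo (R.- R.1#) (toℕ j)) (cong (DS._^ toℕ j) (trans (neg-homo _) (cong S.-_ 1-homo))))
      (trans (*-homo _ _) (cong₂ S._*_ (e zero j) (det-homo _ λ i k → e (suc i) (punchIn j k)))))

ι : ℤ → ℚ
ι z = z ℚ./ 1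

module _ where
  open ℚᵘ.≃-Reasoning using (step-≈-⟩) renaming (begin_ to beginᵘ_; _∎ to _∎ᵘ)

  toℚᵘ-ι : ∀ z → ℚ.toℚᵘ (ι z) ℚᵘ.≃ ℚᵘ.mkℚᵘ z 0
  toℚᵘ-ι z = ℚ.toℚᵘ-fromℚᵘ (ℚᵘ.mkℚᵘ z 0)

  ι-+ : ∀ a b → ι (a + b) ≡ ι a ℚ.+ ι b
  ι-+ a b = ℚ.toℚᵘ-injective (beginᵘ
    ℚ.toℚᵘ (ι (a + b))                     ≈⟨ toℚᵘ-ι (a + b) ⟩
    ℚᵘ.mkℚᵘ (a + b) 0                      ≈⟨ ℚᵘ.*≡* (solved a b) ⟩
    ℚᵘ.mkℚᵘ a 0 ℚᵘ.+ ℚᵘ.mkℚᵘ b 0           ≈⟨ ℚᵘ.≃-sym (ℚᵘ.+-cong (toℚᵘ-ι a) (toℚᵘ-ι b)) ⟩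
    ℚ.toℚᵘ (ι a) ℚᵘ.+ ℚ.toℚᵘ (ι b)         ≈⟨ ℚᵘ.≃-sym (ℚ.toℚᵘ-homo-+ (ι a) (ι b)) ⟩
    ℚ.toℚᵘ (ι a ℚ.+ ι b)                   ∎ᵘ)
    where
    solved : ∀ a b → (a + b) * 1ℤ ≡ (a * 1ℤ + b * 1ℤ) * 1ℤ
    solved = solve-∀

  ι-* : ∀ a b → ι (a * b) ≡ ι a ℚ.* ι b
  ι-* a b = ℚ.toℚᵘ-injective (beginᵘ
    ℚ.toℚᵘ (ι (a * b))                     ≈⟨ toℚᵘ-ι (a * b) ⟩
    ℚᵘ.mkℚᵘ (a * b) 0                      ≈⟨ ℚᵘ.*≡* refl ⟩
    ℚᵘ.mkℚᵘ a 0 ℚᵘ.* ℚᵘ.mkℚᵘ b 0           ≈⟨ ℚᵘ.≃-sym (ℚᵘ.*-cong (toℚᵘ-ι a) (toℚᵘ-ι b)) ⟩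
    ℚ.toℚᵘ (ι a) ℚᵘ.* ℚ.toℚᵘ (ι b)         ≈⟨ ℚᵘ.≃-sym (ℚ.toℚᵘ-homo-* (ι a) (ι b)) ⟩
    ℚ.toℚᵘ (ι a ℚ.* ι b)                   ∎ᵘ)

  ι-neg : ∀ a → ι (- a) ≡ ℚ.- ι a
  ι-neg a = ℚ.toℚᵘ-injective (beginᵘ
    ℚ.toℚᵘ (ι (- a))                       ≈⟨ toℚᵘ-ι (- a) ⟩
    ℚᵘ.- ℚᵘ.mkℚᵘ a 0                       ≈⟨ ℚᵘ.≃-sym (ℚᵘ.-‿cong (toℚᵘ-ι a)) ⟩
    ℚᵘ.- ℚ.toℚᵘ (ι a)                      ≈⟨ ℚᵘ.≃-sym (ℚ.toℚᵘ-homo‿- (ι a)) ⟩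
    ℚ.toℚᵘ (ℚ.- ι a)                       ∎ᵘ)

ι-injective : ∀ {a b} → ι a ≡ ι b → a ≡ b
ι-injective {a} {b} e with ℚᵘ.≃-trans (ℚᵘ.≃-sym (toℚᵘ-ι a)) (ℚᵘ.≃-trans (ℚᵘ.≃-reflexive (cong ℚ.toℚᵘ e)) (toℚᵘ-ι b))
... | ℚᵘ.*≡* eq = trans (sym (ℤ.*-identityʳ a)) (trans eq (ℤ.*-identityʳ b))

+ᴿ-cong : ∀ {x x′ y y′} → x ≃ x′ → y ≃ y′ → x +ᴿ y ≃ x′ +ᴿ y′
+ᴿ-cong {x} {x′} {y} {y′} (mk≃ p) (mk≃ q) = mk≃ λ ε ε>0 →
  let N₁ , h₁ = p (½ ℚ.* ε) (half>0 ε>0)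
      N₂ , h₂ = q (½ ℚ.* ε) (half>0 ε>0)
  in N₁ ℕ.⊔ N₂ , λ n n≥ → sum-close ε (seq x n) (seq y n) (seq x′ n) (seq y′ n)
       (h₁ n (≤-⊔ˡ N₁ N₂ n≥)) (h₂ n (≤-⊔ʳ N₁ N₂ n≥))

-ᴿ-cong : ∀ {x y} → x ≃ y → -ᴿ x ≃ -ᴿ y
-ᴿ-cong {x} {y} p = mk≃ λ ε ε>0 →
  let N , h = close (≃-sym p) ε ε>0
  in N , λ n n≥ → subst (λ a → ℚ.∣ a ∣ ℚ.< ε) (negate-sub (seq x n) (seq y n)) (h n n≥)

*ᴿ-cong : ∀ {x x′ y y′} → x ≃ x′ → y ≃ y′ → x *ᴿ y ≃ x′ *ᴿ y′
*ᴿ-cong {x} {x′} {y} {y′} (mk≃ p) (mk≃ q) = mk≃ λ ε ε>0 →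
  let B , B>0 , N₁ , b₁ = bounded (cauchy x)
      C , C>0 , N₂ , b₂ = bounded (cauchy y′)
      δ₁ , δ₁>0 , p₁    = shrink B (½ ℚ.* ε) B>0 (half>0 ε>0)
      δ₂ , δ₂>0 , p₂    = shrink C (½ ℚ.* ε) C>0 (half>0 ε>0)
      N₃ , h₁           = q δ₁ δ₁>0
      N₄ , h₂           = p δ₂ δ₂>0
      N₁₂               = N₁ ℕ.⊔ N₂
      N₃₄               = N₃ ℕ.⊔ N₄
  in N₁₂ ℕ.⊔ N₃₄ , λ n n≥ →
    let n≥₁₂ = ≤-⊔ˡ N₁₂ N₃₄ n≥
        n≥₃₄ = ≤-⊔ʳ N₁₂ N₃₄ n≥
    in prod-close ε (seq x n) (seq y n) (seq x′ n) (seq y′ n)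
         (p₁ (seq x n) (seq y n ℚ.- seq y′ n) (b₁ n (≤-⊔ˡ N₁ N₂ n≥₁₂)) (h₁ n (≤-⊔ˡ N₃ N₄ n≥₃₄)))
         (p₂ (seq y′ n) (seq x n ℚ.- seq x′ n) (b₂ n (≤-⊔ʳ N₁ N₂ n≥₁₂)) (h₂ n (≤-⊔ʳ N₃ N₄ n≥₃₄)))

≃-pointwise : ∀ {x y} → (∀ n → seq x n ≡ seq y n) → x ≃ y
≃-pointwise {x} {y} e = mk≃ λ ε ε>0 → 0 , λ n _ →
  subst (ℚ._< ε) (sym (trans (cong (λ a → ℚ.∣ a ℚ.- seq y n ∣) (e n)) (∣a-a∣ (seq y n)))) ε>0

-- On lists, because the permutation relates `toList λs` and `toList μs`, which do not come with a
-- common length.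
rootProduct : ℝ → List ℝ → ℝ
rootProduct x []       = fromℚ 1ℚ
rootProduct x (r ∷ rs) = (x +ᴿ -ᴿ r) *ᴿ rootProduct x rs

rootProduct-toList : ∀ {n} x (rs : Vec ℝ n) →
  Dℝ.product (λ i → x +ᴿ -ᴿ lookup rs i) ≡ rootProduct x (toList rs)
rootProduct-toList x []       = refl
rootProduct-toList x (r ∷ rs) = cong ((x +ᴿ -ᴿ r) *ᴿ_) (rootProduct-toList x rs)

factor-cong : ∀ x {r s} → r ≃ s → x +ᴿ -ᴿ r ≃ x +ᴿ -ᴿ s
factor-cong x {r} {s} r≃s = +ᴿ-cong {x} {x} {(-ᴿ r)} {(-ᴿ s)} ≃-refl (-ᴿ-cong r≃s)

rootProduct-↭ : ∀ x {rs ss} → rs ↭ᴿ ss → rootProduct x rs ≃ rootProduct x ss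
rootProduct-↭ x (Homogeneous.refl eqs) = go eqs
  where
  go : ∀ {rs ss} → Pointwise _≃_ rs ss → rootProduct x rs ≃ rootProduct x ss
  go []         = ≃-refl
  go (eq ∷ eqs) = *ᴿ-cong (factor-cong x eq) (go eqs)
rootProduct-↭ x (Homogeneous.prep eq p) = *ᴿ-cong (factor-cong x eq) (rootProduct-↭ x p)
rootProduct-↭ x (Homogeneous.swap {xs = rs} {x = r} {y = s} eq₁ eq₂ p) = ≃-trans
  (≃-pointwise λ n → solved (seq (x +ᴿ -ᴿ r) n) (seq (x +ᴿ -ᴿ s) n) (seq (rootProduct x rs) n))
  (*ᴿ-cong (factor-cong x eq₂) (*ᴿ-cong (factor-cong x eq₁) (rootProduct-↭ x p)))
  where
  open +-*-Solver
  solved : ∀ a b c → a ℚ.* (b ℚ.* c) ≡ b ℚ.* (a ℚ.* c)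
  solved = solve 3 (λ a b c → a :* (b :* c) := b :* (a :* c)) refl
rootProduct-↭ x (Homogeneous.trans p q) = ≃-trans (rootProduct-↭ x p) (rootProduct-↭ x q)

-- The tolerance is taken to be |a - b| itself. In this way equality in ℝ of two values computed
-- from rationals becomes equality in ℚ.
≃-const : ∀ {x y a b} → (∀ n → seq x n ≡ a) → (∀ n → seq y n ≡ b) → x ≃ y → a ≡ b
≃-const {x} {y} {a} {b} xa yb x≃y with a ℚ.≟ b
... | yes a≡b = a≡b
... | no  a≢b = ⊥-elim (ℚ.<-irrefl refl contradiction)
  where
  d≢0 : a ℚ.- b ≢ 0ℚ
  d≢0 e = a≢b (trans (sym (sub-add a b)) (trans (cong (ℚ._+ b) e) (ℚ.+-identityˡ b)))
  d>0 : 0ℚ ℚ.< ℚ.∣ a ℚ.- b ∣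
  d>0 = ℚ.≰⇒> λ ∣d∣≤0 → d≢0 (ℚ.∣p∣≡0⇒p≡0 _ (ℚ.≤-antisym ∣d∣≤0 (ℚ.0≤∣p∣ (a ℚ.- b))))
  contradiction : ℚ.∣ a ℚ.- b ∣ ℚ.< ℚ.∣ a ℚ.- b ∣
  contradiction = let N , h = close x≃y _ d>0 in
    subst (ℚ._< ℚ.∣ a ℚ.- b ∣) (cong₂ (λ u v → ℚ.∣ u ℚ.- v ∣) (xa N) (yb N)) (h N ℕ.≤-refl)

scale-det : ∀ {n} t (A : Matrix ℚ n) → Dℚ.det (λ i j → t ℚ.* A i j) ≡ t Dℚ.^ n ℚ.* Dℚ.det A
scale-det {zero}  t A = refl
scale-det {suc n} t A = trans
  (pointwise λ j → trans
    (cong (λ d → (ℚ.- 1ℚ) Dℚ.^ toℕ j ℚ.* (t ℚ.* A zero j ℚ.* d)) (scale-det t (λ i k → A (suc i) (punchIn j k))))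
    (regroup ((ℚ.- 1ℚ) Dℚ.^ toℕ j) t (A zero j) (t Dℚ.^ n) _))
  (sym (distribute (t Dℚ.^ suc n) λ j → (ℚ.- 1ℚ) Dℚ.^ toℕ j ℚ.* (A zero j ℚ.* Dℚ.det (λ i k → A (suc i) (punchIn j k)))))
  where
  open +-*-Solver
  regroup : ∀ s t a p d → s ℚ.* (t ℚ.* a ℚ.* (p ℚ.* d)) ≡ t ℚ.* p ℚ.* (s ℚ.* (a ℚ.* d))
  regroup = solve 5 (λ s t a p d → s :* (t :* a :* (p :* d)) := t :* p :* (s :* (a :* d))) refl
  pointwise : ∀ {m} {f g : Fin m → ℚ} → (∀ j → f j ≡ g j) → Dℚ.sum f ≡ Dℚ.sum g
  pointwise {zero}  e = refl
  pointwise {suc m} e = cong₂ ℚ._+_ (e zero) (pointwise (e ∘ suc))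
  distribute : ∀ {m} c (f : Fin m → ℚ) → c ℚ.* Dℚ.sum f ≡ Dℚ.sum (λ j → c ℚ.* f j)
  distribute {zero}  c f = ℚ.*-zeroʳ c
  distribute {suc m} c f = trans (ℚ.*-distribˡ-+ c (f zero) (Dℚ.sum (f ∘ suc))) (cong (c ℚ.* f zero ℚ.+_) (distribute c (f ∘ suc)))

toℤ : ∀ {n} → Matrix ℕ n → Matrix ℤ n
toℤ D u v = + D u v

module _ (m : ℕ) where
  private
    t = ι (+ suc m)
    instance
      t-nonZero : ℚ.NonZero t
      t-nonZero = ℚ.≢-nonZero λ t≡0 → suc≢0 (ι-injective {+ suc m} {0ℤ} t≡0)
        where
        suc≢0 : ¬ (+ suc m ≡ 0ℤ)
        suc≢0 ()
    x = ℚ.1/ t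

  -- This is xI - D at x = 1/t. Multiplied by `t` it is integral, namely `pencil (toℤ D) t`, at the
  -- cost of the `n`-th power of `t` in the determinant.
  rationalCharMatrix : ∀ {n} → Matrix ℕ n → Matrix ℚ n
  rationalCharMatrix D i j = x ℚ.* ι (identity i j) ℚ.+ ℚ.- ι (+ D i j)

  seq-identity : ∀ {n} l (i j : Fin n) → seq (Dℝ.identity i j) l ≡ ι (identity i j)
  seq-identity l zero    zero    = refl
  seq-identity l zero    (suc j) = refl
  seq-identity l (suc i) zero    = refl
  seq-identity l (suc i) (suc j) = seq-identity l i j

  seq-charPoly : ∀ {n} (D : Matrix ℕ n) l →
    seq (Dℝ.charPoly (λ u v → fromℕᴿ (D u v)) (fromℚ x)) l ≡ Dℚ.det (rationalCharMatrix D)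
  seq-charPoly D l = det-homo {ℝ-rawRing} {ℚ.+-*-rawRing} (λ y → seq y l)
    (λ _ _ → refl) (λ _ _ → refl) (λ _ → refl) refl refl _
    λ i j → cong (λ e → x ℚ.* e ℚ.+ ℚ.- ι (+ D i j)) (seq-identity l i j)

  det-rationalCharMatrix : ∀ {n} (D : Matrix ℕ n) →
    ι (det (pencil (toℤ D) (+ suc m))) ≡ t Dℚ.^ n ℚ.* Dℚ.det (rationalCharMatrix D)
  det-rationalCharMatrix D = trans
    (det-homo {ℤ.+-*-rawRing} {ℚ.+-*-rawRing} ι ι-+ ι-* ι-neg refl refl _ entry)
    (scale-det t (rationalCharMatrix D))
    where
    open +-*-Solver
    regroup : ∀ t x e d → t ℚ.* x ℚ.* e ℚ.+ t ℚ.* ℚ.- d ≡ t ℚ.* (x ℚ.* e ℚ.+ ℚ.- d)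
    regroup = solve 4 (λ t x e d → t :* x :* e :+ t :* (:- d) := t :* (x :* e :+ (:- d))) refl
    entry : ∀ i j → ι (pencil (toℤ D) (+ suc m) i j) ≡ t ℚ.* rationalCharMatrix D i j
    entry i j = begin
      ι (identity i j + + suc m * - + D i j)
        ≡⟨ trans (ι-+ (identity i j) _) (cong (ι (identity i j) ℚ.+_) (trans (ι-* (+ suc m) (- + D i j)) (cong (t ℚ.*_) (ι-neg (+ D i j))))) ⟩
      ι (identity i j) ℚ.+ t ℚ.* ℚ.- ι (+ D i j)
        ≡⟨ cong (ℚ._+ t ℚ.* ℚ.- ι (+ D i j)) (sym (trans (cong (ℚ._* ι (identity i j)) (ℚ.*-inverseʳ t)) (ℚ.*-identityˡ (ι (identity i j))))) ⟩
      t ℚ.* x ℚ.* ι (identity i j) ℚ.+ t ℚ.* ℚ.- ι (+ D i j)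
        ≡⟨ regroup t x (ι (identity i j)) (ι (+ D i j)) ⟩
      t ℚ.* rationalCharMatrix D i j ∎

  det-pencil-agree : ∀ {n} (A B : Matrix ℕ n) {λs μs} →
    IsSpectrum (λ u v → fromℕᴿ (A u v)) λs → IsSpectrum (λ u v → fromℕᴿ (B u v)) μs →
    toList λs ↭ᴿ toList μs → det (pencil (toℤ A) (+ suc m)) ≡ det (pencil (toℤ B) (+ suc m))
  det-pencil-agree {n} A B {λs} {μs} specA specB λs↭μs = ι-injective (begin
    ι (det (pencil (toℤ A) (+ suc m)))                 ≡⟨ det-rationalCharMatrix A ⟩
    t Dℚ.^ n ℚ.* Dℚ.det (rationalCharMatrix A)         ≡⟨ cong (t Dℚ.^ n ℚ.*_) same ⟩
    t Dℚ.^ n ℚ.* Dℚ.det (rationalCharMatrix B)         ≡⟨ sym (det-rationalCharMatrix B) ⟩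
    ι (det (pencil (toℤ B) (+ suc m)))                 ∎)
    where
    products : Dℝ.product (λ i → fromℚ x +ᴿ -ᴿ lookup λs i) ≃ Dℝ.product (λ i → fromℚ x +ᴿ -ᴿ lookup μs i)
    products = subst (_≃ Dℝ.product (λ i → fromℚ x +ᴿ -ᴿ lookup μs i)) (sym (rootProduct-toList (fromℚ x) λs))
      (subst (rootProduct (fromℚ x) (toList λs) ≃_) (sym (rootProduct-toList (fromℚ x) μs))
        (rootProduct-↭ (fromℚ x) λs↭μs))
    same : Dℚ.det (rationalCharMatrix A) ≡ Dℚ.det (rationalCharMatrix B)
    same = ≃-const (seq-charPoly A) (seq-charPoly B)
      (≃-trans (specA (fromℚ x)) (≃-trans products (≃-sym (specB (fromℚ x)))))

spectrum-size : ∀ {m n} (λs : Vec ℝ m) (μs : Vec ℝ n) → toList λs ↭ᴿ toList μs → m ≡ n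
spectrum-size λs μs p = trans (sym (length-toList λs)) (trans (PermutationProperties.xs↭ys⇒|xs|≡|ys| ℝ-setoid p) (length-toList μs))

-- Order, inner products and matrices acting on integer vectors

∑-mono : ∀ {n} {f g : Fin n → ℤ} → (∀ i → f i ℤ.≤ g i) → ∑ f ℤ.≤ ∑ g
∑-mono {zero}  f≤g = ℤ.≤-refl
∑-mono {suc n} f≤g = ℤ.+-mono-≤ (f≤g zero) (∑-mono (f≤g ∘ suc))

∑-nonneg : ∀ {n} {f : Fin n → ℤ} → (∀ i → 0ℤ ℤ.≤ f i) → 0ℤ ℤ.≤ ∑ f
∑-nonneg {zero}  0≤f = ℤ.≤-refl
∑-nonneg {suc n} 0≤f = ℤ.+-mono-≤ (0≤f zero) (∑-nonneg (0≤f ∘ suc))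

term≤∑ : ∀ {n} {f : Fin n → ℤ} → (∀ i → 0ℤ ℤ.≤ f i) → ∀ i → f i ℤ.≤ ∑ f
term≤∑ {f = f} 0≤f zero = subst (ℤ._≤ ∑ f) (ℤ.+-identityʳ (f zero))
  (ℤ.+-mono-≤ (ℤ.≤-refl {f zero}) (∑-nonneg (0≤f ∘ suc)))
term≤∑ {f = f} 0≤f (suc i) = subst (ℤ._≤ ∑ f) (ℤ.+-identityˡ (f (suc i)))
  (ℤ.+-mono-≤ (0≤f zero) (term≤∑ (0≤f ∘ suc) i))

∑≡0⇒≡0 : ∀ {n} {f : Fin n → ℤ} → (∀ i → 0ℤ ℤ.≤ f i) → ∑ f ≡ 0ℤ → ∀ i → f i ≡ 0ℤ
∑≡0⇒≡0 {f = f} 0≤f e i = ℤ.≤-antisym (subst (f i ℤ.≤_) e (term≤∑ 0≤f i)) (0≤f i)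

0≤i*i : ∀ i → 0ℤ ℤ.≤ i * i
0≤i*i (+ n)      = subst (0ℤ ℤ.≤_) (ℤ.pos-* n n) (ℤ.+≤+ ℕ.z≤n)
0≤i*i ℤ.-[1+ n ] = ℤ.+≤+ ℕ.z≤n

i*i≡0⇒i≡0 : ∀ i → i * i ≡ 0ℤ → i ≡ 0ℤ
i*i≡0⇒i≡0 i e with ℤ.i*j≡0⇒i≡0∨j≡0 i e
... | inj₁ i≡0 = i≡0
... | inj₂ i≡0 = i≡0

∑-const : ∀ n c → ∑ {n} (λ _ → c) ≡ + n * c
∑-const zero    c = sym (ℤ.*-zeroˡ c)
∑-const (suc n) c = trans (cong (_+_ c) (∑-const n c)) (sym (ℤ.suc-* (+ n) c))

infixr 8 _∙_

_∙_ : ∀ {m n} → (Fin m → Fin n → ℤ) → (Fin n → ℤ) → Fin m → ℤ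
(A ∙ v) i = ∑ λ j → A i j * v j

⟨_,_⟩ : ∀ {n} → (Fin n → ℤ) → (Fin n → ℤ) → ℤ
⟨ u , v ⟩ = ∑ λ i → u i * v i

Symmetric : ∀ {n} → Matrix ℤ n → Set
Symmetric A = ∀ i j → A i j ≡ A j i

∙-cong : ∀ {m n} (A : Fin m → Fin n → ℤ) {u v : Fin n → ℤ} → (∀ i → u i ≡ v i) → ∀ i → (A ∙ u) i ≡ (A ∙ v) i
∙-cong A u≡v i = ∑-cong λ j → cong (A i j *_) (u≡v j)

∙-linear : ∀ {m n} (A : Fin m → Fin n → ℤ) s (u v : Fin n → ℤ) i →
  (A ∙ (λ j → u j + s * v j)) i ≡ (A ∙ u) i + s * (A ∙ v) i
∙-linear A s u v i = trans
  (∑-cong λ j → distribute (A i j) s (u j) (v j))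
  (∑-+* s (λ j → A i j * u j) (λ j → A i j * v j))
  where
  distribute : ∀ a s u v → a * (u + s * v) ≡ a * u + s * (a * v)
  distribute = solve-∀

∙-linear₃ : ∀ {m n} (A : Fin m → Fin n → ℤ) s t (u v w : Fin n → ℤ) i →
  (A ∙ (λ j → u j + s * v j + t * w j)) i ≡ (A ∙ u) i + s * (A ∙ v) i + t * (A ∙ w) i
∙-linear₃ A s t u v w i = trans (∙-linear A t (λ j → u j + s * v j) w i)
  (cong (_+ t * (A ∙ w) i) (∙-linear A s u v i))

-- Associativity of the matrix product, with the vector as a matrix of one column.
·-∙ : ∀ {l m n} (A : Fin l → Fin m → ℤ) (B : Fin m → Fin n → ℤ) v i → ((A · B) ∙ v) i ≡ (A ∙ B ∙ v) i
·-∙ A B v i = ·-assoc A B (λ j (_ : Fin 1) → v j) i zero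

⟨⟩-cong : ∀ {n} {u u′ v v′ : Fin n → ℤ} → (∀ i → u i ≡ u′ i) → (∀ i → v i ≡ v′ i) → ⟨ u , v ⟩ ≡ ⟨ u′ , v′ ⟩
⟨⟩-cong u≡ v≡ = ∑-cong λ i → cong₂ _*_ (u≡ i) (v≡ i)

⟨⟩-comm : ∀ {n} (u v : Fin n → ℤ) → ⟨ u , v ⟩ ≡ ⟨ v , u ⟩
⟨⟩-comm u v = ∑-cong λ i → ℤ.*-comm (u i) (v i)

⟨⟩-linearʳ : ∀ {n} s (u v w : Fin n → ℤ) → ⟨ u , (λ i → v i + s * w i) ⟩ ≡ ⟨ u , v ⟩ + s * ⟨ u , w ⟩
⟨⟩-linearʳ s u v w = ∙-linear (λ (_ : Fin 1) → u) s v w zero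

⟨⟩-linearˡ : ∀ {n} s (u v w : Fin n → ℤ) → ⟨ (λ i → u i + s * v i) , w ⟩ ≡ ⟨ u , w ⟩ + s * ⟨ v , w ⟩
⟨⟩-linearˡ s u v w = trans (⟨⟩-comm _ w) (trans (⟨⟩-linearʳ s w u v)
  (cong₂ (λ x y → x + s * y) (⟨⟩-comm w u) (⟨⟩-comm w v)))

⟨⟩-self-adjoint : ∀ {n} (A : Matrix ℤ n) → Symmetric A → ∀ u v → ⟨ A ∙ u , v ⟩ ≡ ⟨ u , A ∙ v ⟩
⟨⟩-self-adjoint A A-sym u v = begin
  ∑ (λ i → ∑ (λ j → A i j * u j) * v i)
    ≡⟨ ∑-cong (λ i → *-distribʳ-sum (v i) (λ j → A i j * u j)) ⟩
  ∑ (λ i → ∑ λ j → A i j * u j * v i)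
    ≡⟨ ∑-comm (λ i j → A i j * u j * v i) ⟩
  ∑ (λ j → ∑ λ i → A i j * u j * v i)
    ≡⟨ ∑-cong (λ j → ∑-cong λ i → trans (cong (λ a → a * u j * v i) (A-sym i j)) (regroup (A j i) (u j) (v i))) ⟩
  ∑ (λ j → ∑ λ i → u j * (A j i * v i))
    ≡⟨ ∑-cong (λ j → sym (*-distribˡ-sum (u j) (λ i → A j i * v i))) ⟩
  ∑ (λ j → u j * ∑ λ i → A j i * v i) ∎
  where
  regroup : ∀ a u v → a * u * v ≡ u * (a * v)
  regroup = solve-∀

-- Polynomials in a symmetric matrix

poly : ∀ {n d} → Matrix ℤ n → (Fin d → ℤ) → Matrix ℤ n
poly A c i j = ∑ λ a → c a * pow A (toℕ a) i j

pow-+ : ∀ {n} (A : Matrix ℤ n) p q i j → (pow A p · pow A q) i j ≡ pow A (p ℕ.+ q) i j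
pow-+ A p zero    i j = trans (∑-identityʳ j (pow A p i)) (cong (λ r → pow A r i j) (sym (ℕ.+-identityʳ p)))
pow-+ A p (suc q) i j = begin
  (pow A p · (pow A q · A)) i j  ≡⟨ sym (·-assoc (pow A p) (pow A q) A i j) ⟩
  (pow A p · pow A q · A) i j    ≡⟨ ∑-cong (λ l → cong (_* A l j) (pow-+ A p q i l)) ⟩
  pow A (suc (p ℕ.+ q)) i j      ≡⟨ cong (λ r → pow A r i j) (sym (ℕ.+-suc p q)) ⟩
  pow A (p ℕ.+ suc q) i j        ∎

pow-sym : ∀ {n} {A : Matrix ℤ n} → Symmetric A → ∀ p → Symmetric (pow A p)
pow-sym A-sym zero    i j = identity-sym i j
pow-sym {A = A} A-sym (suc p) i j = begin
  ∑ (λ l → pow A p i l * A l j)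
    ≡⟨ ∑-cong (λ l → trans (cong₂ _*_ (pow-sym A-sym p i l) (A-sym l j)) (ℤ.*-comm (pow A p l i) (A j l))) ⟩
  ∑ (λ l → A j l * pow A p l i)
    ≡⟨ ∑-cong (λ l → cong (_* pow A p l i) (sym (pow-1 A j l))) ⟩
  (pow A 1 · pow A p) j i
    ≡⟨ pow-+ A 1 p j i ⟩
  pow A (suc p) j i ∎

∑∑-∑ : ∀ {l m n} (f : Fin l → Fin m → Fin n → ℤ) →
  ∑∑ (λ i j → ∑ λ a → f i j a) ≡ ∑ λ a → ∑∑ λ i j → f i j a
∑∑-∑ f = trans (∑-cong λ i → ∑-comm (f i)) (∑-comm (λ i a → ∑ λ j → f i j a))

∑∑-poly : ∀ {n d} (A : Matrix ℤ n) (c : Fin d → ℤ) (X : Matrix ℤ n) →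
  ∑∑ (λ i j → X i j * poly A c i j) ≡ ∑ λ a → c a * ∑∑ λ i j → X i j * pow A (toℕ a) i j
∑∑-poly A c X = begin
  ∑∑ (λ i j → X i j * ∑ λ a → c a * P a i j)
    ≡⟨ ∑∑-cong (λ i j → trans (*-distribˡ-sum (X i j) (λ a → c a * P a i j))
         (∑-cong λ a → regroup (X i j) (c a) (P a i j))) ⟩
  ∑∑ (λ i j → ∑ λ a → c a * (X i j * P a i j))
    ≡⟨ ∑∑-∑ (λ i j a → c a * (X i j * P a i j)) ⟩
  ∑ (λ a → ∑∑ λ i j → c a * (X i j * P a i j))
    ≡⟨ ∑-cong (λ a → trans (∑-cong λ i → sym (*-distribˡ-sum (c a) (λ j → X i j * P a i j)))
         (sym (*-distribˡ-sum (c a) (λ i → ∑ λ j → X i j * P a i j)))) ⟩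
  ∑ (λ a → c a * ∑∑ λ i j → X i j * P a i j) ∎
  where
  P = λ a → pow A (toℕ a)
  regroup : ∀ x c p → x * (c * p) ≡ c * (x * p)
  regroup = solve-∀

∑∑-poly² : ∀ {n d} {A : Matrix ℤ n} → Symmetric A → (c : Fin d → ℤ) →
  ∑∑ (λ i j → poly A c i j * poly A c i j) ≡
  ∑ λ a → c a * ∑ λ b → c b * tr (pow A (toℕ a ℕ.+ toℕ b))
∑∑-poly² {A = A} A-sym c = trans (∑∑-poly A c (poly A c)) (∑-cong λ a → cong (c a *_) (begin
  ∑∑ (λ i j → poly A c i j * P a i j)
    ≡⟨ ∑∑-cong (λ i j → ℤ.*-comm (poly A c i j) (P a i j)) ⟩
  ∑∑ (λ i j → P a i j * poly A c i j)
    ≡⟨ ∑∑-poly A c (P a) ⟩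
  ∑ (λ b → c b * ∑∑ λ i j → P a i j * P b i j)
    ≡⟨ ∑-cong (λ b → cong (c b *_) (∑-cong λ i → trans
         (∑-cong λ j → cong (P a i j *_) (pow-sym A-sym (toℕ b) i j))
         (pow-+ A (toℕ a) (toℕ b) i i))) ⟩
  ∑ (λ b → c b * tr (pow A (toℕ a ℕ.+ toℕ b))) ∎))
  where P = λ a → pow A (toℕ a)

-- The squared Frobenius norm of a polynomial in A is a combination of power traces.
poly≡0-agree : ∀ {n d} {A B : Matrix ℤ n} → Symmetric A → Symmetric B →
  (∀ p → tr (pow A p) ≡ tr (pow B p)) → (c : Fin d → ℤ) →
  (∀ i j → poly B c i j ≡ 0ℤ) → ∀ i j → poly A c i j ≡ 0ℤ
poly≡0-agree {n} {A = A} {B} A-sym B-sym traces c B≡0 i j = i*i≡0⇒i≡0 _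
  (∑≡0⇒≡0 (λ j → 0≤i*i (poly A c i j))
    (∑≡0⇒≡0 (λ i → ∑-nonneg λ j → 0≤i*i (poly A c i j)) norm≡0 i) j)
  where
  norm≡0 : ∑∑ (λ i j → poly A c i j * poly A c i j) ≡ 0ℤ
  norm≡0 = begin
    ∑∑ (λ i j → poly A c i j * poly A c i j)
      ≡⟨ ∑∑-poly² A-sym c ⟩
    ∑ (λ a → c a * ∑ λ b → c b * tr (pow A (toℕ a ℕ.+ toℕ b)))
      ≡⟨ ∑-cong (λ a → cong (c a *_) (∑-cong λ b → cong (c b *_) (traces (toℕ a ℕ.+ toℕ b)))) ⟩
    ∑ (λ a → c a * ∑ λ b → c b * tr (pow B (toℕ a ℕ.+ toℕ b)))
      ≡⟨ sym (∑∑-poly² B-sym c) ⟩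
    ∑∑ (λ i j → poly B c i j * poly B c i j)
      ≡⟨ ∑-zero {n} (λ i → ∑-zero {n} λ j → cong (λ x → x * x) (B≡0 i j)) ⟩
    0ℤ ∎

poly-∙ : ∀ {n d} (A : Matrix ℤ n) (c : Fin d → ℤ) z i →
  (poly A c ∙ z) i ≡ ∑ λ a → c a * (pow A (toℕ a) ∙ z) i
poly-∙ A c z i = begin
  ∑ (λ j → ∑ (λ a → c a * pow A (toℕ a) i j) * z j)
    ≡⟨ ∑-cong (λ j → trans (*-distribʳ-sum (z j) (λ a → c a * pow A (toℕ a) i j))
         (∑-cong λ a → ℤ.*-assoc (c a) (pow A (toℕ a) i j) (z j))) ⟩
  ∑ (λ j → ∑ λ a → c a * (pow A (toℕ a) i j * z j))
    ≡⟨ ∑-comm (λ j a → c a * (pow A (toℕ a) i j * z j)) ⟩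
  ∑ (λ a → ∑ λ j → c a * (pow A (toℕ a) i j * z j))
    ≡⟨ ∑-cong (λ a → sym (*-distribˡ-sum (c a) (λ j → pow A (toℕ a) i j * z j))) ⟩
  ∑ (λ a → c a * (pow A (toℕ a) ∙ z) i) ∎

pow-∙ : ∀ {n} (A : Matrix ℤ n) p z i → (pow A (suc p) ∙ z) i ≡ (pow A p ∙ A ∙ z) i
pow-∙ A p z = ·-∙ (pow A p) A z

N : ∀ {n} → Matrix ℤ n → (Fin n → ℤ) → Fin n → ℤ
N A z i = (A ∙ A ∙ z) i + + 4 * (A ∙ z) i + + 3 * z i

Q : ∀ {n} → ℤ → Matrix ℤ n → (Fin n → ℤ) → Fin n → ℤ
Q κ A z i = (A ∙ A ∙ z) i + - (+ 4 * κ - + 3) * (A ∙ z) i + - (+ 2 * κ) * z i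

-- (x + 1)(x + 3)(x² - (4κ - 3)x - 2κ), lowest coefficient first; (x + 1)(x + 3)
-- is N and the last factor Q.
coefficients : ℤ → Fin 5 → ℤ
coefficients κ = lookup (- (+ 6 * κ) ∷ + 9 - + 20 * κ ∷ + 15 - + 18 * κ ∷ + 7 - + 4 * κ ∷ + 1 ∷ [])

module _ {n} (A : Matrix ℤ n) (κ : ℤ) (z : Fin n → ℤ) (i : Fin n) where
  private
    z₁ = A ∙ z
    z₂ = A ∙ z₁
    z₃ = A ∙ z₂
    z₄ = A ∙ z₃

    expanded : (poly A (coefficients κ) ∙ z) i ≡
      - (+ 6 * κ) * z i + ((+ 9 - + 20 * κ) * z₁ i + ((+ 15 - + 18 * κ) * z₂ i
        + ((+ 7 - + 4 * κ) * z₃ i + (+ 1 * z₄ i + 0ℤ))))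
    expanded = trans (poly-∙ A (coefficients κ) z i)
      (cong₂ (λ a r → - (+ 6 * κ) * a + r) (p₀ z)
      (cong₂ (λ a r → (+ 9 - + 20 * κ) * a + r) (p₁ z)
      (cong₂ (λ a r → (+ 15 - + 18 * κ) * a + r) (p₂ z)
      (cong₂ (λ a r → (+ 7 - + 4 * κ) * a + (+ 1 * r + 0ℤ)) (p₃ z) (trans (pow-∙ A 3 z i) (p₃ z₁))))))
      where
      p₀ : ∀ z → (pow A 0 ∙ z) i ≡ z i
      p₀ z = ∑-identityˡ i z
      p₁ : ∀ z → (pow A 1 ∙ z) i ≡ (A ∙ z) i
      p₁ z = trans (pow-∙ A 0 z i) (p₀ (A ∙ z))
      p₂ : ∀ z → (pow A 2 ∙ z) i ≡ (A ∙ A ∙ z) i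
      p₂ z = trans (pow-∙ A 1 z i) (p₁ (A ∙ z))
      p₃ : ∀ z → (pow A 3 ∙ z) i ≡ (A ∙ A ∙ A ∙ z) i
      p₃ z = trans (pow-∙ A 2 z i) (p₂ (A ∙ z))

  -- Both orders of the factors occur: for the friendship graph, `N` maps into a plane killed by
  -- `Q`, while for `H` the vector `Q κ A z` has to be seen in the kernel of `N`.
  poly≡QN : (poly A (coefficients κ) ∙ z) i ≡ Q κ A (N A z) i
  poly≡QN = trans expanded (sym (trans
    (cong₂ (λ a b → a + - (+ 4 * κ - + 3) * b + - (+ 2 * κ) * N A z i)
      (trans (∙-cong A (∙-linear₃ A (+ 4) (+ 3) z₂ z₁ z) i) (∙-linear₃ A (+ 4) (+ 3) z₃ z₂ z₁ i))
      (∙-linear₃ A (+ 4) (+ 3) z₂ z₁ z i))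
    (solved κ (z i) (z₁ i) (z₂ i) (z₃ i) (z₄ i))))
    where
    solved : ∀ k a b c d e → (e + + 4 * d + + 3 * c) + - (+ 4 * k - + 3) * (d + + 4 * c + + 3 * b)
      + - (+ 2 * k) * (c + + 4 * b + + 3 * a) ≡
      - (+ 6 * k) * a + ((+ 9 - + 20 * k) * b + ((+ 15 - + 18 * k) * c
        + ((+ 7 - + 4 * k) * d + (+ 1 * e + 0ℤ))))
    solved = solve-∀

  poly≡NQ : (poly A (coefficients κ) ∙ z) i ≡ N A (Q κ A z) i
  poly≡NQ = trans expanded (sym (trans
    (cong₂ (λ a b → a + + 4 * b + + 3 * Q κ A z i)
      (trans (∙-cong A (∙-linear₃ A s t z₂ z₁ z) i) (∙-linear₃ A s t z₃ z₂ z₁ i))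
      (∙-linear₃ A s t z₂ z₁ z i))
    (solved κ (z i) (z₁ i) (z₂ i) (z₃ i) (z₄ i))))
    where
    s = - (+ 4 * κ - + 3)
    t = - (+ 2 * κ)
    solved : ∀ k a b c d e → let s = - (+ 4 * k - + 3) ; t = - (+ 2 * k) in
      (e + s * d + t * c) + + 4 * (d + s * c + t * b) + + 3 * (c + s * b + t * a) ≡
      - (+ 6 * k) * a + ((+ 9 - + 20 * k) * b + ((+ 15 - + 18 * k) * c
        + ((+ 7 - + 4 * k) * d + (+ 1 * e + 0ℤ))))
    solved = solve-∀

-- The distance matrix of the friendship graph

-- With `E` for this matrix, `E` is 1 on the diagonal too, so `2 - E - I` is 0 on the diagonal, 1
-- between partners and 2 otherwise. `E` consists of two-by-two blocks of ones, whence `E² = 2E`.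
sameTriangle : ∀ k → Matrix ℤ (k ℕ.* 2)
sameTriangle k i j = if does (quotient {k} 2 i ≟ᶠ quotient {k} 2 j) then 1ℤ else 0ℤ

friendshipMatrix : ∀ k → Matrix ℤ (1 ℕ.+ k ℕ.* 2)
friendshipMatrix k zero    zero    = 0ℤ
friendshipMatrix k zero    (suc j) = 1ℤ
friendshipMatrix k (suc i) zero    = 1ℤ
friendshipMatrix k (suc i) (suc j) = + 2 - sameTriangle k i j - identity i j

∑-sameTriangle : ∀ k i → ∑ (sameTriangle k i) ≡ + 2
∑-sameTriangle (suc k) zero          = cong (λ s → 1ℤ + (1ℤ + s)) (∑-zero {k ℕ.* 2} λ _ → refl)
∑-sameTriangle (suc k) (suc zero)    = cong (λ s → 1ℤ + (1ℤ + s)) (∑-zero {k ℕ.* 2} λ _ → refl)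
∑-sameTriangle (suc k) (suc (suc i)) = cong (λ s → 0ℤ + (0ℤ + s)) (∑-sameTriangle k i)

module _ (k : ℕ) where
  private
    m = k ℕ.* 2
    E = sameTriangle k
    D = friendshipMatrix k

  sameTriangle-sym : Symmetric E
  sameTriangle-sym i j = cong (if_then 1ℤ else 0ℤ) (does-sym (quotient {k} 2 i) (quotient {k} 2 j))

  -- In this form the sum over `j` in `E²` decouples from `l` and leaves a row sum times an entry.
  sameTriangle-trans : ∀ i j l → E i j * E j l ≡ E i j * E i l
  sameTriangle-trans i j l with quotient {k} 2 i ≟ᶠ quotient {k} 2 j
  ... | yes e = cong (λ q → 1ℤ * (if does (q ≟ᶠ quotient {k} 2 l) then 1ℤ else 0ℤ)) (sym e)
  ... | no  _ = trans (ℤ.*-zeroˡ (E j l)) (sym (ℤ.*-zeroˡ (E i l)))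

  sameTriangle-∙ : ∀ v i → (E ∙ E ∙ v) i ≡ + 2 * (E ∙ v) i
  sameTriangle-∙ v i = begin
    ∑ (λ j → E i j * ∑ λ l → E j l * v l)
      ≡⟨ ∑-cong (λ j → trans (*-distribˡ-sum (E i j) (λ l → E j l * v l)) (trans
           (∑-cong λ l → trans (sym (ℤ.*-assoc (E i j) (E j l) (v l)))
             (trans (cong (_* v l) (sameTriangle-trans i j l)) (ℤ.*-assoc (E i j) (E i l) (v l))))
           (sym (*-distribˡ-sum (E i j) (λ l → E i l * v l))))) ⟩
    ∑ (λ j → E i j * (E ∙ v) i)
      ≡⟨ sym (*-distribʳ-sum ((E ∙ v) i) (E i)) ⟩
    ∑ (E i) * (E ∙ v) i
      ≡⟨ cong (_* (E ∙ v) i) (∑-sameTriangle k i) ⟩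
    + 2 * (E ∙ v) i ∎

  ∑-sameTriangle-∙ : ∀ v → ∑ (E ∙ v) ≡ + 2 * ∑ v
  ∑-sameTriangle-∙ v = begin
    ∑ (λ i → ∑ λ j → E i j * v j)
      ≡⟨ ∑-comm (λ i j → E i j * v j) ⟩
    ∑ (λ j → ∑ λ i → E i j * v j)
      ≡⟨ ∑-cong (λ j → trans (sym (*-distribʳ-sum (v j) (λ i → E i j)))
           (cong (_* v j) (trans (∑-cong λ i → sameTriangle-sym i j) (∑-sameTriangle k j)))) ⟩
    ∑ (λ j → + 2 * v j)
      ≡⟨ sym (*-distribˡ-sum (+ 2) v) ⟩
    + 2 * ∑ v ∎

  friendshipMatrix-sym : Symmetric D
  friendshipMatrix-sym zero    zero    = refl
  friendshipMatrix-sym zero    (suc j) = refl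
  friendshipMatrix-sym (suc i) zero    = refl
  friendshipMatrix-sym (suc i) (suc j) = cong₂ (λ e d → + 2 - e - d) (sameTriangle-sym i j) (identity-sym i j)

  friendship-∙-zero : ∀ v → (D ∙ v) zero ≡ ∑ (v ∘ suc)
  friendship-∙-zero v = trans
    (cong₂ _+_ (ℤ.*-zeroˡ (v zero)) (∑-cong λ j → ℤ.*-identityˡ (v (suc j))))
    (ℤ.+-identityˡ (∑ (v ∘ suc)))

  friendship-∙-suc : ∀ v i →
    (D ∙ v) (suc i) ≡ v zero + + 2 * ∑ (v ∘ suc) - (E ∙ (v ∘ suc)) i - v (suc i)
  friendship-∙-suc v i = begin
    1ℤ * v zero + ∑ (λ j → (+ 2 - E i j - identity i j) * w j)
      ≡⟨ cong (_+_ (1ℤ * v zero)) (∑-cong λ j → distribute (E i j) (identity i j) (w j)) ⟩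
    1ℤ * v zero + ∑ (λ j → + 2 * w j + - 1ℤ * (E i j * w j) + - 1ℤ * (identity i j * w j))
      ≡⟨ cong (_+_ (1ℤ * v zero)) (trans
           (∑-+* (- 1ℤ) (λ j → + 2 * w j + - 1ℤ * (E i j * w j)) (λ j → identity i j * w j))
           (cong₂ (λ a b → a + - 1ℤ * b)
             (trans (∑-+* (- 1ℤ) (λ j → + 2 * w j) (λ j → E i j * w j))
               (cong (_+ - 1ℤ * (E ∙ w) i) (sym (*-distribˡ-sum (+ 2) w))))
             (∑-identityˡ i w))) ⟩
    1ℤ * v zero + (+ 2 * ∑ w + - 1ℤ * (E ∙ w) i + - 1ℤ * w i)
      ≡⟨ collect (v zero) (∑ w) ((E ∙ w) i) (w i) ⟩
    v zero + + 2 * ∑ w - (E ∙ w) i - w i ∎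
    where
    w = v ∘ suc
    distribute : ∀ e d w → (+ 2 - e - d) * w ≡ + 2 * w + - 1ℤ * (e * w) + - 1ℤ * (d * w)
    distribute = solve-∀
    collect : ∀ a s e w → 1ℤ * a + (+ 2 * s + - 1ℤ * e + - 1ℤ * w) ≡ a + + 2 * s - e - w
    collect = solve-∀

  module _ (v : Fin (1 ℕ.+ m) → ℤ) where
    private
      w = v ∘ suc
      s = ∑ w
      y = D ∙ v

      ∑-y : ∑ (y ∘ suc) ≡ + m * v zero + (+ 2 * + m - + 3) * s
      ∑-y = begin
        ∑ (y ∘ suc)
          ≡⟨ ∑-cong (λ i → trans (friendship-∙-suc v i) (reshape (v zero) s ((E ∙ w) i) (w i))) ⟩
        ∑ (λ i → (v zero + + 2 * s) + - 1ℤ * (E ∙ w) i + - 1ℤ * w i)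
          ≡⟨ trans (∑-+* (- 1ℤ) (λ i → (v zero + + 2 * s) + - 1ℤ * (E ∙ w) i) w)
               (cong (_+ - 1ℤ * s) (∑-+* (- 1ℤ) (λ _ → v zero + + 2 * s) (E ∙ w))) ⟩
        ∑ (λ (_ : Fin m) → v zero + + 2 * s) + - 1ℤ * ∑ (E ∙ w) + - 1ℤ * s
          ≡⟨ cong₂ (λ a b → a + - 1ℤ * b + - 1ℤ * s) (∑-const m (v zero + + 2 * s)) (∑-sameTriangle-∙ w) ⟩
        + m * (v zero + + 2 * s) + - 1ℤ * (+ 2 * s) + - 1ℤ * s
          ≡⟨ collect (+ m) (v zero) s ⟩
        + m * v zero + (+ 2 * + m - + 3) * s ∎
        where
        reshape : ∀ a s e w → a + + 2 * s - e - w ≡ (a + + 2 * s) + - 1ℤ * e + - 1ℤ * w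
        reshape = solve-∀
        collect : ∀ m a s → m * (a + + 2 * s) + - 1ℤ * (+ 2 * s) + - 1ℤ * s ≡ m * a + (+ 2 * m - + 3) * s
        collect = solve-∀

      E∙y : ∀ i → (E ∙ (y ∘ suc)) i ≡ + 2 * (v zero + + 2 * s) - + 3 * (E ∙ w) i
      E∙y i = begin
        (E ∙ (y ∘ suc)) i
          ≡⟨ ∙-cong E (λ j → trans (friendship-∙-suc v j) (reshape (v zero + + 2 * s) ((E ∙ w) j) (w j))) i ⟩
        (E ∙ (λ j → (v zero + + 2 * s) + - 1ℤ * (E ∙ w) j + - 1ℤ * w j)) i
          ≡⟨ ∙-linear₃ E (- 1ℤ) (- 1ℤ) (λ _ → v zero + + 2 * s) (E ∙ w) w i ⟩
        (E ∙ (λ _ → v zero + + 2 * s)) i + - 1ℤ * (E ∙ E ∙ w) i + - 1ℤ * (E ∙ w) i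
          ≡⟨ cong₂ (λ a b → a + - 1ℤ * b + - 1ℤ * (E ∙ w) i)
               (trans (sym (*-distribʳ-sum (v zero + + 2 * s) (E i))) (cong (_* (v zero + + 2 * s)) (∑-sameTriangle k i)))
               (sameTriangle-∙ w i) ⟩
        + 2 * (v zero + + 2 * s) + - 1ℤ * (+ 2 * (E ∙ w) i) + - 1ℤ * (E ∙ w) i
          ≡⟨ collect (v zero + + 2 * s) ((E ∙ w) i) ⟩
        + 2 * (v zero + + 2 * s) - + 3 * (E ∙ w) i ∎
        where
        reshape : ∀ a e w → a - e - w ≡ a + - 1ℤ * e + - 1ℤ * w
        reshape = solve-∀
        collect : ∀ a e → + 2 * a + - 1ℤ * (+ 2 * e) + - 1ℤ * e ≡ + 2 * a - + 3 * e
        collect = solve-∀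

    -- N D v is constant off the centre; such vectors form a plane, on which D has
    -- characteristic polynomial x² - (4k - 3)x - 2k.
    N-friendship-suc : ∀ i → N D v (suc i) ≡ (+ 2 * + m + + 1) * v zero + (+ 4 * + m - + 3) * s
    N-friendship-suc i = trans
      (cong₂ (λ a b → a + + 4 * b + + 3 * w i)
        (trans (friendship-∙-suc y i) (trans
          (cong₂ (λ a b → a + + 2 * b - (E ∙ (y ∘ suc)) i - y (suc i)) (friendship-∙-zero v) ∑-y)
          (cong₂ (λ a b → s + + 2 * (+ m * v zero + (+ 2 * + m - + 3) * s) - a - b) (E∙y i) (friendship-∙-suc v i))))
        (friendship-∙-suc v i))
      (collect (+ m) (v zero) s ((E ∙ w) i) (w i))
      where
      collect : ∀ m a s e w →
        (s + + 2 * (m * a + (+ 2 * m - + 3) * s) - (+ 2 * (a + + 2 * s) - + 3 * e) - (a + + 2 * s - e - w))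
          + + 4 * (a + + 2 * s - e - w) + + 3 * w ≡ (+ 2 * m + + 1) * a + (+ 4 * m - + 3) * s
      collect = solve-∀

  module _ (v : Fin (1 ℕ.+ m) → ℤ) (b : ℤ) (v≡b : ∀ i → v (suc i) ≡ b) where

    friendship-plane-zero : (D ∙ v) zero ≡ + m * b
    friendship-plane-zero = trans (friendship-∙-zero v) (trans (∑-cong v≡b) (∑-const m b))

    friendship-plane-suc : ∀ i → (D ∙ v) (suc i) ≡ v zero + (+ 2 * + m - + 3) * b
    friendship-plane-suc i = trans (friendship-∙-suc v i) (trans
      (cong₂ (λ s e → v zero + + 2 * s - e - v (suc i))
        (trans (∑-cong v≡b) (∑-const m b))
        (trans (∙-cong E v≡b i) (trans (sym (*-distribʳ-sum b (E i))) (cong (_* b) (∑-sameTriangle k i)))))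
      (trans (cong (λ x → v zero + + 2 * (+ m * b) - + 2 * b - x) (v≡b i)) (collect (+ m) (v zero) b)))
      where
      collect : ∀ m a b → a + + 2 * (m * b) - + 2 * b - b ≡ a + (+ 2 * m - + 3) * b
      collect = solve-∀

  pos-m : + m ≡ + 2 * + k
  pos-m = trans (ℤ.pos-* k 2) (ℤ.*-comm (+ k) (+ 2))

  -- On pairs (value at the centre, common outer value) `D` acts by the matrix with rows (0, 2k) and
  -- (1, 4k - 3); this is Cayley-Hamilton for it.
  Q-friendship-plane : ∀ v b → (∀ i → v (suc i) ≡ b) → ∀ i → Q (+ k) D v i ≡ 0ℤ
  Q-friendship-plane v b v≡b zero = trans
    (cong₂ (λ x y → x + - (+ 4 * + k - + 3) * y + - (+ 2 * + k) * v zero)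
      (trans (friendship-plane-zero (D ∙ v) _ (friendship-plane-suc v b v≡b))
        (cong (λ m → m * (v zero + (+ 2 * m - + 3) * b)) pos-m))
      (trans (friendship-plane-zero v b v≡b) (cong (_* b) pos-m)))
    (collect (+ k) (v zero) b)
    where
    collect : ∀ k a b → + 2 * k * (a + (+ 2 * (+ 2 * k) - + 3) * b)
      + - (+ 4 * k - + 3) * (+ 2 * k * b) + - (+ 2 * k) * a ≡ 0ℤ
    collect = solve-∀
  Q-friendship-plane v b v≡b (suc i) = trans
    (cong₂ (λ x y → x + - (+ 4 * + k - + 3) * y + - (+ 2 * + k) * v (suc i))
      (trans (friendship-plane-suc (D ∙ v) _ (friendship-plane-suc v b v≡b) i)
        (cong₂ (λ m x → x + (+ 2 * m - + 3) * (v zero + (+ 2 * m - + 3) * b)) pos-m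
          (trans (friendship-plane-zero v b v≡b) (cong (_* b) pos-m))))
      (trans (friendship-plane-suc v b v≡b i) (cong (λ m → v zero + (+ 2 * m - + 3) * b) pos-m)))
    (trans (cong (λ x → (+ 2 * + k * b + (+ 2 * (+ 2 * + k) - + 3) * (v zero + (+ 2 * (+ 2 * + k) - + 3) * b))
      + - (+ 4 * + k - + 3) * (v zero + (+ 2 * (+ 2 * + k) - + 3) * b) + - (+ 2 * + k) * x) (v≡b i))
      (collect (+ k) (v zero) b))
    where
    collect : ∀ k a b → (+ 2 * k * b + (+ 2 * (+ 2 * k) - + 3) * (a + (+ 2 * (+ 2 * k) - + 3) * b))
      + - (+ 4 * k - + 3) * (a + (+ 2 * (+ 2 * k) - + 3) * b) + - (+ 2 * k) * b ≡ 0ℤ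
    collect = solve-∀

  poly-friendship : ∀ i j → poly D (coefficients (+ k)) i j ≡ 0ℤ
  -- Applying the polynomial to the unit vector at `j` picks out its column `j`.
  poly-friendship i j = trans (sym (∑-identityʳ j (poly D (coefficients (+ k)) i))) (trans
    (poly≡QN D (+ k) (λ l → identity l j) i)
    (Q-friendship-plane (N D (λ l → identity l j)) _ (N-friendship-suc (λ l → identity l j)) i))

  private
    E-identity : ∀ i j → E i j * identity i j ≡ identity i j
    E-identity i j with i ≟ᶠ j
    ... | yes refl = trans (cong (_* identity i i) (cong (if_then 1ℤ else 0ℤ) (does-refl (quotient {k} 2 i))))
                       (ℤ.*-identityˡ (identity i i))
    ... | no i≢j = trans (cong (E i j *_) (identity-≢ i≢j)) (trans (ℤ.*-zeroʳ (E i j)) (sym (identity-≢ i≢j)))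

    E-idem : ∀ i j → E i j * E i j ≡ E i j
    E-idem i j with does (quotient {k} 2 i ≟ᶠ quotient {k} 2 j)
    ... | true  = refl
    ... | false = refl

    identity-idem : ∀ {n} (i j : Fin n) → identity i j * identity i j ≡ identity i j
    identity-idem i j with i ≟ᶠ j
    ... | yes refl = trans (cong (_* identity i i) (identity-refl i)) (ℤ.*-identityˡ (identity i i))
    ... | no i≢j = trans (cong (identity i j *_) (identity-≢ i≢j)) (trans (ℤ.*-zeroʳ (identity i j)) (sym (identity-≢ i≢j)))

  tr-friendship² : ∑∑ (λ i j → D i j * D i j) ≡ + 16 * + k * + k - + 10 * + k
  tr-friendship² = begin
    0ℤ * 0ℤ + ∑ {m} (λ _ → 1ℤ) + ∑ (λ i → 1ℤ * 1ℤ + ∑ λ j → D (suc i) (suc j) * D (suc i) (suc j))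
      ≡⟨ cong₂ (λ a b → 0ℤ * 0ℤ + a + b) (∑-const m 1ℤ) (∑-cong λ i → cong (_+_ 1ℤ) (row i)) ⟩
    0ℤ * 0ℤ + + m * 1ℤ + ∑ {m} (λ _ → 1ℤ + (+ m * + 4 - + 7))
      ≡⟨ cong (_+_ (0ℤ * 0ℤ + + m * 1ℤ)) (∑-const m (1ℤ + (+ m * + 4 - + 7))) ⟩
    0ℤ * 0ℤ + + m * 1ℤ + + m * (1ℤ + (+ m * + 4 - + 7))
      ≡⟨ cong (λ m → 0ℤ * 0ℤ + m * 1ℤ + m * (1ℤ + (m * + 4 - + 7))) pos-m ⟩
    0ℤ * 0ℤ + + 2 * + k * 1ℤ + + 2 * + k * (1ℤ + (+ 2 * + k * + 4 - + 7))
      ≡⟨ collect (+ k) ⟩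
    + 16 * + k * + k - + 10 * + k ∎
    where
    collect : ∀ k → 0ℤ * 0ℤ + + 2 * k * 1ℤ + + 2 * k * (1ℤ + (+ 2 * k * + 4 - + 7)) ≡ + 16 * k * k - + 10 * k
    collect = solve-∀
    square : ∀ e d → (+ 2 - e - d) * (+ 2 - e - d) ≡ + 4 - + 4 * e - + 4 * d + (e * e + d * d + + 2 * (e * d))
    square = solve-∀
    reduce : ∀ e d → + 4 - + 4 * e - + 4 * d + (e + d + + 2 * d) ≡ + 4 + - + 3 * e + - 1ℤ * d
    reduce = solve-∀
    row : ∀ i → ∑ (λ j → D (suc i) (suc j) * D (suc i) (suc j)) ≡ + m * + 4 - + 7
    row i = begin
      ∑ (λ j → D (suc i) (suc j) * D (suc i) (suc j))
        ≡⟨ ∑-cong (λ j → trans (square (E i j) (identity i j)) (trans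
             (cong₂ (λ a b → + 4 - + 4 * E i j - + 4 * identity i j + (a + b)) (cong₂ _+_ (E-idem i j) (identity-idem i j))
               (cong (+ 2 *_) (E-identity i j)))
             (reduce (E i j) (identity i j)))) ⟩
      ∑ (λ j → + 4 + - + 3 * E i j + - 1ℤ * identity i j)
        ≡⟨ trans (∑-+* (- 1ℤ) (λ j → + 4 + - + 3 * E i j) (identity i))
             (cong (_+ - 1ℤ * ∑ (identity i)) (∑-+* (- + 3) (λ _ → + 4) (E i))) ⟩
      ∑ (λ (_ : Fin m) → + 4) + - + 3 * ∑ (E i) + - 1ℤ * ∑ (identity i)
        ≡⟨ cong₂ (λ a b → a + - + 3 * ∑ (E i) + - 1ℤ * b) (∑-const m (+ 4))
             (trans (∑-cong λ j → sym (ℤ.*-identityʳ (identity i j))) (∑-identityˡ i (λ _ → 1ℤ))) ⟩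
      + m * + 4 + - + 3 * ∑ (E i) + - 1ℤ * 1ℤ
        ≡⟨ cong (λ e → + m * + 4 + - + 3 * e + - 1ℤ * 1ℤ) (∑-sameTriangle k i) ⟩
      + m * + 4 + - + 3 * + 2 + - 1ℤ * 1ℤ
        ≡⟨ ℤ.+-assoc (+ m * + 4) (- + 6) (- 1ℤ) ⟩
      + m * + 4 - + 7 ∎

-- Distances in a graph

module _ {n} {G : Graph n} where
  open Path

  dropStart : ∀ {u v ℓ} (p : Path G u v (suc ℓ)) → Path G (vertex p (suc zero)) v ℓ
  dropStart p .vertex i      = vertex p (suc i)
  dropStart p .start         = refl
  dropStart p .end           = end p
  dropStart p .edge i        = edge p (suc i)
  dropStart p .distinct e    = suc-injective (distinct p e)

  suffix : ∀ {u v ℓ} (p : Path G u v ℓ) i → ∃ λ ℓ′ → ℓ′ ℕ.≤ ℓ × Path G (vertex p i) v ℓ′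
  suffix {ℓ = ℓ} p zero = ℓ , ℕ.≤-refl , record
    { vertex = vertex p ; start = refl ; end = end p ; edge = edge p ; distinct = distinct p }
  suffix {ℓ = suc ℓ} p (suc i) with suffix (dropStart p) i
  ... | ℓ′ , ℓ′≤ℓ , q = ℓ′ , ℕ.m≤n⇒m≤1+n ℓ′≤ℓ , q

  -- Paths may not repeat a vertex. If `u` already lies on the path, its suffix from `u` is taken,
  -- which is why the length is only bounded above.
  prepend : ∀ {u w v ℓ} → T (adj G u w) → Path G w v ℓ → ∃ λ ℓ′ → ℓ′ ℕ.≤ suc ℓ × Path G u v ℓ′
  prepend {u} {w} {v} {ℓ} uw p with any? (λ i → vertex p i ≟ᶠ u)
  ... | yes (i , refl) = let ℓ′ , ℓ′≤ℓ , q = suffix p i in ℓ′ , ℕ.m≤n⇒m≤1+n ℓ′≤ℓ , q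
  ... | no u∉p = suc ℓ , ℕ.≤-refl , record
    { vertex = vs ; start = refl ; end = end p ; edge = es ; distinct = λ {i} {j} → ds i j }
    where
    vs : Fin (suc (suc ℓ)) → Fin n
    vs zero    = u
    vs (suc i) = vertex p i
    es : ∀ i → T (adj G (vs (inject₁ i)) (vs (suc i)))
    es zero    = subst (λ x → T (adj G u x)) (sym (start p)) uw
    es (suc i) = edge p i
    ds : ∀ i j → vs i ≡ vs j → i ≡ j
    ds zero    zero    e = refl
    ds zero    (suc j) e = ⊥-elim (u∉p (j , sym e))
    ds (suc i) zero    e = ⊥-elim (u∉p (i , e))
    ds (suc i) (suc j) e = cong suc (distinct p e)

  trivialPath : ∀ v → Path G v v 0
  trivialPath v = record { vertex = λ _ → v ; start = refl ; end = refl ; edge = λ () ; distinct = λ { {zero} {zero} _ → refl } }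

T⇒≡true : ∀ {b} → T b → b ≡ true
T⇒≡true {true} _ = refl

≡true⇒T : ∀ {b} → b ≡ true → T b
≡true⇒T refl = tt

module Distance {n} {G : Graph n} {D : Matrix ℕ n} (isD : IsDistanceMatrix G D) where
  open Path

  dist-refl : ∀ v → D v v ≡ 0
  dist-refl v = ℕ.n≤0⇒n≡0 (proj₂ (isD v v) 0 (trivialPath v))

  dist≡0⇒≡ : ∀ {u v} → D u v ≡ 0 → u ≡ v
  dist≡0⇒≡ {u} {v} e with D u v | proj₁ (isD u v)
  dist≡0⇒≡ refl | .0 | p = trans (sym (start p)) (end p)

  dist-step : ∀ {u w} v → T (adj G u w) → D u v ℕ.≤ suc (D w v)
  dist-step {u} {w} v uw = let ℓ , ℓ≤ , p = prepend uw (proj₁ (isD w v)) in ℕ.≤-trans (proj₂ (isD u v) ℓ p) ℓ≤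

  -- `w` is the second vertex of a shortest path: the rest of that path bounds its distance from
  -- above, `dist-step` along the first edge bounds it from below.
  dist-descend : ∀ {u v d} → D u v ≡ suc d → ∃ λ w → T (adj G u w) × D w v ≡ d
  dist-descend {u} {v} {d} e = w , uw ,
    ℕ.≤-antisym (proj₂ (isD w v) d (dropStart p)) (ℕ.s≤s⁻¹ (subst (ℕ._≤ suc (D w v)) e (dist-step v uw)))
    where
    p : Path G u v (suc d)
    p = subst (Path G u v) e (proj₁ (isD u v))
    w = vertex p (suc zero)
    uw : T (adj G u w)
    uw = subst (λ x → T (adj G x w)) (start p) (edge p zero)

  T-sym : ∀ {u v} → T (adj G u v) → T (adj G v u)
  T-sym {u} {v} = subst T (adj-sym G u v)

  private
    -- `dist-step` moves the source of a distance. Moving the target is proved by descent from the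
    -- source, since the symmetry of the distance is itself derived from this.
    ≤-by : ∀ d {u v} → D u v ≡ d → ∀ {w} → T (adj G v w) → D u w ℕ.≤ suc d
    ≤-by zero {u} {v} e {w} vw = subst (λ x → D x w ℕ.≤ 1) (sym (dist≡0⇒≡ e))
      (subst (λ x → D v w ℕ.≤ suc x) (dist-refl w) (dist-step w vw))
    ≤-by (suc d) e {w} vw = let x , ux , xv = dist-descend e in
      ℕ.≤-trans (dist-step w ux) (ℕ.s≤s (≤-by d xv vw))

    sym-≤ : ∀ d {u v} → D u v ≡ d → D v u ℕ.≤ d
    sym-≤ zero {u} {v} e = ℕ.≤-reflexive (trans (cong (λ x → D v x) (dist≡0⇒≡ e)) (dist-refl v))
    sym-≤ (suc d) {u} {v} e = let w , uw , wv = dist-descend e in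
      ℕ.≤-trans (≤-by (D v w) refl (T-sym uw)) (ℕ.s≤s (sym-≤ d wv))

  dist-sym : ∀ u v → D u v ≡ D v u
  dist-sym u v = ℕ.≤-antisym (sym-≤ (D v u) refl) (sym-≤ (D u v) refl)

  dist-stepʳ : ∀ {v w} u → T (adj G v w) → D u w ℕ.≤ suc (D u v)
  dist-stepʳ {v} u vw = ≤-by (D u v) refl vw

  dist≡1⇒adj : ∀ {u v} → D u v ≡ 1 → T (adj G u v)
  dist≡1⇒adj {u} e = let w , uw , wv = dist-descend e in subst (λ x → T (adj G u x)) (dist≡0⇒≡ wv) uw

  adj⇒dist≡1 : ∀ {u v} → T (adj G u v) → D u v ≡ 1
  adj⇒dist≡1 {u} {v} uv with D u v in e | subst (λ x → D u v ℕ.≤ suc x) (dist-refl v) (dist-step v uv)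
  ... | 0 | _ = ⊥-elim (subst T (trans (cong (adj G u) (sym (dist≡0⇒≡ e))) (adj-irrefl G u)) uv)
  ... | 1 | _ = refl
  ... | suc (suc _) | ℕ.s≤s ()

  dist≡2 : ∀ {u v w} → u ≢ v → adj G u v ≡ false → T (adj G u w) → T (adj G w v) → D u v ≡ 2
  dist≡2 {u} {v} {w} u≢v uv uw wv with D u v in e | ℕ.≤-trans (dist-step v uw) (ℕ.s≤s (ℕ.≤-reflexive (adj⇒dist≡1 wv)))
  ... | 0 | _ = ⊥-elim (u≢v (dist≡0⇒≡ e))
  ... | 1 | _ = ⊥-elim (subst T uv (dist≡1⇒adj e))
  ... | 2 | _ = refl
  ... | suc (suc (suc _)) | ℕ.s≤s (ℕ.s≤s ())

  toℤ-sym : Symmetric (toℤ D)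
  toℤ-sym u v = cong +_ (dist-sym u v)

friendship-dist : ∀ k {D} → IsDistanceMatrix (friendship k) D → ∀ i j → + D i j ≡ friendshipMatrix k i j
friendship-dist k {D} isD = entry
  where
  open Distance isD
  q = quotient {k} 2
  r = remainder {k} 2
  q,r-injective : ∀ {i j} → q i ≡ q j → r i ≡ r j → i ≡ j
  q,r-injective {i} {j} e e′ = trans (sym (combine-remQuot {k} 2 i)) (trans (cong₂ combine e e′) (combine-remQuot {k} 2 j))
  entry : ∀ i j → + D i j ≡ friendshipMatrix k i j
  entry zero    zero    = cong +_ (dist-refl zero)
  entry zero    (suc j) = cong +_ (adj⇒dist≡1 {zero} {suc j} tt)
  entry (suc i) zero    = cong +_ (adj⇒dist≡1 {suc i} {zero} tt)
  entry (suc i) (suc j) with i ≟ᶠ j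
  ... | yes refl = trans (cong +_ (dist-refl (suc i))) (sym (cong₂ (λ e d → + 2 - e - d)
          (cong (if_then 1ℤ else 0ℤ) (does-refl (q i))) (identity-refl i)))
  ... | no i≢j with q i ≟ᶠ q j in eq
  ...   | no q≢q = trans (cong +_ (dist≡2 {suc i} {suc j} {zero} (i≢j ∘ suc-injective)
            (cong (λ d → does d ∧ not (does (r i ≟ᶠ r j))) eq) tt tt))
          (cong (λ d → + 2 - 0ℤ - d) (sym (identity-≢ i≢j)))
  ...   | yes q≡q = trans (cong +_ (adj⇒dist≡1 {suc i} {suc j} (≡true⇒T
            (trans (cong (λ d → does d ∧ not (does (r i ≟ᶠ r j))) eq) r≠r))))
          (cong (λ d → + 2 - 1ℤ - d) (sym (identity-≢ i≢j)))
    where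
    r≠r : not (does (r i ≟ᶠ r j)) ≡ true
    r≠r with r i ≟ᶠ r j
    ... | yes r≡r = ⊥-elim (i≢j (q,r-injective q≡q r≡r))
    ... | no  _   = refl

-- Positivity from the polynomial equation

0≤+ : ∀ {n} → 0ℤ ℤ.≤ + n
0≤+ = ℤ.+≤+ ℕ.z≤n

0≤i+j : ∀ {i j} → 0ℤ ℤ.≤ i → 0ℤ ℤ.≤ j → 0ℤ ℤ.≤ i + j
0≤i+j = ℤ.+-mono-≤

0≤i*j : ∀ {i j} → 0ℤ ℤ.≤ i → 0ℤ ℤ.≤ j → 0ℤ ℤ.≤ i * j
0≤i*j {+ m} {+ n} _ _ = subst (0ℤ ℤ.≤_) (ℤ.pos-* m n) 0≤+
0≤i*j {ℤ.-[1+ m ]} () _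
0≤i*j {+ m} {ℤ.-[1+ n ]} _ ()

0≤c*i⇒0≤i : ∀ c .{{_ : ℤ.Positive c}} {i} → 0ℤ ℤ.≤ c * i → 0ℤ ℤ.≤ i
0≤c*i⇒0≤i c {i} h = ℤ.*-cancelˡ-≤-pos 0ℤ i c (subst (ℤ._≤ c * i) (sym (ℤ.*-zeroʳ c)) h)

c*i≡0⇒i≡0 : ∀ c .{{_ : ℤ.Positive c}} {i} → c * i ≡ 0ℤ → i ≡ 0ℤ
c*i≡0⇒i≡0 c@(+ suc _) e = ℤ.*-cancelˡ-≡ c _ 0ℤ (trans e (sym (ℤ.*-zeroʳ c)))

⟨⟩-linear₃ : ∀ {n} s t (u v w x : Fin n → ℤ) →
  ⟨ x , (λ i → u i + s * v i + t * w i) ⟩ ≡ ⟨ x , u ⟩ + s * ⟨ x , v ⟩ + t * ⟨ x , w ⟩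
⟨⟩-linear₃ s t u v w x = ∙-linear₃ (λ (_ : Fin 1) → x) s t u v w zero

⟨⟩-scale : ∀ {n} c (u v : Fin n → ℤ) → ⟨ u , (λ i → c * v i) ⟩ ≡ c * ⟨ u , v ⟩
⟨⟩-scale c u v = trans (∑-cong λ i → regroup (u i) c (v i)) (sym (*-distribˡ-sum c (λ i → u i * v i)))
  where
  regroup : ∀ u c v → u * (c * v) ≡ c * (u * v)
  regroup = solve-∀

∙-scale : ∀ {m n} (A : Fin m → Fin n → ℤ) c v i → (A ∙ (λ j → c * v j)) i ≡ c * (A ∙ v) i
∙-scale A c v i = ⟨⟩-scale c (A i) v

positive-* : ∀ i j → ℤ.Positive i → ℤ.Positive j → ℤ.Positive (i * j)
positive-* ℤ.+[1+ m ] ℤ.+[1+ n ] _ _ = _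

positive-+ : ∀ i j → ℤ.Positive i → ℤ.Positive j → ℤ.Positive (i + j)
positive-+ ℤ.+[1+ m ] ℤ.+[1+ n ] _ _ = _

positive⇒0≤ : ∀ {i} → ℤ.Positive i → 0ℤ ℤ.≤ i
positive⇒0≤ {ℤ.+[1+ m ]} _ = 0≤+

module Positivity {n} (A : Matrix ℤ n) (A-sym : Symmetric A) (μ : ℤ) (μ>0 : ℤ.Positive μ)
  (annihilated : ∀ z i → N A (Q (1ℤ + μ) A z) i ≡ 0ℤ) where

  private
    κ = 1ℤ + μ
    -- `Q` takes the value 2μ at -1 and 10κ at -3. Hence `y = (A + 3) Q z` is 4μ times the component
    -- of `z` for -1, and `w = (A + 1) Q z` is -20κ times the one for -3. The multiple 20κμ recovers
    -- these components as `5κ y` and `- μ w`.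
    K = + 20 * κ * μ
    -- The coefficient of `b` in `square`. Multiplying the forms by it lets `b`, whose sign is
    -- unknown, enter only through that square.
    c = + 3 + + 4 * μ

    κ>0 : ℤ.Positive κ
    κ>0 = positive-+ 1ℤ μ _ μ>0

    instance
      c>0 : ℤ.Positive c
      c>0 = positive-+ (+ 3) (+ 4 * μ) _ (positive-* (+ 4) μ _ μ>0)
      K²c>0 : ℤ.Positive (K * K * c)
      K²c>0 = positive-* (K * K) c (positive-* K K K>0 K>0) c>0
        where
        K>0 : ℤ.Positive K
        K>0 = positive-* (+ 20 * κ) μ (positive-* (+ 20) κ _ κ>0) μ>0

    0≤m+nμ : ∀ m n → 0ℤ ℤ.≤ + m + + n * μ
    0≤m+nμ m n = 0≤i+j {+ m} {+ n * μ} 0≤+ (0≤i*j {+ n} {μ} 0≤+ (positive⇒0≤ μ>0))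

    self-adjoint : ∀ u v → ⟨ u , A ∙ v ⟩ ≡ ⟨ A ∙ u , v ⟩
    self-adjoint u v = sym (⟨⟩-self-adjoint A A-sym u v)

  -- Up to the factor K, z is the sum of eigenvectors y and w of A for -1 and -3
  -- and of a vector u with Q u = 0; the three are mutually orthogonal.
  module Splitting (z : Fin n → ℤ) where
    q r y w u x : Fin n → ℤ
    q = Q κ A z
    r = A ∙ q
    y i = r i + + 3 * q i
    w i = r i + 1ℤ * q i
    u i = K * z i + - (+ 5 * κ) * y i + μ * w i
    x i = u i + + 5 * κ * y i + - μ * w i

    Kz≡x : ∀ i → K * z i ≡ x i
    Kz≡x i = solved (K * z i) (+ 5 * κ) (y i) μ (w i)
      where
      solved : ∀ a b y m w → a ≡ a + - b * y + m * w + b * y + - m * w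
      solved = solve-∀

    A∙r : ∀ i → (A ∙ r) i ≡ - + 4 * r i + - + 3 * q i
    A∙r i = trans (move ((A ∙ r) i) (r i) (q i))
      (trans (cong (_+ (- + 4 * r i + - + 3 * q i)) (annihilated z i)) (ℤ.+-identityˡ _))
      where
      move : ∀ a r q → a ≡ a + + 4 * r + + 3 * q + (- + 4 * r + - + 3 * q)
      move = solve-∀

    A∙y : ∀ i → (A ∙ y) i ≡ - 1ℤ * y i
    A∙y i = trans (∙-linear A (+ 3) r q i) (trans (cong (_+ + 3 * r i) (A∙r i)) (solved (r i) (q i)))
      where
      solved : ∀ r q → - + 4 * r + - + 3 * q + + 3 * r ≡ - 1ℤ * (r + + 3 * q)
      solved = solve-∀

    A∙w : ∀ i → (A ∙ w) i ≡ - + 3 * w i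
    A∙w i = trans (∙-linear A 1ℤ r q i) (trans (cong (_+ 1ℤ * r i) (A∙r i)) (solved (r i) (q i)))
      where
      solved : ∀ r q → - + 4 * r + - + 3 * q + 1ℤ * r ≡ - + 3 * (r + 1ℤ * q)
      solved = solve-∀

    A∙u : ∀ i → (A ∙ u) i ≡ K * (A ∙ z) i + + 5 * κ * y i + - + 3 * μ * w i
    A∙u i = trans (∙-linear₃ A (- (+ 5 * κ)) μ (λ i → K * z i) y w i) (trans
      (cong₂ (λ a b → a + b + μ * (A ∙ w) i) (∙-scale A K z i) (cong (- (+ 5 * κ) *_) (A∙y i)))
      (trans (cong (λ b → K * (A ∙ z) i + - (+ 5 * κ) * (- 1ℤ * y i) + μ * b) (A∙w i))
        (solved (K * (A ∙ z) i) κ μ (y i) (w i))))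
      where
      solved : ∀ a k m y w → a + - (+ 5 * k) * (- 1ℤ * y) + m * (- + 3 * w) ≡ a + + 5 * k * y + - + 3 * m * w
      solved = solve-∀

    -- This is `Q u = 0`: as `Q` multiplies `y` by 2μ and `w` by 10κ, it sends `u` to
    -- `K q - 10κμ (y - w)`, and `y - w = 2q`.
    A²∙u : ∀ i → (A ∙ A ∙ u) i ≡ (1ℤ + + 4 * μ) * (A ∙ u) i + + 2 * κ * u i
    A²∙u i = trans (∙-cong A A∙u i) (trans
      (∙-linear₃ A (+ 5 * κ) (- + 3 * μ) (λ i → K * (A ∙ z) i) y w i) (trans
      (cong₂ (λ a b → a + + 5 * κ * b + - + 3 * μ * (A ∙ w) i) (∙-scale A K (A ∙ z) i) (A∙y i)) (trans
      (cong (λ b → K * (A ∙ A ∙ z) i + + 5 * κ * (- 1ℤ * y i) + - + 3 * μ * b) (A∙w i)) (trans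
      (solved μ (z i) ((A ∙ z) i) ((A ∙ A ∙ z) i) (r i))
      (cong (λ a → (1ℤ + + 4 * μ) * a + + 2 * κ * u i) (sym (A∙u i)))))))
      where
      solved : ∀ m z z₁ z₂ r → let k = 1ℤ + m ; K = + 20 * k * m
                                   q = z₂ + - (+ 4 * k - + 3) * z₁ + - (+ 2 * k) * z
                                   y = r + + 3 * q ; w = r + 1ℤ * q in
        K * z₂ + + 5 * k * (- 1ℤ * y) + - + 3 * m * (- + 3 * w) ≡
        (1ℤ + + 4 * m) * (K * z₁ + + 5 * k * y + - + 3 * m * w)
          + + 2 * k * (K * z + - (+ 5 * k) * y + m * w)
      solved = solve-∀

    a b : ℤ
    a = ⟨ u , u ⟩
    b = ⟨ u , A ∙ u ⟩

    ⟨u,A²u⟩ : ⟨ u , A ∙ A ∙ u ⟩ ≡ (1ℤ + + 4 * μ) * b + + 2 * κ * a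
    ⟨u,A²u⟩ = trans
      (⟨⟩-cong {u = u} (λ _ → refl) (λ i → trans (A²∙u i) (pad ((1ℤ + + 4 * μ) * (A ∙ u) i) (+ 2 * κ * u i))))
      (trans (⟨⟩-linear₃ (1ℤ + + 4 * μ) (+ 2 * κ) (λ _ → 0ℤ) (A ∙ u) u u)
        (trans (cong (λ e → e + (1ℤ + + 4 * μ) * b + + 2 * κ * a) (∑-zero λ i → ℤ.*-zeroʳ (u i)))
          (sym (pad ((1ℤ + + 4 * μ) * b) (+ 2 * κ * a)))))
      where
      pad : ∀ x y → x + y ≡ 0ℤ + x + y
      pad = solve-∀

    -- ‖A u + u‖², by Q u = 0.
    square : ⟨ (λ i → (A ∙ u) i + 1ℤ * u i) , (λ i → (A ∙ u) i + 1ℤ * u i) ⟩ ≡ c * b + (+ 3 + + 2 * μ) * a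
    square = trans (⟨⟩-linearʳ 1ℤ v (A ∙ u) u) (trans
      (cong₂ (λ s t → s + 1ℤ * t) (⟨⟩-linearˡ 1ℤ (A ∙ u) u (A ∙ u)) (⟨⟩-linearˡ 1ℤ (A ∙ u) u u)) (trans
      (cong₂ (λ s t → s + 1ℤ * b + 1ℤ * (t + 1ℤ * a))
        (trans (sym (self-adjoint u (A ∙ u))) ⟨u,A²u⟩) (sym (self-adjoint u u)))
      (solved μ a b)))
      where
      v = λ i → (A ∙ u) i + 1ℤ * u i
      solved : ∀ m a b → (1ℤ + + 4 * m) * b + + 2 * (1ℤ + m) * a + 1ℤ * b + 1ℤ * (b + 1ℤ * a)
        ≡ (+ 3 + + 4 * m) * b + (+ 3 + + 2 * m) * a
      solved = solve-∀

    0≤square : 0ℤ ℤ.≤ c * b + (+ 3 + + 2 * μ) * a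
    0≤square = subst (0ℤ ℤ.≤_) square (∑-nonneg λ i → 0≤i*i ((A ∙ u) i + 1ℤ * u i))

    0≤a : 0ℤ ℤ.≤ a
    0≤a = ∑-nonneg λ i → 0≤i*i (u i)

    ⟨Au,v⟩ : ∀ λ₀ v → (∀ i → (A ∙ v) i ≡ λ₀ * v i) → ⟨ A ∙ u , v ⟩ ≡ λ₀ * ⟨ u , v ⟩
    ⟨Au,v⟩ λ₀ v eig = trans (⟨⟩-self-adjoint A A-sym u v)
      (trans (⟨⟩-cong {u = u} (λ _ → refl) eig) (⟨⟩-scale λ₀ u v))

    -- `⟨ A ∙ u , A ∙ v ⟩` is evaluated in two ways. The difference of the two sides is the value of
    -- the quadratic at `λ₀` times `⟨ u , v ⟩`; that value is 2μ at -1 and 10κ at -3, both positive,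
    -- so `u` is orthogonal to `y` and `w`.
    ⟨A²u,v⟩ : ∀ λ₀ v → (∀ i → (A ∙ v) i ≡ λ₀ * v i) →
      λ₀ * (λ₀ * ⟨ u , v ⟩) ≡ (1ℤ + + 4 * μ) * (λ₀ * ⟨ u , v ⟩) + + 2 * κ * ⟨ u , v ⟩
    ⟨A²u,v⟩ λ₀ v eig = begin
      λ₀ * (λ₀ * ⟨ u , v ⟩)
        ≡⟨ cong (λ₀ *_) (sym (⟨Au,v⟩ λ₀ v eig)) ⟩
      λ₀ * ⟨ A ∙ u , v ⟩
        ≡⟨ sym (trans (⟨⟩-cong {u = A ∙ u} (λ _ → refl) eig) (⟨⟩-scale λ₀ (A ∙ u) v)) ⟩
      ⟨ A ∙ u , A ∙ v ⟩
        ≡⟨ self-adjoint (A ∙ u) v ⟩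
      ⟨ A ∙ A ∙ u , v ⟩
        ≡⟨ trans (⟨⟩-cong {v = v} (λ i → A²∙u i) (λ _ → refl)) (⟨⟩-comm _ v) ⟩
      ⟨ v , (λ i → (1ℤ + + 4 * μ) * (A ∙ u) i + + 2 * κ * u i) ⟩
        ≡⟨ ⟨⟩-linearʳ (+ 2 * κ) v (λ i → (1ℤ + + 4 * μ) * (A ∙ u) i) u ⟩
      ⟨ v , (λ i → (1ℤ + + 4 * μ) * (A ∙ u) i) ⟩ + + 2 * κ * ⟨ v , u ⟩
        ≡⟨ cong₂ (λ s t → s + + 2 * κ * t) (trans (⟨⟩-scale (1ℤ + + 4 * μ) v (A ∙ u))
             (cong ((1ℤ + + 4 * μ) *_) (trans (⟨⟩-comm v (A ∙ u)) (⟨Au,v⟩ λ₀ v eig)))) (⟨⟩-comm v u) ⟩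
      (1ℤ + + 4 * μ) * (λ₀ * ⟨ u , v ⟩) + + 2 * κ * ⟨ u , v ⟩ ∎

    u⟂y : ⟨ u , y ⟩ ≡ 0ℤ
    u⟂y = c*i≡0⇒i≡0 (+ 2 * μ) {{positive-* (+ 2) μ _ μ>0}} (trans (left μ ⟨ u , y ⟩)
      (trans (cong (_- ((1ℤ + + 4 * μ) * (- 1ℤ * ⟨ u , y ⟩) + + 2 * κ * ⟨ u , y ⟩)) (⟨A²u,v⟩ (- 1ℤ) y A∙y))
        (ℤ.+-inverseʳ ((1ℤ + + 4 * μ) * (- 1ℤ * ⟨ u , y ⟩) + + 2 * κ * ⟨ u , y ⟩))))
      where
      left : ∀ m p → + 2 * m * p ≡
        - 1ℤ * (- 1ℤ * p) - ((1ℤ + + 4 * m) * (- 1ℤ * p) + + 2 * (1ℤ + m) * p)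
      left = solve-∀

    u⟂w : ⟨ u , w ⟩ ≡ 0ℤ
    u⟂w = c*i≡0⇒i≡0 (+ 10 * κ) {{positive-* (+ 10) κ _ κ>0}} (trans (left μ ⟨ u , w ⟩)
      (trans (cong (_- ((1ℤ + + 4 * μ) * (- + 3 * ⟨ u , w ⟩) + + 2 * κ * ⟨ u , w ⟩)) (⟨A²u,v⟩ (- + 3) w A∙w))
        (ℤ.+-inverseʳ ((1ℤ + + 4 * μ) * (- + 3 * ⟨ u , w ⟩) + + 2 * κ * ⟨ u , w ⟩))))
      where
      left : ∀ m p → + 10 * (1ℤ + m) * p ≡
        - + 3 * (- + 3 * p) - ((1ℤ + + 4 * m) * (- + 3 * p) + + 2 * (1ℤ + m) * p)
      left = solve-∀

    y⟂w : ⟨ w , y ⟩ ≡ 0ℤ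
    y⟂w = c*i≡0⇒i≡0 (+ 2) (trans (left ⟨ w , y ⟩) (trans (cong (_- - + 3 * ⟨ w , y ⟩) (begin
      - 1ℤ * ⟨ w , y ⟩
        ≡⟨ sym (trans (⟨⟩-cong {u = w} (λ _ → refl) A∙y) (⟨⟩-scale (- 1ℤ) w y)) ⟩
      ⟨ w , A ∙ y ⟩
        ≡⟨ self-adjoint w y ⟩
      ⟨ A ∙ w , y ⟩
        ≡⟨ trans (⟨⟩-cong {v = y} A∙w (λ _ → refl)) (trans (⟨⟩-comm _ y) (trans (⟨⟩-scale (- + 3) y w) (cong (- + 3 *_) (⟨⟩-comm y w)))) ⟩
      - + 3 * ⟨ w , y ⟩ ∎)) (ℤ.+-inverseʳ (- + 3 * ⟨ w , y ⟩))))
      where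
      left : ∀ p → + 2 * p ≡ - 1ℤ * p - - + 3 * p
      left = solve-∀

    ⟨v,x⟩ : ∀ v → ⟨ v , x ⟩ ≡ ⟨ v , u ⟩ + + 5 * κ * ⟨ v , y ⟩ + - μ * ⟨ v , w ⟩
    ⟨v,x⟩ v = ⟨⟩-linear₃ (+ 5 * κ) (- μ) u y w v

    ⟨x,u⟩ : ⟨ u , x ⟩ ≡ a
    ⟨x,u⟩ = trans (⟨v,x⟩ u) (trans (cong₂ (λ s t → a + + 5 * κ * s + - μ * t) u⟂y u⟂w) (solved a (+ 5 * κ) (- μ)))
      where
      solved : ∀ a s t → a + s * 0ℤ + t * 0ℤ ≡ a
      solved = solve-∀

    ⟨x,Au⟩ : ⟨ A ∙ u , x ⟩ ≡ b
    ⟨x,Au⟩ = trans (⟨v,x⟩ (A ∙ u)) (trans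
      (cong₂ (λ s t → ⟨ A ∙ u , u ⟩ + + 5 * κ * s + - μ * t)
        (trans (⟨Au,v⟩ (- 1ℤ) y A∙y) (cong (- 1ℤ *_) u⟂y)) (trans (⟨Au,v⟩ (- + 3) w A∙w) (cong (- + 3 *_) u⟂w)))
      (trans (solved ⟨ A ∙ u , u ⟩ (+ 5 * κ) (- μ)) (⟨⟩-comm (A ∙ u) u)))
      where
      solved : ∀ a s t → a + s * (- 1ℤ * 0ℤ) + t * (- + 3 * 0ℤ) ≡ a
      solved = solve-∀

    ⟨x,y⟩ : ⟨ y , x ⟩ ≡ + 5 * κ * ⟨ y , y ⟩
    ⟨x,y⟩ = trans (⟨v,x⟩ y) (trans
      (cong₂ (λ s t → s + + 5 * κ * ⟨ y , y ⟩ + - μ * t) (trans (⟨⟩-comm y u) u⟂y) (trans (⟨⟩-comm y w) y⟂w))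
      (solved (+ 5 * κ * ⟨ y , y ⟩) (- μ)))
      where
      solved : ∀ a t → 0ℤ + a + t * 0ℤ ≡ a
      solved = solve-∀

    A∙x : ∀ i → (A ∙ x) i ≡ (A ∙ u) i + + 5 * κ * (- 1ℤ * y i) + - μ * (- + 3 * w i)
    A∙x i = trans (∙-linear₃ A (+ 5 * κ) (- μ) u y w i)
      (cong₂ (λ s t → (A ∙ u) i + + 5 * κ * s + - μ * t) (A∙y i) (A∙w i))

    scaled : ∀ (B : (Fin n → ℤ) → Fin n → ℤ) → (∀ {v v′} → (∀ i → v i ≡ v′ i) → ∀ i → B v i ≡ B v′ i) →
      (∀ s v i → B (λ i → s * v i) i ≡ s * B v i) → K * K * ⟨ z , B z ⟩ ≡ ⟨ B x , x ⟩
    scaled B B-cong B-scale = begin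
      K * K * ⟨ z , B z ⟩
        ≡⟨ ℤ.*-assoc K K ⟨ z , B z ⟩ ⟩
      K * (K * ⟨ z , B z ⟩)
        ≡⟨ cong (K *_) (trans (sym (⟨⟩-scale K z (B z))) (⟨⟩-comm z _)) ⟩
      K * ⟨ (λ i → K * B z i) , z ⟩
        ≡⟨ sym (⟨⟩-scale K (λ i → K * B z i) z) ⟩
      ⟨ (λ i → K * B z i) , (λ i → K * z i) ⟩
        ≡⟨ ⟨⟩-cong (λ i → trans (sym (B-scale K z i)) (B-cong Kz≡x i)) Kz≡x ⟩
      ⟨ B x , x ⟩ ∎

    A+3 : (Fin n → ℤ) → Fin n → ℤ
    A+3 v i = (A ∙ v) i + + 3 * v i

    -- `A + 3` doubles `y` and kills `w`, which gives the last term. On `u` the form is `b + 3a`,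
    -- and `c` times it is the square plus a nonnegative multiple of `a`.
    A+3-form : K * K * c * ⟨ z , A+3 z ⟩ ≡
      (c * b + (+ 3 + + 2 * μ) * a) + (+ 6 + + 10 * μ) * a + c * (+ 50 * (κ * κ) * ⟨ y , y ⟩)
    A+3-form = trans (regroup K c ⟨ z , A+3 z ⟩) (trans
      (cong (c *_) (trans
        (scaled A+3 (λ e i → cong₂ (λ s t → s + + 3 * t) (∙-cong A e i) (e i))
          (λ s v i → trans (cong (_+ + 3 * (s * v i)) (∙-scale A s v i)) (factor s ((A ∙ v) i) (v i))))
        (trans (⟨⟩-cong {v = x} (λ i → trans (cong (_+ + 3 * x i) (A∙x i)) (collapse κ μ ((A ∙ u) i) (u i) (y i) (w i))) (λ _ → refl))
          (trans (⟨⟩-comm _ x) (trans (⟨⟩-linear₃ (+ 3) (+ 10 * κ) (A ∙ u) u y x)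
            (cong₂ (λ s t → s + + 10 * κ * t)
              (cong₂ (λ s t → s + + 3 * t) (trans (⟨⟩-comm x (A ∙ u)) ⟨x,Au⟩) (trans (⟨⟩-comm x u) ⟨x,u⟩))
              (trans (⟨⟩-comm x y) ⟨x,y⟩)))))))
      (solved μ a b ⟨ y , y ⟩))
      where
      regroup : ∀ k c f → k * k * c * f ≡ c * (k * k * f)
      regroup = solve-∀
      factor : ∀ s p q → s * p + + 3 * (s * q) ≡ s * (p + + 3 * q)
      factor = solve-∀
      collapse : ∀ k m p u y w → p + + 5 * k * (- 1ℤ * y) + - m * (- + 3 * w) + + 3 * (u + + 5 * k * y + - m * w)
        ≡ p + + 3 * u + + 10 * k * y
      collapse = solve-∀
      solved : ∀ m a b y → let k = 1ℤ + m ; c = + 3 + + 4 * m in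
        c * (b + + 3 * a + + 10 * k * (+ 5 * k * y)) ≡
        (c * b + (+ 3 + + 2 * m) * a) + (+ 6 + + 10 * m) * a + c * (+ 50 * (k * k) * y)
      solved = solve-∀

    -- `N` kills `y` and `w`, and on `u` it equals `(5 + 4μ) A + (5 + 2μ)` because `Q u = 0`. After
    -- multiplication by `c` the square absorbs the term in `b` and leaves `4μ a`.
    N-form : K * K * c * ⟨ z , N A z ⟩ ≡ (+ 5 + + 4 * μ) * (c * b + (+ 3 + + 2 * μ) * a) + + 4 * μ * a
    N-form = trans (regroup K c ⟨ z , N A z ⟩) (trans
      (cong (c *_) (trans
        (scaled (N A)
          (λ e i → cong₂ (λ s t → s + + 3 * t) (cong₂ (λ s t → s + + 4 * t) (∙-cong A (∙-cong A e) i) (∙-cong A e i)) (e i))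
          (λ s v i → trans (cong₂ (λ p q → p + + 4 * q + + 3 * (s * v i))
            (trans (∙-cong A (∙-scale A s v) i) (∙-scale A s (A ∙ v) i)) (∙-scale A s v i)) (factor s ((A ∙ A ∙ v) i) ((A ∙ v) i) (v i))))
        (trans (⟨⟩-cong {v = x} Nx (λ _ → refl))
          (trans (⟨⟩-comm _ x) (trans (⟨⟩-linear₃ (+ 5 + + 4 * μ) (+ 5 + + 2 * μ) (λ _ → 0ℤ) (A ∙ u) u x)
            (cong₂ (λ s t → s + (+ 5 + + 2 * μ) * t)
              (cong₂ (λ s t → s + (+ 5 + + 4 * μ) * t) (∑-zero λ i → ℤ.*-zeroʳ (x i)) (trans (⟨⟩-comm x (A ∙ u)) ⟨x,Au⟩))
              (trans (⟨⟩-comm x u) ⟨x,u⟩)))))))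
      (solved μ a b))
      where
      regroup : ∀ k c f → k * k * c * f ≡ c * (k * k * f)
      regroup = solve-∀
      factor : ∀ s p q r → s * p + + 4 * (s * q) + + 3 * (s * r) ≡ s * (p + + 4 * q + + 3 * r)
      factor = solve-∀
      A²∙x : ∀ i → (A ∙ A ∙ x) i ≡ (A ∙ A ∙ u) i + + 5 * κ * y i + - + 9 * μ * w i
      A²∙x i = trans (∙-cong A (λ j → trans (A∙x j) (reshape κ μ ((A ∙ u) j) (y j) (w j))) i) (trans
        (∙-linear₃ A (- (+ 5 * κ)) (+ 3 * μ) (A ∙ u) y w i) (trans
        (cong₂ (λ s t → (A ∙ A ∙ u) i + - (+ 5 * κ) * s + + 3 * μ * t) (A∙y i) (A∙w i))
        (finish κ μ ((A ∙ A ∙ u) i) (y i) (w i))))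
        where
        reshape : ∀ k m p y w → p + + 5 * k * (- 1ℤ * y) + - m * (- + 3 * w) ≡ p + - (+ 5 * k) * y + + 3 * m * w
        reshape = solve-∀
        finish : ∀ k m p y w → p + - (+ 5 * k) * (- 1ℤ * y) + + 3 * m * (- + 3 * w) ≡ p + + 5 * k * y + - + 9 * m * w
        finish = solve-∀
      Nx : ∀ i → N A x i ≡ 0ℤ + (+ 5 + + 4 * μ) * (A ∙ u) i + (+ 5 + + 2 * μ) * u i
      Nx i = trans
        (cong₂ (λ p q → p + + 4 * q + + 3 * x i)
          (trans (A²∙x i) (cong (λ p → p + + 5 * κ * y i + - + 9 * μ * w i) (A²∙u i))) (A∙x i))
        (collapse μ ((A ∙ u) i) (u i) (y i) (w i))
        where
        collapse : ∀ m p u y w → let k = 1ℤ + m in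
          ((1ℤ + + 4 * m) * p + + 2 * k * u) + + 5 * k * y + - + 9 * m * w
            + + 4 * (p + + 5 * k * (- 1ℤ * y) + - m * (- + 3 * w)) + + 3 * (u + + 5 * k * y + - m * w)
          ≡ 0ℤ + (+ 5 + + 4 * m) * p + (+ 5 + + 2 * m) * u
        collapse = solve-∀
      solved : ∀ m a b → let c = + 3 + + 4 * m in
        c * (0ℤ + (+ 5 + + 4 * m) * b + (+ 5 + + 2 * m) * a) ≡
        (+ 5 + + 4 * m) * (c * b + (+ 3 + + 2 * m) * a) + + 4 * m * a
      solved = solve-∀

    0≤A+3 : 0ℤ ℤ.≤ ⟨ z , A+3 z ⟩
    0≤A+3 = 0≤c*i⇒0≤i (K * K * c) (subst (0ℤ ℤ.≤_) (sym A+3-form)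
      (0≤i+j (0≤i+j 0≤square (0≤i*j (0≤m+nμ 6 10) 0≤a))
        (0≤i*j {c} (positive⇒0≤ c>0) (0≤i*j {+ 50 * (κ * κ)} (0≤i*j {+ 50} 0≤+ (0≤i*i κ)) (∑-nonneg λ i → 0≤i*i (y i))))))

    0≤N : 0ℤ ℤ.≤ ⟨ z , N A z ⟩
    0≤N = 0≤c*i⇒0≤i (K * K * c) (subst (0ℤ ℤ.≤_) (sym N-form)
      (0≤i+j (0≤i*j (0≤m+nμ 5 4) 0≤square) (0≤i*j {+ 4 * μ} (0≤i*j {+ 4} 0≤+ (positive⇒0≤ μ>0)) 0≤a)))

  A+3-nonneg : ∀ z → 0ℤ ℤ.≤ ⟨ z , (λ i → (A ∙ z) i + + 3 * z i) ⟩
  A+3-nonneg z = Splitting.0≤A+3 z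

  N-nonneg : ∀ z → 0ℤ ℤ.≤ ⟨ z , N A z ⟩
  N-nonneg z = Splitting.0≤N z

-- Zero-one vectors and test vectors with small support

Indicator : ∀ {n} → (Fin n → ℤ) → Set
Indicator f = ∀ v → f v ≡ 0ℤ ⊎ f v ≡ 1ℤ

indicator-nonneg : ∀ {n} {f : Fin n → ℤ} → Indicator f → ∀ v → 0ℤ ℤ.≤ f v
indicator-nonneg ind v with ind v
... | inj₁ e = ℤ.≤-reflexive (sym e)
... | inj₂ e = subst (0ℤ ℤ.≤_) (sym e) 0≤+

identity≡1⇒≡ : ∀ {n} {a v : Fin n} → identity a v ≡ 1ℤ → a ≡ v
identity≡1⇒≡ {a = a} {v} e with a ≟ᶠ v
... | yes a≡v = a≡v
... | no a≢v with trans (sym e) (identity-≢ a≢v)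
...   | ()

∑-identity : ∀ {n} (a : Fin n) → ∑ (identity a) ≡ 1ℤ
∑-identity a = trans (∑-cong λ v → sym (ℤ.*-identityʳ (identity a v))) (∑-identityˡ a (λ _ → 1ℤ))

∃-one : ∀ {n} {f : Fin n → ℤ} → Indicator f → ∑ f ≢ 0ℤ → ∃ λ a → f a ≡ 1ℤ
∃-one {f = f} ind ∑f≢0 with any? (λ a → f a ℤ.≟ 1ℤ)
... | yes p = p
... | no ¬p = ⊥-elim (∑f≢0 (∑-zero f≡0))
  where
  f≡0 : ∀ v → f v ≡ 0ℤ
  f≡0 v with ind v
  ... | inj₁ e = e
  ... | inj₂ e = ⊥-elim (¬p (v , e))

without : ∀ {n} → (Fin n → ℤ) → Fin n → Fin n → ℤ
without f a v = f v + - 1ℤ * identity a v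

without-indicator : ∀ {n} {f : Fin n → ℤ} {a} → Indicator f → f a ≡ 1ℤ → Indicator (without f a)
without-indicator {f = f} {a} ind fa v with a ≟ᶠ v
... | yes refl = inj₁ (cong₂ (λ x y → x + - 1ℤ * y) fa (identity-refl a))
... | no a≢v with ind v
...   | inj₁ e = inj₁ (cong₂ (λ x y → x + - 1ℤ * y) e (identity-≢ a≢v))
...   | inj₂ e = inj₂ (cong₂ (λ x y → x + - 1ℤ * y) e (identity-≢ a≢v))

∑-without : ∀ {n} (f : Fin n → ℤ) a → ∑ (without f a) ≡ ∑ f - 1ℤ
∑-without f a = trans (∑-+* (- 1ℤ) f (identity a)) (cong (λ s → ∑ f + - 1ℤ * s) (∑-identity a))

∑≡1⇒identity : ∀ {n} {f : Fin n → ℤ} {a} → Indicator f → ∑ f ≡ 1ℤ → f a ≡ 1ℤ → ∀ v → f v ≡ identity a v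
∑≡1⇒identity {f = f} {a} ind ∑f fa v = trans (move (f v) (identity a v)) (trans
  (cong (_+ identity a v) (∑≡0⇒≡0 (indicator-nonneg (without-indicator ind fa))
    (trans (∑-without f a) (cong (_- 1ℤ) ∑f)) v))
  (ℤ.+-identityˡ (identity a v)))
  where
  move : ∀ x y → x ≡ x + - 1ℤ * y + y
  move = solve-∀

∑≡2⇒pair : ∀ {n} {f : Fin n → ℤ} {a} → Indicator f → ∑ f ≡ + 2 → f a ≡ 1ℤ →
  ∃ λ b → a ≢ b × f b ≡ 1ℤ × ∀ v → f v ≡ identity a v + identity b v
∑≡2⇒pair {f = f} {a} ind ∑f fa = b , a≢b , trans (pair b) (cong₂ _+_ (identity-≢ a≢b) (identity-refl b)) , pair
  where
  g-ind : Indicator (without f a)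
  g-ind = without-indicator ind fa
  ∑g : ∑ (without f a) ≡ 1ℤ
  ∑g = trans (∑-without f a) (cong (_- 1ℤ) ∑f)
  1≢0 : ¬ (1ℤ ≡ 0ℤ)
  1≢0 ()
  another = ∃-one g-ind λ ∑g≡0 → 1≢0 (trans (sym ∑g) ∑g≡0)
  b = proj₁ another
  gb = proj₂ another
  a≢b : a ≢ b
  a≢b a≡b = 1≢0 (trans (sym gb) (cong₂ (λ x y → x + - 1ℤ * y) (trans (cong f (sym a≡b)) fa)
    (trans (cong (identity a) (sym a≡b)) (identity-refl a))))
  move : ∀ x y → x ≡ y + (x + - 1ℤ * y)
  move = solve-∀
  pair : ∀ v → f v ≡ identity a v + identity b v
  pair v = trans (move (f v) (identity a v)) (cong (_+_ (identity a v)) (∑≡1⇒identity g-ind ∑g gb v))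

pair-member : ∀ {n} {a b v : Fin n} → identity a v + identity b v ≡ 1ℤ → v ≡ a ⊎ v ≡ b
pair-member {a = a} {b} {v} e with a ≟ᶠ v
... | yes refl = inj₁ refl
... | no a≢v = inj₂ (sym (identity≡1⇒≡ (trans (sym (ℤ.+-identityˡ (identity b v)))
      (trans (cong (_+ identity b v) (sym (identity-≢ a≢v))) e))))

infix 7 _at_and_at_

_at_and_at_ : ∀ {n} → ℤ → Fin n → ℤ → Fin n → Fin n → ℤ
(p at a and q at b) v = p * identity a v + q * identity b v

⟨at,⟩ : ∀ {n} p (a : Fin n) q b u → ⟨ p at a and q at b , u ⟩ ≡ p * u a + q * u b
⟨at,⟩ p a q b u = trans (⟨⟩-linearˡ q (λ v → p * identity a v) (identity b) u)
  (cong₂ (λ x y → x + q * y)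
    (trans (⟨⟩-comm _ u) (trans (⟨⟩-scale p u (identity a)) (cong (p *_) (trans (⟨⟩-comm u (identity a)) (∑-identityˡ a u)))))
    (∑-identityˡ b u))

at-norm : ∀ {n} p {a : Fin n} q {b} → a ≢ b → ⟨ p at a and q at b , p at a and q at b ⟩ ≡ p * p + q * q
at-norm p {a} q {b} a≢b = trans (⟨at,⟩ p a q b _) (trans
  (cong₂ (λ x y → p * x + q * y)
    (cong₂ (λ x y → p * x + q * y) (identity-refl a) (identity-≢ (a≢b ∘ sym)))
    (cong₂ (λ x y → p * x + q * y) (identity-≢ a≢b) (identity-refl b)))
  (solved p q))
  where
  solved : ∀ p q → p * (p * 1ℤ + q * 0ℤ) + q * (p * 0ℤ + q * 1ℤ) ≡ p * p + q * q
  solved = solve-∀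

⟨at,at⟩≡0 : ∀ {n} p {a : Fin n} q {b} r {c} s {d} → a ≢ c → a ≢ d → b ≢ c → b ≢ d →
  ⟨ p at a and q at b , r at c and s at d ⟩ ≡ 0ℤ
⟨at,at⟩≡0 p {a} q {b} r {c} s {d} a≢c a≢d b≢c b≢d = trans (⟨at,⟩ p a q b _) (trans
  (cong₂ (λ x y → p * x + q * y)
    (cong₂ (λ x y → r * x + s * y) (identity-≢ (a≢c ∘ sym)) (identity-≢ (a≢d ∘ sym)))
    (cong₂ (λ x y → r * x + s * y) (identity-≢ (b≢c ∘ sym)) (identity-≢ (b≢d ∘ sym))))
  (solved p q r s))
  where
  solved : ∀ p q r s → p * (r * 0ℤ + s * 0ℤ) + q * (r * 0ℤ + s * 0ℤ) ≡ 0ℤ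
  solved = solve-∀

∑-at : ∀ {n} p (a : Fin n) q b → ∑ (p at a and q at b) ≡ p + q
∑-at p a q b = trans (∑-cong λ v → sym (ℤ.*-identityʳ ((p at a and q at b) v)))
  (trans (⟨at,⟩ p a q b (λ _ → 1ℤ)) (cong₂ _+_ (ℤ.*-identityʳ p) (ℤ.*-identityʳ q)))

norm-+ : ∀ {n} s (u v : Fin n → ℤ) → ⟨ (λ i → u i + s * v i) , (λ i → u i + s * v i) ⟩
  ≡ ⟨ u , u ⟩ + + 2 * s * ⟨ u , v ⟩ + s * s * ⟨ v , v ⟩
norm-+ s u v = trans (⟨⟩-linearˡ s u v (λ i → u i + s * v i)) (trans
  (cong₂ (λ x y → x + s * y) (⟨⟩-linearʳ s u u v) (trans (⟨⟩-linearʳ s v u v) (cong (_+ s * ⟨ v , v ⟩) (⟨⟩-comm v u))))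
  (solved s ⟨ u , u ⟩ ⟨ u , v ⟩ ⟨ v , v ⟩))
  where
  solved : ∀ s a b c → a + s * b + s * (b + s * c) ≡ a + + 2 * s * b + s * s * c
  solved = solve-∀

-- The hypothesis expands carries all spectral information; what follows is combinatorial.
module Expanding {ν} (A : Matrix ℤ (suc ν)) (A-sym : Symmetric A) (A-01 : ∀ u → Indicator (A u))
  (A-irrefl : ∀ v → A v v ≡ 0ℤ) (2≤ν : 2 ℕ.≤ ν)
  (diameter : ∀ {u v} → u ≢ v → A u v ≡ 1ℤ ⊎ ∃ λ w → A u w ≡ 1ℤ × A w v ≡ 1ℤ)
  (∑deg : ∑∑ A ≡ + 3 * + ν)
  (expands : ∀ z → ∑ z ≡ 0ℤ → ⟨ z , z ⟩ ℤ.≤ ⟨ A ∙ z , A ∙ z ⟩) where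

  deg : Fin (suc ν) → ℤ
  deg v = ∑ (A v)

  Dominates : Fin (suc ν) → Set
  Dominates c = ∀ v → v ≢ c → A c v ≡ 1ℤ

  private
    flip : ∀ {u v} → A u v ≡ 1ℤ → A v u ≡ 1ℤ
    flip {u} {v} = trans (A-sym v u)

    0≢1 : ∀ {x} → x ≡ 0ℤ → x ≡ 1ℤ → ⊥
    0≢1 e e′ with trans (sym e) e′
    ... | ()

    adj⇒≢ : ∀ {u v} → A u v ≡ 1ℤ → u ≢ v
    adj⇒≢ {u} uv refl = 0≢1 (A-irrefl u) uv

    ≢1⇒≡0 : ∀ {u v} → A u v ≢ 1ℤ → A u v ≡ 0ℤ
    ≢1⇒≡0 {u} {v} ≢1 with A-01 u v
    ... | inj₁ e = e
    ... | inj₂ e = ⊥-elim (≢1 e)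

    A∙at : ∀ p a q b v → (A ∙ (p at a and q at b)) v ≡ p * A a v + q * A b v
    A∙at p a q b v = trans (⟨⟩-comm (A v) (p at a and q at b)) (trans (⟨at,⟩ p a q b (A v))
      (cong₂ (λ x y → p * x + q * y) (A-sym v a) (A-sym v b)))

  Pair : Fin (suc ν) → Fin (suc ν) → Fin (suc ν) → Set
  Pair i a b = ∀ v → A i v ≡ identity a v + identity b v

  private
    member : ∀ {i} a b {v} → Pair i a b → A i v ≡ 1ℤ → v ≡ a ⊎ v ≡ b
    member a b {v} p iv = pair-member (trans (sym (p v)) iv)

    Pair-swap : ∀ {i a b} → Pair i a b → Pair i b a
    Pair-swap {i} {a} {b} p v = trans (p v) (ℤ.+-comm (identity a v) (identity b v))

    left : ∀ {i a b} → a ≢ b → Pair i a b → A i a ≡ 1ℤ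
    left {i} {a} a≢b p = trans (p a) (cong₂ _+_ (identity-refl a) (identity-≢ (a≢b ∘ sym)))

    right : ∀ {i a b} → a ≢ b → Pair i a b → A i b ≡ 1ℤ
    right {i} {a} {b} a≢b p = left {i} {b} {a} (a≢b ∘ sym) (Pair-swap {i} {a} {b} p)

  deg-two : ∀ {i a} → deg i ≡ + 2 → A i a ≡ 1ℤ → ∃ λ b → a ≢ b × A i b ≡ 1ℤ × Pair i a b
  deg-two {i} = ∑≡2⇒pair (A-01 i)

  -- Equal neighbourhoods put `e_i - e_j` into the kernel of `A`, against `expands`.
  no-twins : ∀ {i j a b} → i ≢ j → Pair i a b → Pair j a b → ⊥
  no-twins {i} {j} {a} {b} i≢j pi pj = absurd (subst₂ ℤ._≤_ (at-norm 1ℤ (- 1ℤ) i≢j) A²≡0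
      (expands (1ℤ at i and - 1ℤ at j) (∑-at 1ℤ i (- 1ℤ) j)))
    where
    absurd : ¬ (+ 2 ℤ.≤ 0ℤ)
    absurd (ℤ.+≤+ ())
    cancel : ∀ x → 1ℤ * x + - 1ℤ * x ≡ 0ℤ
    cancel = solve-∀
    A∙z≡0 : ∀ v → (A ∙ (1ℤ at i and - 1ℤ at j)) v ≡ 0ℤ
    A∙z≡0 v = trans (A∙at 1ℤ i (- 1ℤ) j v) (trans
      (cong (λ x → 1ℤ * A i v + - 1ℤ * x) (trans (pj v) (sym (pi v)))) (cancel (A i v)))
    A²≡0 : ⟨ A ∙ (1ℤ at i and - 1ℤ at j) , A ∙ (1ℤ at i and - 1ℤ at j) ⟩ ≡ 0ℤ
    A²≡0 = ∑-zero {suc ν} λ v → cong (λ x → x * x) (A∙z≡0 v)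

  -- Otherwise x (e_i - e_j) + (e_b - e_c) is shrunk for large x.
  private-neighbours-nonadjacent : ∀ {i j a b c} → a ≢ b → a ≢ c → b ≢ c → i ≢ j → A i j ≡ 0ℤ →
    Pair i a b → Pair j a c → A b c ≡ 0ℤ
  private-neighbours-nonadjacent {i} {j} {a} {b} {c} a≢b a≢c b≢c i≢j ij pi pj = ≢1⇒≡0 λ bc → absurd (estimate bc)
    where
    ib = right a≢b pi
    jc = right a≢c pj
    i≢b = adj⇒≢ ib
    j≢c = adj⇒≢ jc
    i≢c : i ≢ c
    i≢c refl = 0≢1 (trans (A-sym j i) ij) jc
    j≢b : j ≢ b
    j≢b refl = 0≢1 ij ib
    f g h : Fin (suc ν) → ℤ
    f = 1ℤ at i and - 1ℤ at j
    g = 1ℤ at b and - 1ℤ at c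
    h = A ∙ g
    -- If `b` and `c` are adjacent, then `A f = g` and `⟨ h , g ⟩ = -2` make the squared norm of
    -- `g + x f` drop by `2 + 4x - ⟨ h , h ⟩` under `A`. This choice of `x` turns the drop into
    -- `2 + 3x`, which is positive.
    x = ⟨ h , h ⟩
    z : Fin (suc ν) → ℤ
    z v = g v + x * f v
    ∑z : ∑ z ≡ 0ℤ
    ∑z = trans (∑-+* x g f) (trans (cong₂ (λ s t → s + x * t) (∑-at 1ℤ b (- 1ℤ) c) (∑-at 1ℤ i (- 1ℤ) j))
      (trans (ℤ.+-identityˡ (x * 0ℤ)) (ℤ.*-zeroʳ x)))
    A∙f : ∀ v → (A ∙ f) v ≡ g v
    A∙f v = trans (A∙at 1ℤ i (- 1ℤ) j v) (trans (cong₂ (λ s t → 1ℤ * s + - 1ℤ * t) (pi v) (pj v))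
      (solved (identity a v) (identity b v) (identity c v)))
      where
      solved : ∀ a b c → 1ℤ * (a + b) + - 1ℤ * (a + c) ≡ 1ℤ * b + - 1ℤ * c
      solved = solve-∀
    ⟨z,z⟩ : ⟨ z , z ⟩ ≡ + 2 + + 2 * (x * x)
    ⟨z,z⟩ = trans (norm-+ x g f) (trans
      (cong₂ (λ s t → s + t + x * x * ⟨ f , f ⟩) (at-norm 1ℤ (- 1ℤ) b≢c)
        (cong (+ 2 * x *_) (⟨at,at⟩≡0 1ℤ (- 1ℤ) 1ℤ (- 1ℤ) (i≢b ∘ sym) (j≢b ∘ sym) (i≢c ∘ sym) (j≢c ∘ sym))))
      (trans (cong (λ t → + 2 + + 2 * x * 0ℤ + x * x * t) (at-norm 1ℤ (- 1ℤ) i≢j)) (solved x)))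
      where
      solved : ∀ x → + 2 + + 2 * x * 0ℤ + x * x * + 2 ≡ + 2 + + 2 * (x * x)
      solved = solve-∀
    ⟨h,g⟩ : A b c ≡ 1ℤ → ⟨ h , g ⟩ ≡ - + 2
    ⟨h,g⟩ bc = trans (⟨⟩-comm h g) (trans (⟨at,⟩ 1ℤ b (- 1ℤ) c h)
      (cong₂ (λ s t → 1ℤ * s + - 1ℤ * t)
        (trans (A∙at 1ℤ b (- 1ℤ) c b) (cong₂ (λ s t → 1ℤ * s + - 1ℤ * t) (A-irrefl b) (flip bc)))
        (trans (A∙at 1ℤ b (- 1ℤ) c c) (cong₂ (λ s t → 1ℤ * s + - 1ℤ * t) bc (A-irrefl c)))))
    ⟨Az,Az⟩ : A b c ≡ 1ℤ → ⟨ A ∙ z , A ∙ z ⟩ ≡ - + 3 * x + + 2 * (x * x)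
    ⟨Az,Az⟩ bc = trans (⟨⟩-cong Az Az) (trans (norm-+ x h g) (trans
      (cong₂ (λ s t → x + + 2 * x * s + x * x * t) (⟨h,g⟩ bc) (at-norm 1ℤ (- 1ℤ) b≢c)) (solved x)))
      where
      Az : ∀ v → (A ∙ z) v ≡ h v + x * g v
      Az v = trans (∙-linear A x g f v) (cong (λ t → h v + x * t) (A∙f v))
      solved : ∀ x → x + + 2 * x * - + 2 + x * x * + 2 ≡ - + 3 * x + + 2 * (x * x)
      solved = solve-∀
    estimate : A b c ≡ 1ℤ → + 2 + + 3 * x ℤ.≤ 0ℤ
    estimate bc = subst (ℤ._≤ 0ℤ) (solved x (+ 2 * (x * x))) (ℤ.i≤j⇒i-j≤0
      (subst (ℤ._≤ - + 3 * x + + 2 * (x * x)) ⟨z,z⟩ (subst (⟨ z , z ⟩ ℤ.≤_) (⟨Az,Az⟩ bc) (expands z ∑z))))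
      where
      solved : ∀ x y → + 2 + y - (- + 3 * x + y) ≡ + 2 + + 3 * x
      solved = solve-∀
    absurd : ¬ (+ 2 + + 3 * x ℤ.≤ 0ℤ)
    absurd h = ℤ.<⇒≱ (ℤ.+-mono-<-≤ {0ℤ} {+ 2} (ℤ.+<+ (ℕ.s≤s ℕ.z≤n))
      (0≤i*j {+ 3} 0≤+ (∑-nonneg λ v → 0≤i*i ((A ∙ g) v)))) h

  private
    deg≢0 : ∀ v → deg v ≢ 0ℤ
    deg≢0 v deg≡0 = 0≢1 (∑≡0⇒≡0 (indicator-nonneg (A-01 v)) deg≡0 (proj₁ neighbour)) (proj₂ neighbour)
      where
      another : ∀ {ν} → 2 ℕ.≤ ν → (v : Fin (suc ν)) → ∃ λ u → v ≢ u
      another (ℕ.s≤s _) zero    = suc zero , λ ()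
      another (ℕ.s≤s _) (suc _) = zero , λ ()
      neighbour : ∃ λ w → A v w ≡ 1ℤ
      neighbour with another 2≤ν v
      ... | u , v≢u with diameter v≢u
      ...   | inj₁ vu = u , vu
      ...   | inj₂ (w , vw , _) = w , vw

  -- Every walk out of `i` passes through `a` first, so whatever lies within distance two of `i` is
  -- `i`, `a` or a neighbour of `a`.
  pendant⇒dominating : ∀ {i a} → (∀ v → A i v ≡ identity a v) → Dominates a
  pendant⇒dominating {i} {a} p v v≢a with i ≟ᶠ v
  ... | yes refl = flip (trans (p a) (identity-refl a))
  ... | no i≢v with diameter i≢v
  ...   | inj₁ iv = ⊥-elim (v≢a (sym (identity≡1⇒≡ (trans (sym (p v)) iv))))
  ...   | inj₂ (w , iw , wv) = trans (cong (λ x → A x v) (identity≡1⇒≡ (trans (sym (p w)) iw))) wv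

  private
    norm-bound : ∀ {x} → x ≡ 0ℤ ⊎ x ≡ 1ℤ → ¬ (+ 4 ℤ.≤ (1ℤ - x) * (1ℤ - x) + - (1ℤ - x) * - (1ℤ - x))
    norm-bound (inj₁ refl) (ℤ.+≤+ (ℕ.s≤s (ℕ.s≤s ())))
    norm-bound (inj₂ refl) (ℤ.+≤+ ())

  -- If a ≠ b then e_i - e_j + e_a - e_b is shrunk.
  adjacent-pairs⇒dominating : ∀ {i j a b} → j ≢ a → i ≢ b → Pair i j a → Pair j i b → Dominates a
  adjacent-pairs⇒dominating {i} {j} {a} {b} j≢a i≢b pi pj with a ≟ᶠ b
  ... | yes refl = dominates
    where
    dominates : Dominates a
    dominates v v≢a with i ≟ᶠ v | j ≟ᶠ v
    ... | yes refl | _        = flip (right j≢a pi)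
    ... | no _     | yes refl = flip (right i≢b pj)
    ... | no i≢v   | no j≢v with diameter i≢v
    ...   | inj₁ iv with member j a pi iv
    ...     | inj₁ e = ⊥-elim (j≢v (sym e))
    ...     | inj₂ e = ⊥-elim (v≢a e)
    dominates v v≢a | no i≢v | no j≢v | inj₂ (w , iw , wv) with member j a pi iw
    ...     | inj₂ refl = wv
    ...     | inj₁ refl with member i a pj wv
    ...       | inj₁ e = ⊥-elim (i≢v (sym e))
    ...       | inj₂ e = ⊥-elim (v≢a e)
  ... | no a≢b = ⊥-elim (norm-bound (A-01 a b) 4≤)
    where
    ij = left j≢a pi
    ia = right j≢a pi
    jb = right i≢b pj
    i≢j = adj⇒≢ ij
    i≢a = adj⇒≢ ia
    j≢b = adj⇒≢ jb
    ib : A i b ≡ 0ℤ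
    ib = trans (pi b) (cong₂ _+_ (identity-≢ j≢b) (identity-≢ a≢b))
    ja : A j a ≡ 0ℤ
    ja = trans (pj a) (cong₂ _+_ (identity-≢ i≢a) (identity-≢ (a≢b ∘ sym)))
    f g z : Fin (suc ν) → ℤ
    f = 1ℤ at i and - 1ℤ at j
    g = 1ℤ at a and - 1ℤ at b
    z v = f v + 1ℤ * g v
    ∑z : ∑ z ≡ 0ℤ
    ∑z = trans (∑-+* 1ℤ f g) (cong₂ (λ s t → s + 1ℤ * t) (∑-at 1ℤ i (- 1ℤ) j) (∑-at 1ℤ a (- 1ℤ) b))
    ⟨z,z⟩ : ⟨ z , z ⟩ ≡ + 4
    ⟨z,z⟩ = trans (norm-+ 1ℤ f g) (trans
      (cong₂ (λ s t → s + + 2 * 1ℤ * t + 1ℤ * 1ℤ * ⟨ g , g ⟩) (at-norm 1ℤ (- 1ℤ) i≢j)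
        (⟨at,at⟩≡0 1ℤ (- 1ℤ) 1ℤ (- 1ℤ) i≢a i≢b j≢a j≢b))
      (cong (λ t → + 2 + + 2 * 1ℤ * 0ℤ + 1ℤ * 1ℤ * t) (at-norm 1ℤ (- 1ℤ) a≢b)))
    α = A a b
    Az-entry : ∀ v → (A ∙ z) v ≡ (1ℤ * A i v + - 1ℤ * A j v) + 1ℤ * (1ℤ * A a v + - 1ℤ * A b v)
    Az-entry v = trans (∙-linear A 1ℤ f g v) (cong₂ (λ s t → s + 1ℤ * t) (A∙at 1ℤ i (- 1ℤ) j v) (A∙at 1ℤ a (- 1ℤ) b v))
    values : ∀ v {p q r s t u} → A i v ≡ p → A j v ≡ q → A a v ≡ r → A b v ≡ s →
      identity a v ≡ t → identity b v ≡ u →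
      (1ℤ * p + - 1ℤ * q) + 1ℤ * (1ℤ * r + - 1ℤ * s) ≡ (1ℤ - α) * t + - (1ℤ - α) * u →
      (A ∙ z) v ≡ ((1ℤ - α) at a and - (1ℤ - α) at b) v
    values v refl refl refl refl refl refl e = trans (Az-entry v) e
    zero-coefficient : ∀ x → 0ℤ ≡ (1ℤ - x) * 0ℤ + - (1ℤ - x) * 0ℤ
    zero-coefficient = solve-∀
    Az : ∀ v → (A ∙ z) v ≡ ((1ℤ - α) at a and - (1ℤ - α) at b) v
    Az v = cases v (i ≟ᶠ v) (j ≟ᶠ v) (a ≟ᶠ v) (b ≟ᶠ v)
      where
      outside : ∀ {v x y w} → Pair x y w → y ≢ v → w ≢ v → A x v ≡ 1ℤ → ⊥
      outside {y = y} {w} p y≢v w≢v xv with member y w p xv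
      ... | inj₁ e = y≢v (sym e)
      ... | inj₂ e = w≢v (sym e)
      via : ∀ {v x y w} → Pair x y w → x ≢ v → y ≢ v → w ≢ v → (A y v ≡ 1ℤ → ⊥) → A w v ≡ 1ℤ
      via {y = y} {w} p x≢v y≢v w≢v ¬yv with diameter x≢v
      ... | inj₁ xv = ⊥-elim (outside p y≢v w≢v xv)
      ... | inj₂ (t , xt , tv) with member y w p xt
      ...   | inj₁ refl = ⊥-elim (¬yv tv)
      ...   | inj₂ refl = tv
      at-a : ∀ x → (1ℤ * 1ℤ + - 1ℤ * 0ℤ) + 1ℤ * (1ℤ * 0ℤ + - 1ℤ * x) ≡ (1ℤ - x) * 1ℤ + - (1ℤ - x) * 0ℤ
      at-a = solve-∀
      at-b : ∀ x → (1ℤ * 0ℤ + - 1ℤ * 1ℤ) + 1ℤ * (1ℤ * x + - 1ℤ * 0ℤ) ≡ (1ℤ - x) * 0ℤ + - (1ℤ - x) * 1ℤ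
      at-b = solve-∀
      cases : ∀ v → Dec (i ≡ v) → Dec (j ≡ v) → Dec (a ≡ v) → Dec (b ≡ v) →
        (A ∙ z) v ≡ ((1ℤ - α) at a and - (1ℤ - α) at b) v
      cases v (yes refl) _ _ _ = values i (A-irrefl i) (flip ij) (flip ia) (trans (A-sym b i) ib)
        (identity-≢ (i≢a ∘ sym)) (identity-≢ (i≢b ∘ sym)) (zero-coefficient α)
      cases v (no _) (yes refl) _ _ = values j ij (A-irrefl j) (trans (A-sym a j) ja) (flip jb)
        (identity-≢ (j≢a ∘ sym)) (identity-≢ (j≢b ∘ sym)) (zero-coefficient α)
      cases v (no _) (no _) (yes refl) _ = values a ia ja (A-irrefl a) (A-sym b a)
        (identity-refl a) (identity-≢ (a≢b ∘ sym)) (at-a α)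
      cases v (no _) (no _) (no _) (yes refl) = values b ib jb refl (A-irrefl b)
        (identity-≢ a≢b) (identity-refl b) (at-b α)
      -- Such a vertex is adjacent to neither `i` nor `j`, so it is reached from `i` only through
      -- `a` and from `j` only through `b`. Being adjacent to both `a` and `b`, it receives 1 - 1 =
      -- 0.
      cases v (no i≢v) (no j≢v) (no a≢v) (no b≢v) = values v
        (trans (pi v) (cong₂ _+_ (identity-≢ j≢v) (identity-≢ a≢v)))
        (trans (pj v) (cong₂ _+_ (identity-≢ i≢v) (identity-≢ b≢v)))
        (via pi i≢v j≢v a≢v λ jv → outside pj i≢v b≢v jv)
        (via pj j≢v i≢v b≢v λ iv → outside pi j≢v a≢v iv)
        (identity-≢ a≢v) (identity-≢ b≢v) (zero-coefficient α)
    4≤ : + 4 ℤ.≤ (1ℤ - α) * (1ℤ - α) + - (1ℤ - α) * - (1ℤ - α)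
    4≤ = subst (ℤ._≤ (1ℤ - α) * (1ℤ - α) + - (1ℤ - α) * - (1ℤ - α)) ⟨z,z⟩
      (subst (⟨ z , z ⟩ ℤ.≤_) (trans (⟨⟩-cong Az Az) (at-norm (1ℤ - α) (- (1ℤ - α)) a≢b)) (expands z ∑z))

  private
    no-excess : ∀ c {x} → ℤ.Positive c → ¬ (c + x ℤ.≤ x)
    no-excess c@(ℤ.+[1+ _ ]) {x} _ h = ℤ.<⇒≱ (subst (ℤ._< c + x) (ℤ.+-identityˡ x)
      (ℤ.+-monoˡ-< x {0ℤ} {c} (ℤ.+<+ (ℕ.s≤s ℕ.z≤n)))) h

    3≤ : ∀ {x} → 0ℤ ℤ.≤ x → x ≢ 0ℤ → x ≢ 1ℤ → x ≢ + 2 → + 3 ℤ.≤ x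
    3≤ {+ 0} _ ≢0 _ _ = ⊥-elim (≢0 refl)
    3≤ {+ 1} _ _ ≢1 _ = ⊥-elim (≢1 refl)
    3≤ {+ 2} _ _ _ ≢2 = ⊥-elim (≢2 refl)
    3≤ {+ suc (suc (suc n))} _ _ _ _ = ℤ.+≤+ (ℕ.s≤s (ℕ.s≤s (ℕ.s≤s ℕ.z≤n)))

    0≤deg : ∀ v → 0ℤ ℤ.≤ deg v
    0≤deg v = ∑-nonneg (indicator-nonneg (A-01 v))

    ∑-3 : ∑ {suc ν} (λ _ → + 3) ≡ + 3 + + 3 * + ν
    ∑-3 = trans (∑-const (suc ν) (+ 3)) (solved (+ ν))
      where
      solved : ∀ x → (1ℤ + x) * + 3 ≡ + 3 + + 3 * x
      solved = solve-∀

    ∑≤∑deg : ∀ g → (∀ v → g v ℤ.≤ deg v) → ∑ g ℤ.≤ + 3 * + ν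
    ∑≤∑deg g g≤ = subst (∑ g ℤ.≤_) ∑deg (∑-mono g≤)

    -- A record, so that the vertex can be inferred from a proof; the bare equation between a sum
    -- and 2 would not determine it.
    record Two (v : Fin (suc ν)) : Set where
      constructor two
      field
        deg≡2 : deg v ≡ + 2

    open Two

    two? : ∀ v → Dec (Two v)
    two? v = map′ two deg≡2 (deg v ℤ.≟ + 2)

  -- With no dominating vertex, the vertices of degree two are pairwise nonadjacent and
  -- all share a neighbour, which is too large for the mean degree to stay below three.
  module NoDominating (¬dominating : ¬ ∃ Dominates) where

    deg≢1 : ∀ v → deg v ≢ 1ℤ
    deg≢1 v e with ∃-one (A-01 v) (deg≢0 v)
    ... | a , va = ¬dominating (a , pendant⇒dominating {v} {a} (∑≡1⇒identity (A-01 v) e va))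

    3≤deg : ∀ {v} → ¬ Two v → + 3 ℤ.≤ deg v
    3≤deg {v} ¬two = 3≤ {deg v} (0≤deg v) (deg≢0 v) (deg≢1 v) λ e → ¬two (two e)

    independent : ∀ {i j} → Two i → Two j → A i j ≡ 1ℤ → ⊥
    independent {i} {j} (two di) (two dj) ij =
      let a , j≢a , _ , pi = deg-two {i} {j} di ij
          b , i≢b , _ , pj = deg-two {j} {i} dj (flip ij)
      in ¬dominating (a , adjacent-pairs⇒dominating {i} {j} {a} {b} j≢a i≢b pi pj)

    shared : ∀ {i j} a b → Two i → Two j → i ≢ j → Pair i a b → A j a ≡ 1ℤ ⊎ A j b ≡ 1ℤ
    shared {i} {j} a b di dj i≢j pi = go (diameter i≢j)
      where
      via : ∀ {w} → A w j ≡ 1ℤ → w ≡ a ⊎ w ≡ b → A j a ≡ 1ℤ ⊎ A j b ≡ 1ℤ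
      via wj (inj₁ refl) = inj₁ (flip wj)
      via wj (inj₂ refl) = inj₂ (flip wj)
      go : A i j ≡ 1ℤ ⊎ (∃ λ w → A i w ≡ 1ℤ × A w j ≡ 1ℤ) → A j a ≡ 1ℤ ⊎ A j b ≡ 1ℤ
      go (inj₁ ij)            = ⊥-elim (independent di dj ij)
      go (inj₂ (w , iw , wj)) = via wj (member a b pi iw)

    nonadjacent : ∀ {i j} → Two i → Two j → A i j ≡ 0ℤ
    nonadjacent di dj = ≢1⇒≡0 (independent di dj)

    -- The second neighbour `c` of `j` differs from `b`, since otherwise `i` and `j` would be twins;
    -- the test vector of `private-neighbours-nonadjacent` then separates `b` from `c`.
    private-neighbour : ∀ {i j} a b → Two i → Two j → i ≢ j → a ≢ b → Pair i a b → A j a ≡ 1ℤ →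
      ∃ λ c → Pair j a c × A j c ≡ 1ℤ × a ≢ c × b ≢ c × A b c ≡ 0ℤ
    private-neighbour {i} {j} a b di dj i≢j a≢b pi ja = c , pj , jc , a≢c , b≢c ,
      private-neighbours-nonadjacent {i} {j} {a} {b} {c} a≢b a≢c b≢c i≢j (nonadjacent di dj) pi pj
      where
      other = deg-two {j} {a} (deg≡2 dj) ja
      c   = proj₁ other
      a≢c = proj₁ (proj₂ other)
      jc  = proj₁ (proj₂ (proj₂ other))
      pj  = proj₂ (proj₂ (proj₂ other))
      b≢c : b ≢ c
      b≢c b≡c = no-twins {i} {j} {a} {b} i≢j pi (subst (Pair j a) (sym b≡c) pj)

    -- `c` is within distance two of `i`, whose neighbours are `a` and `b`, and the route through
    -- `b` is closed.
    third-neighbour : ∀ {i c} a b → Pair i a b → a ≢ c → b ≢ c → i ≢ c → A b c ≡ 0ℤ → A a c ≡ 1ℤ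
    third-neighbour {i} {c} a b pi a≢c b≢c i≢c bc = go (diameter i≢c)
      where
      via : ∀ {w} → A w c ≡ 1ℤ → w ≡ a ⊎ w ≡ b → A a c ≡ 1ℤ
      via wc (inj₁ refl) = wc
      via wc (inj₂ refl) = ⊥-elim (0≢1 bc wc)
      outside : c ≡ a ⊎ c ≡ b → A a c ≡ 1ℤ
      outside (inj₁ e) = ⊥-elim (a≢c (sym e))
      outside (inj₂ e) = ⊥-elim (b≢c (sym e))
      go : A i c ≡ 1ℤ ⊎ (∃ λ w → A i w ≡ 1ℤ × A w c ≡ 1ℤ) → A a c ≡ 1ℤ
      go (inj₁ ic)            = outside (member a b pi ic)
      go (inj₂ (w , iw , wc)) = via wc (member a b pi iw)

    -- The neighbourhoods of `i`, `j`, `l` would be {a, b}, {a, c}, {b, c}: as `j` and `l` share a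
    -- neighbour, their remaining ones coincide. Then `i` and `j` force `a` and `c` to be adjacent,
    -- while `i` and `l` force the opposite.
    no-triangle : ∀ {i j l} a b → Two i → Two j → Two l → i ≢ j → i ≢ l → a ≢ b → Pair i a b →
      A j a ≡ 1ℤ → A l b ≡ 1ℤ → A l a ≡ 0ℤ → ⊥
    no-triangle {i} {j} {l} a b di dj dl i≢j i≢l a≢b pi ja lb la =
      let c , pj , jc , a≢c , b≢c , bc = private-neighbour a b di dj i≢j a≢b pi ja
          c′ , pl , lc′ , b≢c′ , a≢c′ , ac′ =
            private-neighbour b a di dl i≢l (a≢b ∘ sym) (Pair-swap {i} {a} {b} pi) lb
          i≢c : i ≢ c
          i≢c i≡c = independent dj di (trans (cong (A j) i≡c) jc)
          c≡c′ : c ≡ c′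
          c≡c′ = same pl b≢c (shared a c dj dl j≢l pj)
      in 0≢1 (trans (cong (A a) c≡c′) ac′) (third-neighbour a b pi a≢c b≢c i≢c bc)
      where
      j≢l : j ≢ l
      j≢l refl = 0≢1 la ja
      same : ∀ {c c′} → Pair l b c′ → b ≢ c → A l a ≡ 1ℤ ⊎ A l c ≡ 1ℤ → c ≡ c′
      same pl b≢c (inj₁ la≡1) = ⊥-elim (0≢1 la la≡1)
      same {c} {c′} pl b≢c (inj₂ lc) = pick (member b c′ pl lc)
        where
        pick : c ≡ b ⊎ c ≡ c′ → c ≡ c′
        pick (inj₁ e) = ⊥-elim (b≢c (sym e))
        pick (inj₂ e) = e

    -- Pairwise intersecting two-element sets have a common element or form a triangle, and
    -- `no-triangle` excludes the latter.
    common-neighbour : ∀ {i} a b → Two i → a ≢ b → Pair i a b →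
      (∀ j → i ≢ j → Two j → A j a ≡ 1ℤ) ⊎ (∀ j → i ≢ j → Two j → A j b ≡ 1ℤ)
    common-neighbour {i} a b di a≢b pi =
      go (any? (λ j → ¬? (i ≟ᶠ j) ×-dec (two? j ×-dec (A j a ℤ.≟ 0ℤ))))
      where
      other : ∀ j x → ¬ (A j x ≡ 0ℤ) → A j x ≡ 1ℤ
      other j x ≢0 = pick (A-01 j x)
        where
        pick : A j x ≡ 0ℤ ⊎ A j x ≡ 1ℤ → A j x ≡ 1ℤ
        pick (inj₁ e) = ⊥-elim (≢0 e)
        pick (inj₂ e) = e
      go : Dec (∃ λ j → i ≢ j × Two j × A j a ≡ 0ℤ) →
        (∀ j → i ≢ j → Two j → A j a ≡ 1ℤ) ⊎ (∀ j → i ≢ j → Two j → A j b ≡ 1ℤ)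
      go (no ¬p) = inj₁ λ j i≢j dj → other j a λ e → ¬p (j , i≢j , dj , e)
      go (yes (l , i≢l , dl , la)) = inj₂ λ j i≢j dj → at-b j i≢j dj (shared a b di dj i≢j pi)
        where
        lb : A l a ≡ 1ℤ ⊎ A l b ≡ 1ℤ → A l b ≡ 1ℤ
        lb (inj₁ e) = ⊥-elim (0≢1 la e)
        lb (inj₂ e) = e
        at-b : ∀ j → i ≢ j → Two j → A j a ≡ 1ℤ ⊎ A j b ≡ 1ℤ → A j b ≡ 1ℤ
        at-b j i≢j dj (inj₁ ja) = ⊥-elim
          (no-triangle a b di dj dl i≢j i≢l a≢b pi ja (lb (shared a b di dl i≢l pi)) la)
        at-b j i≢j dj (inj₂ jb) = jb

    -- If `s` vertices have degree two, then `a` has degree at least `s + 1` on account of `c`, and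
    -- the remaining vertices have degree at least 3. The degree sum is thus at least
    -- `3 (ν + 1) - s + (s + 1) - 3 = 3ν + 1`.
    no-common-neighbour-of-twos : ∀ {a c} → ¬ Two a → (∀ l → Two l → A l a ≡ 1ℤ) → A a c ≡ 1ℤ → ¬ Two c → ⊥
    no-common-neighbour-of-twos {a} {c} ¬two-a all-a ac ¬two-c =
      no-excess 1ℤ _ (ℤ.≤-trans lower (∑≤∑deg g (λ v → g≤deg v (two? v) (a ≟ᶠ v))))
      where
      χ : ∀ {v} → Dec (Two v) → ℤ
      χ (yes _) = 1ℤ
      χ (no _)  = 0ℤ
      χs : Fin (suc ν) → ℤ
      χs v = χ (two? v)
      g : Fin (suc ν) → ℤ
      g v = + 3 + - 1ℤ * χs v + (deg a - + 3) * identity a v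
      a-row : ∀ v (d : Dec (Two v)) → Dec (c ≡ v) → χ d + 1ℤ * identity c v ℤ.≤ A a v
      a-row v (yes dv) (yes refl) = ⊥-elim (¬two-c dv)
      a-row v (yes dv) (no c≢v) =
        ℤ.≤-reflexive (trans (cong (λ x → 1ℤ + 1ℤ * x) (identity-≢ c≢v)) (sym (flip (all-a v dv))))
      a-row v (no _) (yes refl) = ℤ.≤-reflexive (trans (cong (λ x → 0ℤ + 1ℤ * x) (identity-refl c)) (sym ac))
      a-row v (no _) (no c≢v) = subst (ℤ._≤ A a v) (sym (cong (λ x → 0ℤ + 1ℤ * x) (identity-≢ c≢v)))
        (indicator-nonneg (A-01 a) v)
      deg-a : ∑ χs + 1ℤ ℤ.≤ deg a
      deg-a = subst (ℤ._≤ deg a) (trans (∑-+* 1ℤ χs (identity c)) (cong (λ x → ∑ χs + 1ℤ * x) (∑-identity c)))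
        (∑-mono λ v → a-row v (two? v) (c ≟ᶠ v))
      g≤deg : ∀ v (d : Dec (Two v)) → Dec (a ≡ v) → + 3 + - 1ℤ * χ d + (deg a - + 3) * identity a v ℤ.≤ deg v
      g≤deg v (yes dv) (yes refl) = ⊥-elim (¬two-a dv)
      g≤deg v (yes dv) (no a≢v) = ℤ.≤-reflexive (trans (cong (λ x → + 2 + (deg a - + 3) * x) (identity-≢ a≢v))
        (trans (cong (_+_ (+ 2)) (ℤ.*-zeroʳ (deg a - + 3))) (sym (deg≡2 dv))))
      g≤deg v (no _) (yes refl) = ℤ.≤-reflexive (trans (cong (λ x → + 3 + (deg a - + 3) * x) (identity-refl a)) (solved (deg a)))
        where
        solved : ∀ x → + 3 + (x - + 3) * 1ℤ ≡ x
        solved = solve-∀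
      g≤deg v (no ¬dv) (no a≢v) = subst (ℤ._≤ deg v) (sym (trans (cong (λ x → + 3 + (deg a - + 3) * x) (identity-≢ a≢v))
        (cong (_+_ (+ 3)) (ℤ.*-zeroʳ (deg a - + 3))))) (3≤deg ¬dv)
      ∑g : ∑ g ≡ + 3 * + ν - (∑ χs + 1ℤ) + deg a + 1ℤ
      ∑g = trans (∑-+* (deg a - + 3) (λ v → + 3 + - 1ℤ * χs v) (identity a)) (trans
        (cong₂ (λ x y → x + (deg a - + 3) * y) (trans (∑-+* {suc ν} (- 1ℤ) (λ _ → + 3) χs)
          (cong (_+ - 1ℤ * ∑ χs) ∑-3)) (∑-identity a))
        (solved (+ ν) (∑ χs) (deg a)))
        where
        solved : ∀ n s d → + 3 + + 3 * n + - 1ℤ * s + (d - + 3) * 1ℤ ≡ + 3 * n - (s + 1ℤ) + d + 1ℤ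
        solved = solve-∀
      lower : 1ℤ + + 3 * + ν ℤ.≤ ∑ g
      lower = subst (1ℤ + + 3 * + ν ℤ.≤_) (sym ∑g) (subst (ℤ._≤ + 3 * + ν - (∑ χs + 1ℤ) + deg a + 1ℤ)
        (solved (+ 3 * + ν) (∑ χs + 1ℤ))
        (ℤ.+-monoˡ-≤ 1ℤ (ℤ.+-monoʳ-≤ (+ 3 * + ν - (∑ χs + 1ℤ)) deg-a)))
        where
        solved : ∀ n s → n - s + s + 1ℤ ≡ 1ℤ + n
        solved = solve-∀

    -- The other neighbour `c` of `j` supplies the extra neighbour of `a`: it is adjacent to `a`,
    -- and it cannot have degree two because it is adjacent to `j`.
    no-common-neighbour : ∀ {i j} a b → Two i → Two j → i ≢ j → a ≢ b → Pair i a b →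
      (∀ l → i ≢ l → Two l → A l a ≡ 1ℤ) → ⊥
    no-common-neighbour {i} {j} a b di dj i≢j a≢b pi all-a =
      let c , pj , jc , a≢c , b≢c , bc = private-neighbour a b di dj i≢j a≢b pi (all-a j i≢j dj)
      in no-common-neighbour-of-twos (λ da → independent di da ia) (λ l dl → near l dl (i ≟ᶠ l))
           (third-neighbour a b pi a≢c b≢c (λ i≡c → independent dj di (trans (cong (A j) i≡c) jc)) bc)
           (λ dc → independent dj dc jc)
      where
      ia : A i a ≡ 1ℤ
      ia = left {i} a≢b pi
      near : ∀ l → Two l → Dec (i ≡ l) → A l a ≡ 1ℤ
      near l dl (yes refl) = ia
      near l dl (no i≢l)   = all-a l i≢l dl

    -- Without vertices of degree two the degree sum is at least `3ν + 3`, with a single one at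
    -- least `3ν + 2`; from two on, the common neighbour takes over.
    contradiction : ⊥
    contradiction = first (any? two?)
      where
      only : ∀ {i} → Two i → ¬ (∃ λ j → i ≢ j × Two j) → ⊥
      only {i} di ¬two = no-excess (+ 2) _ (subst (ℤ._≤ + 3 * + ν) ∑g (∑≤∑deg g λ v → g≤deg v (i ≟ᶠ v)))
        where
        g : Fin (suc ν) → ℤ
        g v = + 3 + - 1ℤ * identity i v
        g≤deg : ∀ v → Dec (i ≡ v) → g v ℤ.≤ deg v
        g≤deg v (yes refl) = ℤ.≤-reflexive (trans (cong (λ x → + 3 + - 1ℤ * x) (identity-refl i)) (sym (deg≡2 di)))
        g≤deg v (no i≢v) = subst (ℤ._≤ deg v) (cong (λ x → + 3 + - 1ℤ * x) (sym (identity-≢ i≢v)))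
          (3≤deg λ dv → ¬two (v , i≢v , dv))
        ∑g : ∑ g ≡ + 2 + + 3 * + ν
        ∑g = trans (∑-+* {suc ν} (- 1ℤ) (λ _ → + 3) (identity i)) (trans
          (cong₂ (λ x y → x + - 1ℤ * y) ∑-3 (∑-identity i)) (solved (+ 3 * + ν)))
          where
          solved : ∀ n → + 3 + n + - 1ℤ * 1ℤ ≡ + 2 + n
          solved = solve-∀
      second : ∀ {i} → Two i → Dec (∃ λ j → i ≢ j × Two j) → ⊥
      second di (no ¬two) = only di ¬two
      second {i} di (yes (j , i≢j , dj)) =
        let a , ia = ∃-one (A-01 i) (deg≢0 i)
            b , a≢b , ib , pi = deg-two {i} {a} (deg≡2 di) ia
            pick : (∀ l → i ≢ l → Two l → A l a ≡ 1ℤ) ⊎ (∀ l → i ≢ l → Two l → A l b ≡ 1ℤ) → ⊥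
            pick = λ { (inj₁ all-a) → no-common-neighbour a b di dj i≢j a≢b pi all-a
                     ; (inj₂ all-b) → no-common-neighbour b a di dj i≢j (a≢b ∘ sym) (Pair-swap {i} {a} {b} pi) all-b }
        in pick (common-neighbour a b di a≢b pi)
      first : Dec (∃ Two) → ⊥
      first (no ¬two) = no-excess (+ 3) _ (subst (ℤ._≤ + 3 * + ν) ∑-3
        (∑≤∑deg (λ _ → + 3) λ v → 3≤deg λ dv → ¬two (v , dv)))
      first (yes (i , di)) = second di (any? λ j → ¬? (i ≟ᶠ j) ×-dec two? j)

  dominating-vertex : ∃ Dominates
  dominating-vertex = decidable-stable
    (any? λ c → all? λ v → ¬? (v ≟ᶠ c) →-dec (A c v ℤ.≟ 1ℤ)) NoDominating.contradiction

  -- Degrees in the presence of a dominating vertex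

  module _ {c} (dominates : Dominates c) where

    private
      deg-c : deg c ≡ + ν
      deg-c = trans (∑-cong λ v → row v (c ≟ᶠ v)) (trans
        (∑-+* {suc ν} (- 1ℤ) (λ _ → 1ℤ) (identity c))
        (trans (cong₂ (λ x y → x + - 1ℤ * y) (∑-const (suc ν) 1ℤ) (∑-identity c)) (solved (+ ν))))
        where
        row : ∀ v → Dec (c ≡ v) → A c v ≡ 1ℤ + - 1ℤ * identity c v
        row v (yes refl) = trans (A-irrefl c) (cong (λ x → 1ℤ + - 1ℤ * x) (sym (identity-refl c)))
        row v (no c≢v) = trans (dominates v (c≢v ∘ sym)) (cong (λ x → 1ℤ + - 1ℤ * x) (sym (identity-≢ c≢v)))
        solved : ∀ x → (1ℤ + x) * 1ℤ + - 1ℤ * 1ℤ ≡ x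
        solved = solve-∀

    private
      1≤deg : ∀ {v} → v ≢ c → 1ℤ ℤ.≤ deg v
      1≤deg {v} v≢c = subst (ℤ._≤ deg v) (flip (dominates v v≢c)) (term≤∑ (indicator-nonneg (A-01 v)) c)

      A∙identity : ∀ i v → (A ∙ identity i) v ≡ A i v
      A∙identity i v = trans (⟨⟩-comm (A v) (identity i)) (trans (∑-identityˡ i (A v)) (A-sym v i))

      identity-c : ∀ {v} → v ≢ c → identity c v ≡ 0ℤ
      identity-c v≢c = identity-≢ (v≢c ∘ sym)

    -- Otherwise 1 - e_c - ν e_i is shrunk.
    no-pendant : ∀ {i} → i ≢ c → deg i ≢ 1ℤ
    no-pendant {i} i≢c di = no-excess (+ ν) (positive 2≤ν) (subst (ℤ._≤ (+ ν - + 2) * + ν) (swap (+ ν))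
      (subst (ℤ._≤ (+ ν - + 2) * + ν) ⟨z,z⟩ (ℤ.≤-trans (expands z ∑z)
        (subst (⟨ A ∙ z , A ∙ z ⟩ ℤ.≤_) ∑h (∑-mono λ v → Az²≤h v (v ≟ᶠ c))))))
      where
      positive : ∀ {m} → 2 ℕ.≤ m → ℤ.Positive (+ m)
      positive (ℕ.s≤s _) = _
      swap : ∀ n → n * n - n ≡ n + (n - + 2) * n
      swap = solve-∀
      row-i : ∀ v → A i v ≡ identity c v
      row-i = ∑≡1⇒identity (A-01 i) di (flip (dominates i i≢c))
      z h : Fin (suc ν) → ℤ
      z v = 1ℤ + - 1ℤ * identity c v + - + ν * identity i v
      -- Off `c` the entry of `A z` is `deg v - 1`. It is 0 at `i` and otherwise at most `ν - 2`,
      -- because `v` is adjacent neither to itself nor to `i`; so its square is at most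
      -- `(ν - 2)(deg v - 1)`. The last term makes `h` vanish at `c`, as `A z` does.
      h v = (+ ν - + 2) * (deg v + - 1ℤ * 1ℤ + - (+ ν - 1ℤ) * identity c v)
      ones : Fin (suc ν) → ℤ
      ones _ = 1ℤ
      ∑z : ∑ z ≡ 0ℤ
      ∑z = trans (∑-+* (- + ν) (λ v → 1ℤ + - 1ℤ * identity c v) (identity i)) (trans
        (cong₂ (λ x y → x + - + ν * y) (trans (∑-+* (- 1ℤ) ones (identity c))
          (cong₂ (λ x y → x + - 1ℤ * y) (∑-const (suc ν) 1ℤ) (∑-identity c))) (∑-identity i))
        (solved (+ ν)))
        where
        solved : ∀ n → (1ℤ + n) * 1ℤ + - 1ℤ * 1ℤ + - n * 1ℤ ≡ 0ℤ
        solved = solve-∀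
      ⟨z,z⟩ : ⟨ z , z ⟩ ≡ + ν * + ν - + ν
      ⟨z,z⟩ = trans (⟨⟩-linear₃ (- 1ℤ) (- + ν) ones (identity c) (identity i) z) (trans
        (cong₂ (λ x y → x + - + ν * y)
          (cong₂ (λ x y → x + - 1ℤ * y)
            (trans (∑-cong λ v → ℤ.*-identityʳ (z v)) ∑z)
            (trans (trans (⟨⟩-comm z (identity c)) (∑-identityˡ c z))
              (cong₂ (λ x y → 1ℤ + - 1ℤ * x + - + ν * y) (identity-refl c) (identity-≢ i≢c))))
          (trans (trans (⟨⟩-comm z (identity i)) (∑-identityˡ i z))
            (cong₂ (λ x y → 1ℤ + - 1ℤ * x + - + ν * y) (identity-c i≢c) (identity-refl i))))
        (solved (+ ν)))
        where
        solved : ∀ n → 0ℤ + - 1ℤ * (1ℤ + - 1ℤ * 1ℤ + - n * 0ℤ) + - n * (1ℤ + - 1ℤ * 0ℤ + - n * 1ℤ) ≡ n * n - n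
        solved = solve-∀
      Az : ∀ v → (A ∙ z) v ≡ deg v + - 1ℤ * A c v + - + ν * identity c v
      Az v = trans (∙-linear₃ A (- 1ℤ) (- + ν) ones (identity c) (identity i) v) (cong₂ (λ x y → x + - + ν * y)
        (cong₂ (λ x y → x + - 1ℤ * y) (∑-cong λ u → ℤ.*-identityʳ (A v u)) (A∙identity c v))
        (trans (A∙identity i v) (row-i v)))
      ∑h : ∑ h ≡ (+ ν - + 2) * + ν
      ∑h = trans (sym (*-distribˡ-sum (+ ν - + 2) λ v → deg v + - 1ℤ * 1ℤ + - (+ ν - 1ℤ) * identity c v))
        (cong ((+ ν - + 2) *_) (trans
          (∑-+* (- (+ ν - 1ℤ)) (λ v → deg v + - 1ℤ * 1ℤ) (identity c)) (trans
          (cong₂ (λ x y → x + - (+ ν - 1ℤ) * y) (trans (∑-+* (- 1ℤ) deg ones)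
            (cong₂ (λ x y → x + - 1ℤ * y) ∑deg (∑-const (suc ν) 1ℤ))) (∑-identity c))
          (solved (+ ν)))))
        where
        solved : ∀ n → + 3 * n + - 1ℤ * ((1ℤ + n) * 1ℤ) + - (n - 1ℤ) * 1ℤ ≡ n
        solved = solve-∀
      deg-1 : ∀ {v} → v ≢ c → 0ℤ ℤ.≤ deg v - 1ℤ
      deg-1 v≢c = ℤ.i≤j⇒0≤j-i (1≤deg v≢c)
      0≤ν-2 : 0ℤ ℤ.≤ + ν - + 2
      0≤ν-2 = ℤ.i≤j⇒0≤j-i (ℤ.+≤+ 2≤ν)
      deg-bound : ∀ {v} → v ≢ c → Dec (i ≡ v) → deg v - 1ℤ ℤ.≤ + ν - + 2
      deg-bound _ (yes refl) = subst (ℤ._≤ + ν - + 2) (sym (cong (_- 1ℤ) di)) 0≤ν-2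
      deg-bound {v} v≢c (no i≢v) = subst (deg v - 1ℤ ℤ.≤_) (solved (+ ν))
        (ℤ.+-monoˡ-≤ (- 1ℤ) (subst (deg v ℤ.≤_) ∑b (∑-mono λ u → row u (v ≟ᶠ u) (i ≟ᶠ u))))
        where
        solved : ∀ n → (1ℤ + n) * 1ℤ + - 1ℤ * 1ℤ + - 1ℤ * 1ℤ - 1ℤ ≡ n - + 2
        solved = solve-∀
        ∑b : ∑ (λ u → 1ℤ + - 1ℤ * identity v u + - 1ℤ * identity i u) ≡ (1ℤ + + ν) * 1ℤ + - 1ℤ * 1ℤ + - 1ℤ * 1ℤ
        ∑b = trans (∑-+* (- 1ℤ) (λ u → 1ℤ + - 1ℤ * identity v u) (identity i))
          (cong₂ (λ x y → x + - 1ℤ * y) (trans (∑-+* (- 1ℤ) ones (identity v))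
            (cong₂ (λ x y → x + - 1ℤ * y) (∑-const (suc ν) 1ℤ) (∑-identity v))) (∑-identity i))
        ≤1 : ∀ {x} → x ≡ 0ℤ ⊎ x ≡ 1ℤ → x ℤ.≤ 1ℤ
        ≤1 (inj₁ refl) = ℤ.+≤+ ℕ.z≤n
        ≤1 (inj₂ refl) = ℤ.≤-refl
        row : ∀ u → Dec (v ≡ u) → Dec (i ≡ u) →
          A v u ℤ.≤ 1ℤ + - 1ℤ * identity v u + - 1ℤ * identity i u
        row u (yes refl) _ = ℤ.≤-reflexive (trans (A-irrefl v)
          (sym (cong₂ (λ x y → 1ℤ + - 1ℤ * x + - 1ℤ * y) (identity-refl v) (identity-≢ i≢v))))
        row u (no v≢u) (yes refl) = ℤ.≤-reflexive (trans (trans (A-sym v i) (trans (row-i v) (identity-c v≢c)))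
          (sym (cong₂ (λ x y → 1ℤ + - 1ℤ * x + - 1ℤ * y) (identity-≢ v≢u) (identity-refl i))))
        row u (no v≢u) (no i≢u) = subst (A v u ℤ.≤_)
          (sym (cong₂ (λ x y → 1ℤ + - 1ℤ * x + - 1ℤ * y) (identity-≢ v≢u) (identity-≢ i≢u))) (≤1 (A-01 v u))
      Az²≤h : ∀ v → Dec (v ≡ c) → (A ∙ z) v * (A ∙ z) v ℤ.≤ h v
      Az²≤h v (yes refl) = ℤ.≤-reflexive (trans (cong (λ x → x * x) (trans (Az c) (trans
          (cong₂ (λ x y → deg c + - 1ℤ * x + - + ν * y) (A-irrefl c) (identity-refl c))
          (trans (cong (λ d → d + - 1ℤ * 0ℤ + - + ν * 1ℤ) deg-c) (solved (+ ν))))))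
        (sym (trans (cong₂ (λ d y → (+ ν - + 2) * (d + - 1ℤ * 1ℤ + - (+ ν - 1ℤ) * y)) deg-c (identity-refl c))
          (solved′ (+ ν)))))
        where
        solved : ∀ n → n + - 1ℤ * 0ℤ + - n * 1ℤ ≡ 0ℤ
        solved = solve-∀
        solved′ : ∀ n → (n - + 2) * (n + - 1ℤ * 1ℤ + - (n - 1ℤ) * 1ℤ) ≡ 0ℤ
        solved′ = solve-∀
      Az²≤h v (no v≢c) = subst (λ t → t * t ℤ.≤ h v) (sym Azv) (subst ((deg v - 1ℤ) * (deg v - 1ℤ) ℤ.≤_) (sym hv)
        (ℤ.*-monoʳ-≤-nonNeg (deg v - 1ℤ) {{ℤ.nonNegative (deg-1 v≢c)}} (deg-bound v≢c (i ≟ᶠ v))))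
        where
        Azv : (A ∙ z) v ≡ deg v - 1ℤ
        Azv = trans (Az v) (trans (cong₂ (λ x y → deg v + - 1ℤ * x + - + ν * y) (dominates v v≢c) (identity-c v≢c))
          (solved (deg v) (+ ν)))
          where
          solved : ∀ d n → d + - 1ℤ * 1ℤ + - n * 0ℤ ≡ d - 1ℤ
          solved = solve-∀
        hv : h v ≡ (+ ν - + 2) * (deg v - 1ℤ)
        hv = trans (cong (λ y → (+ ν - + 2) * (deg v + - 1ℤ * 1ℤ + - (+ ν - 1ℤ) * y)) (identity-c v≢c))
          (solved (deg v) (+ ν))
          where
          solved : ∀ d n → (n - + 2) * (d + - 1ℤ * 1ℤ + - (n - 1ℤ) * 0ℤ) ≡ (n - + 2) * (d - 1ℤ)
          solved = solve-∀

    -- Off the centre there are `ν` vertices, each of degree at least 2, and their degrees add up to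
    -- `3ν - ν = 2ν`.
    others-have-degree-two : ∀ {v} → v ≢ c → deg v ≡ + 2
    others-have-degree-two {v} v≢c = ℤ.i-j≡0⇒i≡j (deg v) (+ 2) (trans (sym (off-centre v≢c))
      (∑≡0⇒≡0 (λ u → 0≤h u (u ≟ᶠ c)) ∑h v))
      where
      h : Fin (suc ν) → ℤ
      h u = deg u + - 1ℤ * + 2 + - (+ ν - + 2) * identity c u
      2≤ : ∀ {x} → 1ℤ ℤ.≤ x → x ≢ 1ℤ → + 2 ℤ.≤ x
      2≤ {+ 1} _ ≢1 = ⊥-elim (≢1 refl)
      2≤ {+ suc (suc _)} _ _ = ℤ.+≤+ (ℕ.s≤s (ℕ.s≤s ℕ.z≤n))
      2≤ {+ 0} (ℤ.+≤+ ()) _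
      off-centre : ∀ {u} → u ≢ c → h u ≡ deg u - + 2
      off-centre {u} u≢c = trans (cong (λ y → deg u + - 1ℤ * + 2 + - (+ ν - + 2) * y) (identity-c u≢c))
        (solved (deg u) (- (+ ν - + 2)))
        where
        solved : ∀ d n → d + - 1ℤ * + 2 + n * 0ℤ ≡ d - + 2
        solved = solve-∀
      0≤h : ∀ u → Dec (u ≡ c) → 0ℤ ℤ.≤ h u
      0≤h u (yes refl) = ℤ.≤-reflexive (sym (trans
        (cong₂ (λ d y → d + - 1ℤ * + 2 + - (+ ν - + 2) * y) deg-c (identity-refl c)) (solved (+ ν))))
        where
        solved : ∀ n → n + - 1ℤ * + 2 + - (n - + 2) * 1ℤ ≡ 0ℤ
        solved = solve-∀
      0≤h u (no u≢c) = subst (0ℤ ℤ.≤_) (sym (off-centre u≢c)) (ℤ.i≤j⇒0≤j-i (2≤ (1≤deg u≢c) (no-pendant u≢c)))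
      ∑h : ∑ h ≡ 0ℤ
      ∑h = trans (∑-+* (- (+ ν - + 2)) (λ u → deg u + - 1ℤ * + 2) (identity c)) (trans
        (cong₂ (λ x y → x + - (+ ν - + 2) * y) (trans (∑-+* {suc ν} (- 1ℤ) deg (λ _ → + 2))
          (cong₂ (λ x y → x + - 1ℤ * y) ∑deg (∑-const (suc ν) (+ 2)))) (∑-identity c))
        (solved (+ ν)))
        where
        solved : ∀ n → + 3 * n + - 1ℤ * ((1ℤ + n) * + 2) + - (n - + 2) * 1ℤ ≡ 0ℤ
        solved = solve-∀

-- The graph behind a distance matrix cospectral with that of the friendship graph

adjacency : ∀ {n} → Graph n → Matrix ℤ n
adjacency G u v = if adj G u v then 1ℤ else 0ℤ

module _ {n} (G : Graph n) where

  adjacency-01 : ∀ u → Indicator (adjacency G u)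
  adjacency-01 u v with adj G u v
  ... | true  = inj₂ refl
  ... | false = inj₁ refl

  adjacency-sym : Symmetric (adjacency G)
  adjacency-sym u v = cong (if_then 1ℤ else 0ℤ) (adj-sym G u v)

  adjacency-irrefl : ∀ v → adjacency G v v ≡ 0ℤ
  adjacency-irrefl v = cong (if_then 1ℤ else 0ℤ) (adj-irrefl G v)

  T⇒adjacency≡1 : ∀ {u v} → T (adj G u v) → adjacency G u v ≡ 1ℤ
  T⇒adjacency≡1 uv = cong (if_then 1ℤ else 0ℤ) (T⇒≡true uv)

  adjacency≡1⇒adj : ∀ {u v} → adjacency G u v ≡ 1ℤ → adj G u v ≡ true
  adjacency≡1⇒adj {u} {v} e with adj G u v
  ... | true = refl
  adjacency≡1⇒adj {u} {v} () | false

record Windmill {n} (G : Graph n) : Set where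
  field
    centre        : Fin n
    centre-adj    : ∀ v → v ≢ centre → adjacency G centre v ≡ 1ℤ
    others-degree : ∀ {v} → v ≢ centre → ∑ (adjacency G v) ≡ + 2

pow-cong : ∀ {n} {A B : Matrix ℤ n} → (∀ i j → A i j ≡ B i j) → ∀ p i j → pow A p i j ≡ pow B p i j
pow-cong A≡B zero    i j = refl
pow-cong A≡B (suc p) i j = ∑-cong λ l → cong₂ _*_ (pow-cong A≡B p i l) (A≡B l j)

tr-pow-2 : ∀ {n} {A : Matrix ℤ n} → Symmetric A → tr (pow A 2) ≡ ∑∑ (λ i j → A i j * A i j)
tr-pow-2 {A = A} A-sym = ∑∑-cong λ i l → cong₂ _*_ (pow-1 A i l) (A-sym l i)

module Cospectral {k} {H : Graph (1 ℕ.+ k ℕ.* 2)} {D : Matrix ℕ (1 ℕ.+ k ℕ.* 2)} (isD : IsDistanceMatrix H D)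
  (traces : ∀ p → tr (pow (toℤ D) p) ≡ tr (pow (friendshipMatrix k) p)) where

  open Distance isD

  private
    ν = k ℕ.* 2
    κ = + k
    A = adjacency H
    B = toℤ D

  annihilated : ∀ z i → N B (Q κ B z) i ≡ 0ℤ
  annihilated z i = trans (sym (poly≡NQ B κ z i)) (∑-zero λ j →
    trans (cong (_* z j) (poly≡0-agree toℤ-sym (friendshipMatrix-sym k) traces (coefficients κ) (poly-friendship k) i j))
      (ℤ.*-zeroˡ (z j)))

  ∑∑B² : ∑∑ (λ i j → B i j * B i j) ≡ + 16 * κ * κ - + 10 * κ
  ∑∑B² = trans (sym (tr-pow-2 toℤ-sym)) (trans (traces 2)
    (trans (tr-pow-2 (friendshipMatrix-sym k)) (tr-friendship² k)))

  adj-by-dist : ∀ {u v} → D u v ≡ 1 → A u v ≡ 1ℤ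
  adj-by-dist e = T⇒adjacency≡1 H (dist≡1⇒adj e)

  module DiameterTwo (D≤2 : ∀ u v → D u v ℕ.≤ 2) where

    trichotomy : ∀ u v → u ≡ v ⊎ D u v ≡ 1 ⊎ (D u v ≡ 2 × u ≢ v)
    trichotomy u v = go (D u v) refl (D≤2 u v)
      where
      go : ∀ d → D u v ≡ d → d ℕ.≤ 2 → u ≡ v ⊎ D u v ≡ 1 ⊎ (D u v ≡ 2 × u ≢ v)
      go 0 e _ = inj₁ (dist≡0⇒≡ e)
      go 1 e _ = inj₂ (inj₁ e)
      go 2 e _ = inj₂ (inj₂ (e , λ { refl → 0≢2 (trans (sym (dist-refl u)) e) }))
        where
        0≢2 : ¬ (0 ≡ 2)
        0≢2 ()
      go (suc (suc (suc _))) _ (ℕ.s≤s (ℕ.s≤s ()))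

    dist≡2⇒nonadjacent : ∀ {u v} → D u v ≡ 2 → A u v ≡ 0ℤ
    dist≡2⇒nonadjacent {u} {v} e = go (adj H u v) refl
      where
      go : ∀ b → adj H u v ≡ b → A u v ≡ 0ℤ
      go false uv = cong (if_then 1ℤ else 0ℤ) uv
      go true  uv with trans (sym e) (adj⇒dist≡1 (≡true⇒T uv))
      ... | ()

    adj⇒≢ : ∀ {u v} → D u v ≡ 1 → u ≢ v
    adj⇒≢ {u} e refl with trans (sym (dist-refl u)) e
    ... | ()

    B≡ : ∀ u v → B u v ≡ + 2 + - + 2 * identity u v + - 1ℤ * A u v
    B≡ u v = go (trichotomy u v)
      where
      go : u ≡ v ⊎ D u v ≡ 1 ⊎ (D u v ≡ 2 × u ≢ v) → B u v ≡ + 2 + - + 2 * identity u v + - 1ℤ * A u v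
      go (inj₁ refl) = trans (cong +_ (dist-refl u))
        (sym (cong₂ (λ x y → + 2 + - + 2 * x + - 1ℤ * y) (identity-refl u) (adjacency-irrefl H u)))
      go (inj₂ (inj₁ e)) = trans (cong +_ e)
        (sym (cong₂ (λ x y → + 2 + - + 2 * x + - 1ℤ * y) (identity-≢ (adj⇒≢ e)) (adj-by-dist e)))
      go (inj₂ (inj₂ (e , u≢v))) = trans (cong +_ e)
        (sym (cong₂ (λ x y → + 2 + - + 2 * x + - 1ℤ * y) (identity-≢ u≢v) (dist≡2⇒nonadjacent e)))

    B²≡ : ∀ u v → B u v * B u v ≡ + 4 + - + 4 * identity u v + - + 3 * A u v
    B²≡ u v = go (trichotomy u v)
      where
      go : u ≡ v ⊎ D u v ≡ 1 ⊎ (D u v ≡ 2 × u ≢ v) → B u v * B u v ≡ + 4 + - + 4 * identity u v + - + 3 * A u v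
      go (inj₁ refl) = trans (cong (λ d → + d * + d) (dist-refl u))
        (sym (cong₂ (λ x y → + 4 + - + 4 * x + - + 3 * y) (identity-refl u) (adjacency-irrefl H u)))
      go (inj₂ (inj₁ e)) = trans (cong (λ d → + d * + d) e)
        (sym (cong₂ (λ x y → + 4 + - + 4 * x + - + 3 * y) (identity-≢ (adj⇒≢ e)) (adj-by-dist e)))
      go (inj₂ (inj₂ (e , u≢v))) = trans (cong (λ d → + d * + d) e)
        (sym (cong₂ (λ x y → + 4 + - + 4 * x + - + 3 * y) (identity-≢ u≢v) (dist≡2⇒nonadjacent e)))

    diameter : ∀ {u v} → u ≢ v → A u v ≡ 1ℤ ⊎ ∃ λ w → A u w ≡ 1ℤ × A w v ≡ 1ℤ
    diameter {u} {v} u≢v = go (trichotomy u v)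
      where
      go : u ≡ v ⊎ D u v ≡ 1 ⊎ (D u v ≡ 2 × u ≢ v) → A u v ≡ 1ℤ ⊎ ∃ λ w → A u w ≡ 1ℤ × A w v ≡ 1ℤ
      go (inj₁ e) = ⊥-elim (u≢v e)
      go (inj₂ (inj₁ e)) = inj₁ (adj-by-dist e)
      go (inj₂ (inj₂ (e , _))) = let w , uw , wv = dist-descend e in
        inj₂ (w , T⇒adjacency≡1 H uw , adj-by-dist wv)

    -- Off the diagonal the distances are 1 and 2, so the sum of their squares is
    -- `4n(n - 1) - 3 ∑∑ A` with `n = 2k + 1`, and `∑∑B²` gives its value.
    ∑deg : ∑∑ A ≡ + 3 * + ν
    ∑deg = ℤ.*-cancelˡ-≡ (+ 3) (∑∑ A) (+ 3 * + ν) (trans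
      (isolate (+ 16 * κ * κ - + 10 * κ) (+ suc ν * (+ suc ν * + 4) + - + 4 * (+ suc ν * 1ℤ)) (∑∑ A) (trans (sym ∑∑B²) total))
      (trans (cong (λ m → ((1ℤ + m) * ((1ℤ + m) * + 4) + - + 4 * ((1ℤ + m) * 1ℤ)) - (+ 16 * κ * κ - + 10 * κ)) (pos-m k))
        (trans (solved κ) (cong (λ m → + 3 * (+ 3 * m)) (sym (pos-m k))))))
      where
      total : ∑∑ (λ i j → B i j * B i j) ≡ + suc ν * (+ suc ν * + 4) + - + 4 * (+ suc ν * 1ℤ) + - + 3 * ∑∑ A
      total = begin
        ∑∑ (λ i j → B i j * B i j)
          ≡⟨ ∑∑-cong B²≡ ⟩
        ∑∑ (λ i j → + 4 + - + 4 * identity i j + - + 3 * A i j)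
          ≡⟨ ∑∑-+* (- + 3) (λ i j → + 4 + - + 4 * identity i j) A ⟩
        ∑∑ {suc ν} (λ i j → + 4 + - + 4 * identity i j) + - + 3 * ∑∑ A
          ≡⟨ cong (_+ - + 3 * ∑∑ A) (trans (∑∑-+* {suc ν} (- + 4) (λ _ _ → + 4) identity)
               (cong₂ (λ x y → x + - + 4 * y)
                 (trans (∑-cong {suc ν} λ _ → ∑-const (suc ν) (+ 4)) (∑-const (suc ν) (+ suc ν * + 4)))
                 (trans (∑-cong {suc ν} ∑-identity) (∑-const (suc ν) 1ℤ)))) ⟩
        + suc ν * (+ suc ν * + 4) + - + 4 * (+ suc ν * 1ℤ) + - + 3 * ∑∑ A ∎
      isolate : ∀ l r a → l ≡ r + - + 3 * a → + 3 * a ≡ r - l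
      isolate l r a e = trans (move r a) (cong (_-_ r) (sym e))
        where
        move : ∀ r a → + 3 * a ≡ r - (r + - + 3 * a)
        move = solve-∀
      solved : ∀ k → let m = + 2 * k in
        ((1ℤ + m) * ((1ℤ + m) * + 4) + - + 4 * ((1ℤ + m) * 1ℤ)) - (+ 16 * k * k - + 10 * k) ≡ + 3 * (+ 3 * m)
      solved = solve-∀

    -- On vectors orthogonal to 1 the distance matrix acts as -2 - A, and
    -- (x + 1)(x + 3) = (x + 2)² - 1.
    N-form-balanced : ∀ z → ∑ z ≡ 0ℤ → ⟨ z , N B z ⟩ ≡ ⟨ A ∙ z , A ∙ z ⟩ - ⟨ z , z ⟩
    N-form-balanced z ∑z = begin
      ⟨ z , N B z ⟩
        ≡⟨ ⟨⟩-linear₃ (+ 4) (+ 3) (B ∙ B ∙ z) (B ∙ z) z z ⟩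
      ⟨ z , B ∙ B ∙ z ⟩ + + 4 * ⟨ z , B ∙ z ⟩ + + 3 * ⟨ z , z ⟩
        ≡⟨ cong₂ (λ s t → s + + 4 * t + + 3 * ⟨ z , z ⟩)
             (trans (sym (⟨⟩-self-adjoint B toℤ-sym z (B ∙ z))) (trans (⟨⟩-cong Bz Bz)
               (trans (∑-cong λ i → square (y i)) (norm-+ (+ 2) w z))))
             (trans (⟨⟩-cong {u = z} (λ _ → refl) Bz) (trans (⟨⟩-scale (- 1ℤ) z y)
               (cong (- 1ℤ *_) (⟨⟩-linearʳ (+ 2) z w z)))) ⟩
      (⟨ w , w ⟩ + + 2 * + 2 * ⟨ w , z ⟩ + + 2 * + 2 * ⟨ z , z ⟩)
        + + 4 * (- 1ℤ * (⟨ z , w ⟩ + + 2 * ⟨ z , z ⟩)) + + 3 * ⟨ z , z ⟩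
        ≡⟨ cong (λ t → (⟨ w , w ⟩ + + 2 * + 2 * t + + 2 * + 2 * ⟨ z , z ⟩)
             + + 4 * (- 1ℤ * (⟨ z , w ⟩ + + 2 * ⟨ z , z ⟩)) + + 3 * ⟨ z , z ⟩) (⟨⟩-comm w z) ⟩
      (⟨ w , w ⟩ + + 2 * + 2 * ⟨ z , w ⟩ + + 2 * + 2 * ⟨ z , z ⟩)
        + + 4 * (- 1ℤ * (⟨ z , w ⟩ + + 2 * ⟨ z , z ⟩)) + + 3 * ⟨ z , z ⟩
        ≡⟨ solved ⟨ w , w ⟩ ⟨ z , w ⟩ ⟨ z , z ⟩ ⟩
      ⟨ w , w ⟩ - ⟨ z , z ⟩ ∎
      where
      w y : Fin (suc ν) → ℤ
      w = A ∙ z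
      y i = w i + + 2 * z i
      square : ∀ x → (- 1ℤ * x) * (- 1ℤ * x) ≡ x * x
      square = solve-∀
      solved : ∀ w p z → (w + + 2 * + 2 * p + + 2 * + 2 * z) + + 4 * (- 1ℤ * (p + + 2 * z)) + + 3 * z ≡ w - z
      solved = solve-∀
      Bz : ∀ i → (B ∙ z) i ≡ - 1ℤ * y i
      Bz i = begin
        ⟨ B i , z ⟩
          ≡⟨ trans (⟨⟩-cong {v = z} (B≡ i) (λ _ → refl)) (⟨⟩-comm (λ j → + 2 + - + 2 * identity i j + - 1ℤ * A i j) z) ⟩
        ⟨ z , (λ j → + 2 + - + 2 * identity i j + - 1ℤ * A i j) ⟩
          ≡⟨ ⟨⟩-linear₃ (- + 2) (- 1ℤ) (λ _ → + 2) (identity i) (A i) z ⟩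
        ⟨ z , (λ _ → + 2) ⟩ + - + 2 * ⟨ z , identity i ⟩ + - 1ℤ * ⟨ z , A i ⟩
          ≡⟨ cong₂ (λ s t → s + - + 2 * t + - 1ℤ * ⟨ z , A i ⟩)
               (trans (sym (*-distribʳ-sum (+ 2) z)) (cong (_* + 2) ∑z))
               (trans (⟨⟩-comm z (identity i)) (∑-identityˡ i z)) ⟩
        0ℤ * + 2 + - + 2 * z i + - 1ℤ * ⟨ z , A i ⟩
          ≡⟨ trans (cong (λ t → 0ℤ * + 2 + - + 2 * z i + - 1ℤ * t) (⟨⟩-comm z (A i))) (collect (z i) (w i)) ⟩
        - 1ℤ * y i ∎
        where
        collect : ∀ z w → 0ℤ * + 2 + - + 2 * z + - 1ℤ * w ≡ - 1ℤ * (w + + 2 * z)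
        collect = solve-∀

  -- A shortest path of length three would carry the vector (2, 1, -1, -2), on which
  -- the form of D + 3 is -4.
  no-distance-3 : (∀ z → 0ℤ ℤ.≤ ⟨ z , (λ i → (B ∙ z) i + + 3 * z i) ⟩) → ∀ {s t} → D s t ≢ 3
  no-distance-3 nonneg {s} {t} st = negative (subst (0ℤ ℤ.≤_) form (nonneg z))
    where
    negative : ¬ (0ℤ ℤ.≤ - + 4)
    negative ()
    a b : Fin (suc ν)
    first = dist-descend st
    a = proj₁ first
    at : D a t ≡ 2
    at = proj₂ (proj₂ first)
    sa : D s a ≡ 1
    sa = adj⇒dist≡1 (proj₁ (proj₂ first))
    second = dist-descend at
    b = proj₁ second
    bt : D b t ≡ 1
    bt = proj₂ (proj₂ second)
    ab : D a b ≡ 1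
    ab = adj⇒dist≡1 (proj₁ (proj₂ second))
    sb : D s b ≡ 2
    sb = ℕ.≤-antisym
      (subst (λ d → D s b ℕ.≤ suc d) ab (dist-step b (proj₁ (proj₂ first))))
      (ℕ.s≤s⁻¹ (subst (ℕ._≤ suc (D s b)) st (dist-stepʳ s (dist≡1⇒adj bt))))
    apart : ∀ {u v d} → D u v ≡ suc d → u ≢ v
    apart {u} e refl with trans (sym (dist-refl u)) e
    ... | ()
    f g z X : Fin (suc ν) → ℤ
    -- The path on four vertices has the distance eigenvalue -2 - √2 < -3, with eigenvector (1 + √2,
    -- 1, -1, -1 - √2); the vector used here is an integral approximation of it.
    f = + 2 at s and - + 2 at t
    g = 1ℤ at a and - 1ℤ at b
    z i = f i + 1ℤ * g i
    X i = (B ∙ z) i + + 3 * z i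
    X≡ : ∀ i {ds dt da db es et ea eb} → B i s ≡ ds → B i t ≡ dt → B i a ≡ da → B i b ≡ db →
      identity s i ≡ es → identity t i ≡ et → identity a i ≡ ea → identity b i ≡ eb →
      X i ≡ (+ 2 * ds + - + 2 * dt + 1ℤ * (1ℤ * da + - 1ℤ * db)) + + 3 * (+ 2 * es + - + 2 * et + 1ℤ * (1ℤ * ea + - 1ℤ * eb))
    X≡ i refl refl refl refl refl refl refl refl = cong (_+ + 3 * z i) (trans (∙-linear B 1ℤ f g i)
      (cong₂ (λ x y → x + 1ℤ * y)
        (trans (⟨⟩-comm (B i) f) (⟨at,⟩ (+ 2) s (- + 2) t (B i)))
        (trans (⟨⟩-comm (B i) g) (⟨at,⟩ 1ℤ a (- 1ℤ) b (B i)))))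
    d : ∀ {u v d} → D u v ≡ d → B u v ≡ + d
    d e = cong +_ e
    d′ : ∀ {u v d} → D u v ≡ d → B v u ≡ + d
    d′ {u} {v} e = trans (toℤ-sym v u) (cong +_ e)
    0d : ∀ u → B u u ≡ 0ℤ
    0d u = cong +_ (dist-refl u)
    0i : ∀ {u v m} → D u v ≡ suc m → identity u v ≡ 0ℤ
    0i e = identity-≢ (apart e)
    0i′ : ∀ {u v m} → D u v ≡ suc m → identity v u ≡ 0ℤ
    0i′ e = identity-≢ (apart e ∘ sym)
    form : ⟨ z , X ⟩ ≡ - + 4
    form = trans (⟨⟩-linearˡ 1ℤ f g X) (trans
      (cong₂ (λ x y → x + 1ℤ * y) (⟨at,⟩ (+ 2) s (- + 2) t X) (⟨at,⟩ 1ℤ a (- 1ℤ) b X))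
      (cong₂ (λ x y → x + 1ℤ * y)
        (cong₂ (λ x y → + 2 * x + - + 2 * y)
          (X≡ s (0d s) (d st) (d sa) (d sb) (identity-refl s) (0i′ st) (0i′ sa) (0i′ sb))
          (X≡ t (d′ st) (0d t) (d′ at) (d′ bt) (0i st) (identity-refl t) (0i at) (0i bt)))
        (cong₂ (λ x y → 1ℤ * x + - 1ℤ * y)
          (X≡ a (d′ sa) (d at) (0d a) (d ab) (0i sa) (0i′ at) (identity-refl a) (0i′ ab))
          (X≡ b (d′ sb) (d bt) (d′ ab) (0d b) (0i sb) (0i′ bt) (0i ab) (identity-refl b)))))

  -- Along a shortest path the distance to `v` falls by one at each step, so a distance above 3
  -- leads to one equal to 3.
  dist≤2 : (∀ {s t} → D s t ≢ 3) → ∀ u v → D u v ℕ.≤ 2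
  dist≤2 ≢3 u v = go (D u v) refl
    where
    go : ∀ d {u} → D u v ≡ d → d ℕ.≤ 2
    go 0 _ = ℕ.z≤n
    go 1 _ = ℕ.s≤s ℕ.z≤n
    go 2 _ = ℕ.s≤s (ℕ.s≤s ℕ.z≤n)
    go 3 e = ⊥-elim (≢3 e)
    go (suc (suc (suc (suc d)))) e = ⊥-elim (ℕ.<⇒≱ {2} (ℕ.s≤s (ℕ.s≤s (ℕ.s≤s ℕ.z≤n)))
      (go (suc (suc (suc d))) (proj₂ (proj₂ (dist-descend e)))))

-- The cases k ≥ 2 and k = 1

windmill-large : ∀ j {H D} (isD : IsDistanceMatrix H D) →
  (∀ p → tr (pow (toℤ D) p) ≡ tr (pow (friendshipMatrix (2 ℕ.+ j)) p)) → Windmill H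
windmill-large j {H} {D} isD traces = record
  { centre        = proj₁ dominating-vertex
  ; centre-adj    = proj₂ dominating-vertex
  ; others-degree = others-have-degree-two (proj₂ dominating-vertex)
  }
  where
  open Cospectral {2 ℕ.+ j} isD traces
  -- `+ suc j` is `k - 1`; its positivity is where `k ≥ 2` enters.
  open Positivity (toℤ D) (Distance.toℤ-sym isD) (+ suc j) _ annihilated
  open DiameterTwo (dist≤2 (no-distance-3 A+3-nonneg))
  open Expanding (adjacency H) (adjacency-sym H) (adjacency-01 H) (adjacency-irrefl H)
    (ℕ.s≤s (ℕ.s≤s ℕ.z≤n)) diameter ∑deg
    (λ z ∑z → ℤ.0≤i-j⇒j≤i (subst (0ℤ ℤ.≤_) (N-form-balanced z ∑z) (N-nonneg z)))

-- The sum of the squared distances is 6, and each of the six ordered pairs of distinct vertices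
-- contributes at least 1, so all these distances are 1 and `H` is a triangle.
windmill-triangle : ∀ {H D} (isD : IsDistanceMatrix H D) →
  (∀ p → tr (pow (toℤ D) p) ≡ tr (pow (friendshipMatrix 1) p)) → Windmill H
windmill-triangle {H} {D} isD traces = record
  { centre        = zero
  ; centre-adj    = λ v v≢c → complete′ (v≢c ∘ sym)
  ; others-degree = λ {v} _ → degree v
  }
  where
  open Cospectral {1} isD traces
  open Distance isD
  f : Fin 3 → Fin 3 → ℤ
  f u v = toℤ D u v * toℤ D u v + - 1ℤ * (1ℤ + - 1ℤ * identity u v)
  1≤square : ∀ d → d ≢ 0 → 1ℤ ℤ.≤ + d * + d
  1≤square zero    ≢0 = ⊥-elim (≢0 refl)
  1≤square (suc d) _  = ℤ.+≤+ (ℕ.s≤s ℕ.z≤n)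
  0≤f : ∀ u v → 0ℤ ℤ.≤ f u v
  0≤f u v = go (u ≟ᶠ v)
    where
    go : Dec (u ≡ v) → 0ℤ ℤ.≤ f u v
    go (yes refl) = ℤ.≤-reflexive (sym (cong₂ (λ d e → + d * + d + - 1ℤ * (1ℤ + - 1ℤ * e)) (dist-refl u) (identity-refl u)))
    go (no u≢v) = subst (0ℤ ℤ.≤_) (sym (cong (λ e → toℤ D u v * toℤ D u v + - 1ℤ * (1ℤ + - 1ℤ * e)) (identity-≢ u≢v)))
      (ℤ.i≤j⇒0≤j-i (1≤square (D u v) (u≢v ∘ dist≡0⇒≡)))
  ∑∑f : ∑∑ f ≡ 0ℤ
  ∑∑f = trans (∑∑-+* (- 1ℤ) (λ u v → toℤ D u v * toℤ D u v) (λ u v → 1ℤ + - 1ℤ * identity u v))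
    (cong (_+ - + 6) ∑∑B²)
  f≡0 : ∀ u v → f u v ≡ 0ℤ
  f≡0 u v = ∑≡0⇒≡0 (0≤f u) (∑≡0⇒≡0 (λ u → ∑-nonneg (0≤f u)) ∑∑f u) v
  square≡1 : ∀ d → + d * + d + - 1ℤ * (1ℤ + - 1ℤ * 0ℤ) ≡ 0ℤ → d ≡ 1
  square≡1 1 _ = refl
  complete′ : ∀ {u v} → u ≢ v → adjacency H u v ≡ 1ℤ
  complete′ {u} {v} u≢v = adj-by-dist (square≡1 (D u v)
    (trans (cong (λ e → toℤ D u v * toℤ D u v + - 1ℤ * (1ℤ + - 1ℤ * e)) (sym (identity-≢ u≢v))) (f≡0 u v)))
  degree : ∀ v → ∑ (adjacency H v) ≡ + 2
  degree v = trans (∑-cong λ u → row u (v ≟ᶠ u)) (trans (∑-+* {3} (- 1ℤ) (λ _ → 1ℤ) (identity v))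
    (cong (λ s → + 3 + - 1ℤ * s) (∑-identity v)))
    where
    row : ∀ u → Dec (v ≡ u) → adjacency H v u ≡ 1ℤ + - 1ℤ * identity v u
    row u (yes refl) = trans (adjacency-irrefl H v) (cong (λ x → 1ℤ + - 1ℤ * x) (sym (identity-refl v)))
    row u (no v≢u) = trans (complete′ v≢u) (cong (λ x → 1ℤ + - 1ℤ * x) (sym (identity-≢ v≢u)))

-- Windmills are friendship graphs

lookup-injective : ∀ {a} {A : Set a} {xs : List A} → Unique xs → ∀ i j → List.lookup xs i ≡ List.lookup xs j → i ≡ j
lookup-injective (x∉ ∷ u) zero    zero    e = refl
lookup-injective (x∉ ∷ u) zero    (suc j) e = ⊥-elim (All.lookup x∉ (∈-lookup j) e)
lookup-injective (x∉ ∷ u) (suc i) zero    e = ⊥-elim (All.lookup x∉ (∈-lookup i) (sym e))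
lookup-injective (x∉ ∷ u) (suc i) (suc j) e = cong suc (lookup-injective u i j e)

module WindmillIso {n} {H : Graph n} (W : Windmill H) where
  open Windmill W renaming (centre to c)

  private
    A = adjacency H

    centre-adjʳ : ∀ {v} → v ≢ c → A v c ≡ 1ℤ
    centre-adjʳ {v} v≢c = trans (adjacency-sym H v c) (centre-adj v v≢c)

    Partner : Fin n → Fin n → Set
    Partner v u = c ≢ u × A v u ≡ 1ℤ × (∀ w → A v w ≡ identity c w + identity u w)

    partner : ∀ v → ∃ λ u → v ≢ c → Partner v u
    partner v = choose (v ≟ᶠ c)
      where
      choose : Dec (v ≡ c) → ∃ λ u → v ≢ c → Partner v u
      -- By convention the centre is its own partner, which makes `σ` total; the properties of `σ`
      -- are stated off the centre.
      choose (yes e)  = c , λ v≢c → ⊥-elim (v≢c e)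
      choose (no v≢c) = let u , p = ∑≡2⇒pair (adjacency-01 H v) (others-degree v≢c) (centre-adjʳ v≢c) in u , λ _ → p

    σ : Fin n → Fin n
    σ v = proj₁ (partner v)

    σ≢c : ∀ {v} → v ≢ c → σ v ≢ c
    σ≢c {v} v≢c e = proj₁ (proj₂ (partner v) v≢c) (sym e)

    σ-adj : ∀ {v} → v ≢ c → A v (σ v) ≡ 1ℤ
    σ-adj {v} v≢c = proj₁ (proj₂ (proj₂ (partner v) v≢c))

    adj⇒σ : ∀ {v w} → v ≢ c → w ≢ c → A v w ≡ 1ℤ → w ≡ σ v
    adj⇒σ {v} {w} v≢c w≢c vw = pick (pair-member (trans (sym (proj₂ (proj₂ (proj₂ (partner v) v≢c)) w)) vw))
      where
      pick : w ≡ c ⊎ w ≡ σ v → w ≡ σ v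
      pick (inj₁ e) = ⊥-elim (w≢c e)
      pick (inj₂ e) = e

    σ-involutive : ∀ {v} → v ≢ c → σ (σ v) ≡ v
    σ-involutive {v} v≢c = sym (adj⇒σ (σ≢c v≢c) v≢c (trans (adjacency-sym H (σ v) v) (σ-adj v≢c)))

    σ≢id : ∀ {v} → v ≢ c → v ≢ σ v
    σ≢id {v} v≢c e with trans (sym (adjacency-irrefl H v)) (trans (cong (A v) e) (σ-adj v≢c))
    ... | ()

  -- One vertex is chosen from each pair of partners.
  module FromRepresentatives {r} (rep : Fin r → Fin n)
    (rep-injective : ∀ {p q} → rep p ≡ rep q → p ≡ q)
    (rep≢c : ∀ q → rep q ≢ c) (rep<σ : ∀ q → rep q < σ (rep q))
    (rep-onto : ∀ {v} → v ≢ c → v < σ v → ∃ λ q → rep q ≡ v) where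

    private
      side : Fin 2 → Fin n → Fin n
      side zero       v = v
      side (suc zero) v = σ v

      outer : Fin r → Fin 2 → Fin n
      outer q s = side s (rep q)

      to : Fin (1 ℕ.+ r ℕ.* 2) → Fin n
      to zero    = c
      to (suc x) = outer (quotient {r} 2 x) (remainder {r} 2 x)

      outer≢c : ∀ q s → outer q s ≢ c
      outer≢c q zero       = rep≢c q
      outer≢c q (suc zero) = σ≢c (rep≢c q)

      -- Representatives are the smaller partners: the equation would make each of `rep p` and
      -- `rep q` smaller than the other.
      rep≢σrep : ∀ p q → rep p ≢ σ (rep q)
      rep≢σrep p q e = <-irrefl refl (<-trans (subst (rep q <_) (sym e) (rep<σ q))
        (subst (rep p <_) (trans (cong σ e) (σ-involutive (rep≢c q))) (rep<σ p)))

      σ-injective : ∀ p q → σ (rep p) ≡ σ (rep q) → p ≡ q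
      σ-injective p q e = rep-injective (trans (sym (σ-involutive (rep≢c p)))
        (trans (cong σ e) (σ-involutive (rep≢c q))))

      outer-injective : ∀ p s q t → outer p s ≡ outer q t → p ≡ q × s ≡ t
      outer-injective p zero       q zero       e = rep-injective e , refl
      outer-injective p zero       q (suc zero) e = ⊥-elim (rep≢σrep p q e)
      outer-injective p (suc zero) q zero       e = ⊥-elim (rep≢σrep q p (sym e))
      outer-injective p (suc zero) q (suc zero) e = σ-injective p q e , refl

      to-injective : ∀ x y → to x ≡ to y → x ≡ y
      to-injective zero    zero    e = refl
      to-injective zero    (suc y) e = ⊥-elim (outer≢c (quotient {r} 2 y) (remainder {r} 2 y) (sym e))
      to-injective (suc x) zero    e = ⊥-elim (outer≢c (quotient {r} 2 x) (remainder {r} 2 x) e)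
      to-injective (suc x) (suc y) e =
        let q≡ , s≡ = outer-injective (quotient {r} 2 x) (remainder {r} 2 x) (quotient {r} 2 y) (remainder {r} 2 y) e
        in cong suc (trans (sym (combine-remQuot {r} 2 x)) (trans (cong₂ combine q≡ s≡) (combine-remQuot {r} 2 y)))

      to-combine : ∀ q s → to (suc (combine q s)) ≡ outer q s
      to-combine q s = cong (λ p → outer (proj₁ p) (proj₂ p)) (remQuot-combine q s)

      to-surjective : ∀ v → ∃ λ x → to x ≡ v
      to-surjective v = locate (v ≟ᶠ c)
        where
        locate : Dec (v ≡ c) → ∃ λ x → to x ≡ v
        locate (yes e) = zero , sym e
        locate (no v≢c) with <-cmp v (σ v)
        ... | tri≈ _ e _ = ⊥-elim (σ≢id v≢c e)
        ... | tri< v<σv _ _ = let q , e = rep-onto v≢c v<σv in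
                suc (combine q zero) , trans (to-combine q zero) e
        ... | tri> _ _ σv<v =
                let q , e = rep-onto (σ≢c v≢c) (subst (σ v <_) (sym (σ-involutive v≢c)) σv<v) in
                suc (combine q (suc zero)) , trans (to-combine q (suc zero)) (trans (cong σ e) (σ-involutive v≢c))

      from : Fin n → Fin (1 ℕ.+ r ℕ.* 2)
      from v = proj₁ (to-surjective v)

      to-from : ∀ v → to (from v) ≡ v
      to-from v = proj₂ (to-surjective v)

      from-to : ∀ x → from (to x) ≡ x
      from-to x = to-injective (from (to x)) x (to-from (to x))

      outer-nonadjacent : ∀ p s q t → p ≢ q → A (outer p s) (outer q t) ≢ 1ℤ
      outer-nonadjacent p s q t p≢q e = distinct s t (adj⇒σ (outer≢c p s) (outer≢c q t) e)
        where
        distinct : ∀ s t → outer q t ≡ σ (outer p s) → ⊥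
        distinct zero       zero       e = rep≢σrep q p e
        distinct zero       (suc zero) e = p≢q (sym (σ-injective q p e))
        distinct (suc zero) zero       e = p≢q (sym (rep-injective (trans e (σ-involutive (rep≢c p)))))
        distinct (suc zero) (suc zero) e = rep≢σrep p q (sym (trans e (σ-involutive (rep≢c p))))

      ≢1⇒false : ∀ {u v} → A u v ≢ 1ℤ → adj H u v ≡ false
      ≢1⇒false {u} {v} ≢1 with adj H u v
      ... | true  = ⊥-elim (≢1 refl)
      ... | false = refl

      complete-2-adj : ∀ q s t → not (does (s ≟ᶠ t)) ≡ adj H (outer q s) (outer q t)
      complete-2-adj q zero       zero       = sym (adj-irrefl H (rep q))
      complete-2-adj q zero       (suc zero) = sym (adjacency≡1⇒adj H (σ-adj (rep≢c q)))
      complete-2-adj q (suc zero) zero       = sym (trans (adj-sym H (σ (rep q)) (rep q))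
                                                      (adjacency≡1⇒adj H (σ-adj (rep≢c q))))
      complete-2-adj q (suc zero) (suc zero) = sym (adj-irrefl H (σ (rep q)))

      to-adj : ∀ x y → adj (friendship r) x y ≡ adj H (to x) (to y)
      to-adj zero    zero    = sym (adj-irrefl H c)
      to-adj zero    (suc y) = sym (adjacency≡1⇒adj H (centre-adj (to (suc y)) (outer≢c (quotient {r} 2 y) (remainder {r} 2 y))))
      to-adj (suc x) zero    = sym (adjacency≡1⇒adj H (centre-adjʳ (outer≢c (quotient {r} 2 x) (remainder {r} 2 x))))
      to-adj (suc x) (suc y) = outer-adj (quotient {r} 2 x) (remainder {r} 2 x) (quotient {r} 2 y) (remainder {r} 2 y)
        where
        outer-adj : ∀ p s q t → does (p ≟ᶠ q) ∧ not (does (s ≟ᶠ t)) ≡ adj H (outer p s) (outer q t)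
        outer-adj p s q t with p ≟ᶠ q
        ... | yes refl = complete-2-adj p s t
        ... | no p≢q   = sym (≢1⇒false (outer-nonadjacent p s q t p≢q))

    vertices : Fin n ↔ Fin (1 ℕ.+ r ℕ.* 2)
    vertices = mk↔ₛ′ from to from-to to-from

    iso : H ≅ friendship r
    iso = vertices , λ u v → trans (to-adj (from u) (from v)) (cong₂ (adj H) (to-from u) (to-from v))

  -- Each pair of partners is represented by its smaller vertex in the order of `Fin n`. The number
  -- of triangles arises as the length of a list; comparing numbers of vertices identifies it with
  -- `k` afterwards.
  windmill≅friendship : ∃ λ r → H ≅ friendship r
  windmill≅friendship = length reps , FromRepresentatives.iso (List.lookup reps)
    (λ {p} {q} → lookup-injective (filter⁺ representative? (allFin⁺ n)) p q)
    (λ q → proj₁ (is-representative q)) (λ q → proj₂ (is-representative q))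
    λ {v} v≢c v<σv → let v∈ = ∈-filter⁺ representative? (∈-allFin v) (v≢c , v<σv) in
      index v∈ , sym (lookup-index v∈)
    where
    representative? : ∀ v → Dec (v ≢ c × v < σ v)
    representative? v = ¬? (v ≟ᶠ c) ×-dec (v <? σ v)
    reps = filter representative? (allFin n)
    is-representative : ∀ q → let v = List.lookup reps q in v ≢ c × v < σ v
    is-representative q = proj₂ (∈-filter⁻ representative? {xs = allFin n} (∈-lookup q))

windmill : ∀ k → 1 ≤ k → ∀ {H : Graph (1 ℕ.+ k ℕ.* 2)} {D} (isD : IsDistanceMatrix H D) →
  (∀ p → tr (pow (toℤ D) p) ≡ tr (pow (friendshipMatrix k) p)) → Windmill H
windmill (suc zero)    _ = windmill-triangle
windmill (suc (suc j)) _ = windmill-large j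

corollary4p4 : ∀ (k : ℕ) → 1 ≤ k → ∀ {n : ℕ} (H : Graph n) → Connected H →
    SameDistanceSpectrum H (friendship k) → H ≅ friendship k
corollary4p4 k 1≤k {n} H _ (λs , μs , (D , isD , specD) , (D′ , isD′ , specD′) , λs↭μs) =
  conclude (spectrum-size λs μs λs↭μs) H λs isD specD λs↭μs
  where
  -- Generalised over the order of `H`, so that the equality of orders can be matched with `refl`.
  conclude : ∀ {n} → n ≡ 1 ℕ.+ k ℕ.* 2 → ∀ (H : Graph n) λs {D} → IsDistanceMatrix H D →
    IsSpectrum (λ u v → fromℕᴿ (D u v)) λs → toList λs ↭ᴿ toList μs → H ≅ friendship k
  conclude refl H λs {D} isD specD λs↭μs = subst (λ r → H ≅ friendship r) (sym k≡r) (proj₂ found)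
    where
    traces : ∀ p → tr (pow (toℤ D) p) ≡ tr (pow (friendshipMatrix k) p)
    traces p = trans
      (trace-pow-agree (toℤ D) (toℤ D′) (λ m → det-pencil-agree m D D′ specD specD′ λs↭μs) p)
      (∑-cong λ i → pow-cong (friendship-dist k isD′) p i i)
    found : ∃ λ r → H ≅ friendship r
    found = WindmillIso.windmill≅friendship (windmill k 1≤k isD traces)
    k≡r : k ≡ proj₁ found
    k≡r = ℕ.*-cancelʳ-≡ k (proj₁ found) 2 (ℕ.suc-injective (↔⇒≡ (proj₁ (proj₂ found))))
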